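{- In the hyperelliptic setting below ($p=2$), for $i,j\in\{1,\dots,g\}$: (1) $c_{o_0,e_0}(\xi_i)=-1$; (2) $c_{o_i,e_0}^2=c_{e_i,e_0}^2=c_{\xi_i}$; (3) $c_{o_i,e_0}=c_{o_i,e_i}\,c_{e_i,e_0}$; (4) $c_{o_i,e_i}(\xi_j)=(-1)^{\delta_{ij}}$, with $\delta_{ij}$ the Kronecker delta.
   Context: $\mathbb{K}$ is a complete non-Archimedean valued field, algebraically closed, of characteristic $0$. $\Gamma\subset\mathrm{PGL}(2,\mathbb{K})$ is a Schottky group of rank $g$ with set of ordinary points $\Omega\ni\infty$. For $a,b\in\Omega$, $\Theta_{a,b}(z)=\prod_{\gamma\in\Gamma}\frac{z-\gamma a}{z-\gamma b}$, $c_{a,b}:\Gamma\to\mathbb{K}^*$ the homomorphism with $\Theta_{a,b}(\gamma z)=c_{a,b}(\gamma)\Theta_{a,b}(z)$, and $c_\beta:=c_{a,\beta a}$ for $\beta\in\Gamma$ (independent of $a$). Hyperelliptic setting: $\sigma_0$ normalizes $\Gamma$, $\sigma_0^2=\mathrm{id}$, $\gamma\sigma_0\gamma\sigma_0^{ -1}\in[\Gamma,\Gamma]$ for all $\gamma\in\Gamma$, $\Gamma_0=\langle\Gamma,\sigma_0\rangle$ is the free product of $\langle\sigma_0\rangle,\dots,\langle\sigma_g\rangle$ with each $\sigma_i$ of order $2$, and $\xi_i=\sigma_i\sigma_0$ ($i=1,\dots,g$) form a free basis of $\Gamma$. The fixed points $o_i,e_i$ of $\sigma_i$ lie in $\Om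ega$.
   Formalization: Products of transformations are read left to right (ξᵢ = first σᵢ, then σ₀); with the usual composition of left-acting maps, c_{ξᵢ} in (2) must be replaced by its inverse, since (2) as printed then fails (e.g. Γ generated by z ↦ qz, σ₀z = 1/z, σ₁z = q/z). -}

module Defs where

open import Level using (Level; _⊔_) renaming (suc to lsuc)
open import Algebra.Bundles using (CommutativeRing; Group; RawSemiring; Semiring)
open import Algebra.Construct.NaturalChoice.Max as Max using ()
open import Algebra.Definitions.RawMonoid as Multiple using ()
open import Algebra.Definitions.RawSemiring as Power using ()
import Algebra.Solver.Ring.NaturalCoefficients.Default as NaturalCoefficients
open import Data.Bool.Base using (if_then_else_)
open import Data.Fin.Base using (Fin; zero; suc)
open import Data.Fin.Properties as Fin using ()
open import Data.List.Base using (List; []; _∷_; _++_; map; foldr)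
open import Data.List.Membership.Setoid as Membership using ()
open import Data.List.Relation.Binary.Subset.Setoid as Subset using ()
open import Data.List.Relation.Unary.All using (All)
open import Data.List.Relation.Unary.Linked using (Linked)
open import Data.List.Relation.Unary.Unique.Setoid as Uniqueness using ()
open import Data.Nat.Base as ℕ using (ℕ)
open import Data.Product.Base using (∃; ∃-syntax; Σ-syntax; _×_; _,_; proj₁; proj₂)
open import Data.Sign.Base using (Sign)
open import Data.Sum.Base using (_⊎_)
open import Relation.Binary.Bundles using (TotalOrder)
open import Relation.Binary.Construct.NonStrictToStrict as ToStrict using ()
open import Relation.Binary.Core using (Rel)
open import Relation.Binary.Definitions using (Decidable)
open import Relation.Binary.PropositionalEquality.Core using (_≡_; _≢_)
open import Relation.Binary.Structures using (IsTotalOrder)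
open import Relation.Nullary using (¬_; yes; no)
open import Relation.Nullary.Decidable.Core using (does)
open import Relation.Unary using (Pred; _∈_; _∉_; _≐_)
import Relation.Binary.Reasoning.Setoid as ≈-Reasoning

-- Classical fields: equality is decidable, and inversion is total with
-- the junk value 0⁻¹ = 0.

record Field ℓ : Set (lsuc ℓ) where
  field
    commutativeRing : CommutativeRing ℓ ℓ

  open CommutativeRing commutativeRing public hiding (zero)

  infix 9 _⁻¹
  infix 4 _≟_

  field
    _≟_     : Decidable _≈_
    1≉0     : 1# ≉ 0#
    _⁻¹     : Carrier → Carrier
    inverse : ∀ {x} → x ≉ 0# → x * x ⁻¹ ≈ 1#
    0⁻¹≈0   : 0# ⁻¹ ≈ 0#

  private
    rawSemiring = Semiring.rawSemiring semiring

  open Power rawSemiring public using (_^_)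

  -- coefficients are listed from the constant term upwards
  evaluate : List Carrier → Carrier → Carrier
  evaluate as x = foldr (λ a y → a + x * y) 0# as

  AlgebraicallyClosed : Set ℓ
  AlgebraicallyClosed =
    ∀ a as → ∃[ x ] evaluate (a ∷ as ++ 1# ∷ []) x ≈ 0#

  CharacteristicZero : Set ℓ
  CharacteristicZero = ∀ n → Multiple._×_ (RawSemiring.+-rawMonoid rawSemiring) (ℕ.suc n) 1# ≉ 0#

-- The real numbers, characterised up to unique isomorphism as the
-- Dedekind-complete ordered field.

record CompleteOrderedField ℓ : Set (lsuc ℓ) where
  field
    field′ : Field ℓ

  open Field field′ public

  infix 4 _≤_

  field
    _≤_          : Rel Carrier ℓ
    isTotalOrder : IsTotalOrder _≈_ _≤_
    +-monoˡ-≤    : ∀ {x y} z → x ≤ y → x + z ≤ y + z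
    *-nonneg     : ∀ {x y} → 0# ≤ x → 0# ≤ y → 0# ≤ x * y

  totalOrder : TotalOrder ℓ ℓ ℓ
  totalOrder = record { isTotalOrder = isTotalOrder }

  open ToStrict _≈_ _≤_ public using (_<_)
  open Max totalOrder public renaming (_⊔_ to max) using ()

  _IsUpperBoundOf_ : Carrier → Pred Carrier ℓ → Set ℓ
  u IsUpperBoundOf P = ∀ x → x ∈ P → x ≤ u

  field
    supremum : (P : Pred Carrier ℓ) → ∃ P → ∃ (_IsUpperBoundOf P) →
               ∃[ s ] (s IsUpperBoundOf P ×
                       (∀ u → u IsUpperBoundOf P → s ≤ u))

record CompleteNonArchimedeanField {ℓ} (ℝ : CompleteOrderedField ℓ)
       : Set (lsuc ℓ) where
  private module ℝ = CompleteOrderedField ℝ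

  field
    field′ : Field ℓ

  open Field field′ public

  field
    ∣_∣         : Carrier → ℝ.Carrier
    ∣∣-cong     : ∀ {x y} → x ≈ y → ∣ x ∣ ℝ.≈ ∣ y ∣
    ∣∣-nonneg   : ∀ x → ℝ.0# ℝ.≤ ∣ x ∣
    ∣0∣≈0       : ∣ 0# ∣ ℝ.≈ ℝ.0#
    ∣x∣≈0⇒x≈0   : ∀ {x} → ∣ x ∣ ℝ.≈ ℝ.0# → x ≈ 0#
    ∣∣-*        : ∀ x y → ∣ x * y ∣ ℝ.≈ ∣ x ∣ ℝ.* ∣ y ∣
    ultrametric : ∀ x y → ∣ x + y ∣ ℝ.≤ ℝ.max ∣ x ∣ ∣ y ∣

  field
    complete :
      (u : ℕ → Carrier) →
      (∀ ε → ℝ.0# ℝ.< ε →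
         ∃[ N ] ∀ m n → N ℕ.≤ m → N ℕ.≤ n → ∣ u m - u n ∣ ℝ.< ε) →
      ∃[ x ] ∀ ε → ℝ.0# ℝ.< ε →
         ∃[ N ] ∀ n → N ℕ.≤ n → ∣ u n - x ∣ ℝ.< ε

module GroupTheory {c ℓ} (G : Group c ℓ) where
  open Group G

  record IsSubgroup {p} (P : Pred Carrier p) : Set (c ⊔ ℓ ⊔ p) where
    field
      resp  : ∀ {x y} → x ≈ y → x ∈ P → y ∈ P
      ε∈    : ε ∈ P
      ∙∈    : ∀ {x y} → x ∈ P → y ∈ P → x ∙ y ∈ P
      ⁻¹∈   : ∀ {x} → x ∈ P → x ⁻¹ ∈ P

  data ⟨_⟩ {p} (S : Pred Carrier p) : Pred Carrier (c ⊔ ℓ ⊔ p) where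
    gen  : ∀ {x} → x ∈ S → x ∈ ⟨ S ⟩
    unit : ε ∈ ⟨ S ⟩
    mul  : ∀ {x y} → x ∈ ⟨ S ⟩ → y ∈ ⟨ S ⟩ → x ∙ y ∈ ⟨ S ⟩
    inv  : ∀ {x} → x ∈ ⟨ S ⟩ → x ⁻¹ ∈ ⟨ S ⟩
    resp : ∀ {x y} → x ≈ y → x ∈ ⟨ S ⟩ → y ∈ ⟨ S ⟩

  [_,_] : ∀ {p q} → Pred Carrier p → Pred Carrier q →
           Pred Carrier (c ⊔ ℓ ⊔ p ⊔ q)
  [ P , Q ] = ⟨ (λ z → ∃[ x ] ∃[ y ] (x ∈ P × y ∈ Q ×
                   z ≈ x ∙ y ∙ x ⁻¹ ∙ y ⁻¹)) ⟩

  product : List Carrier → Carrier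
  product = foldr _∙_ ε

  -- P is the internal free product of the subgroups H i: they generate
  -- P, and no nonempty reduced word represents the identity.

  module _ {i p} {I : Set i} (H : I → Pred Carrier p) where

    IsReduced : Pred (List (I × Carrier)) (i ⊔ c ⊔ ℓ ⊔ p)
    IsReduced w = All (λ (k , x) → x ∈ H k × x ≉ ε) w
                × Linked (λ (k , _) (l , _) → k ≢ l) w

    IsFreeProduct : ∀ {q} → Pred Carrier q → Set (i ⊔ c ⊔ ℓ ⊔ p ⊔ q)
    IsFreeProduct P =
        P ≐ ⟨ (λ x → ∃[ k ] x ∈ H k) ⟩
      × (∀ s w → IsReduced (s ∷ w) → product (map proj₂ (s ∷ w)) ≉ ε)

  module _ {i} {I : Set i} (b : I → Carrier) where

    letter : I × Sign → Carrier
    letter (k , Sign.+) = b k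
    letter (k , Sign.-) = b k ⁻¹

    IsFreeBasis : ∀ {q} → Pred Carrier q → Set (i ⊔ c ⊔ ℓ ⊔ q)
    IsFreeBasis P =
        P ≐ ⟨ (λ x → ∃[ k ] x ≈ b k) ⟩
      × (∀ s w → Linked (λ (k , s) (l , t) → k ≡ l → s ≡ t) (s ∷ w) →
                 product (map letter (s ∷ w)) ≉ ε)

  IsFinitelyGenerated : ∀ {p} → Pred Carrier p → Set (c ⊔ ℓ ⊔ p)
  IsFinitelyGenerated P = ∃[ xs ] P ≐ ⟨ (λ x → Membership._∈_ setoid x xs) ⟩

  infixr 8 _^_
  _^_ : Carrier → ℕ → Carrier
  x ^ n = Multiple._×_ rawMonoid n x

  IsTorsionFree : ∀ {p} → Pred Carrier p → Set (c ⊔ ℓ ⊔ p)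
  IsTorsionFree P = ∀ x n → x ∈ P → x ^ ℕ.suc n ≈ ε → x ≈ ε

module Projective {ℓ} (F : Field ℓ) where
  open Field F
  open import Algebra.Properties.Ring ring
    using (-‿distribˡ-*; -‿distribʳ-*; -0#≈0#; -‿+-comm; -‿involutive)

  private
    open NaturalCoefficients commutativeSemiring
      renaming (_:+_ to _⊕_; _:*_ to _⊗_; _:=_ to _⊜_)
    open ≈-Reasoning setoid

    abstract
      *-nonzero : ∀ {x y} → x ≉ 0# → y ≉ 0# → x * y ≉ 0#
      *-nonzero {x} {y} x≉0 y≉0 xy≈0 = y≉0 (begin
        y                ≈⟨ *-identityˡ y ⟨
        1# * y           ≈⟨ *-congʳ (inverse x≉0) ⟨
        x * x ⁻¹ * y     ≈⟨ solve 3 (λ x i y → ((x ⊗ i) ⊗ y) ⊜ (i ⊗ (x ⊗ y))) refl x (x ⁻¹) y ⟩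
        x ⁻¹ * (x * y)   ≈⟨ *-congˡ xy≈0 ⟩
        x ⁻¹ * 0#        ≈⟨ zeroʳ _ ⟩
        0#               ∎)

      ⁻¹-nonzero : ∀ {x} → x ≉ 0# → x ⁻¹ ≉ 0#
      ⁻¹-nonzero {x} x≉0 i≈0 = 1≉0 (begin
        1#        ≈⟨ inverse x≉0 ⟨
        x * x ⁻¹  ≈⟨ *-congˡ i≈0 ⟩
        x * 0#    ≈⟨ zeroʳ x ⟩
        0#        ∎)

      undo : ∀ {k x y} → k ≉ 0# → y ≈ k * x → x ≈ k ⁻¹ * y
      undo {k} {x} {y} k≉0 eq = begin
        x               ≈⟨ *-identityˡ x ⟨
        1# * x          ≈⟨ *-congʳ (inverse k≉0) ⟨
        k * k ⁻¹ * x    ≈⟨ solve 3 (λ k i x → ((k ⊗ i) ⊗ x) ⊜ (i ⊗ (k ⊗ x))) refl k (k ⁻¹) x ⟩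
        k ⁻¹ * (k * x)  ≈⟨ *-congˡ eq ⟨
        k ⁻¹ * y        ∎

      chain : ∀ {k l x y z} → y ≈ k * x → z ≈ l * y → z ≈ l * k * x
      chain {k} {l} {x} p q = trans q (trans (*-congˡ p) (sym (*-assoc l k x)))

      -- P - Q ≈ P′ - Q′ from P + Q′ ≈ P′ + Q
      cross : ∀ {P Q P′ Q′} → P + Q′ ≈ P′ + Q → P - Q ≈ P′ - Q′
      cross {P} {Q} {P′} {Q′} eq = begin
        P - Q                  ≈⟨ +-identityʳ _ ⟨
        P - Q + 0#             ≈⟨ +-congˡ (-‿inverseʳ Q′) ⟨
        P - Q + (Q′ - Q′)      ≈⟨ rearrange P (- Q) Q′ (- Q′) ⟩
        (P + Q′) + (- Q - Q′)  ≈⟨ +-congʳ eq ⟩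
        (P′ + Q) + (- Q - Q′)  ≈⟨ solve 4 (λ p q r s → ((p ⊕ q) ⊕ (r ⊕ s)) ⊜ ((p ⊕ s) ⊕ (q ⊕ r))) refl P′ Q (- Q) (- Q′) ⟩
        P′ - Q′ + (Q - Q)      ≈⟨ +-congˡ (-‿inverseʳ Q) ⟩
        P′ - Q′ + 0#           ≈⟨ +-identityʳ _ ⟩
        P′ - Q′                ∎
        where
        rearrange : ∀ p q r s → (p + q) + (r + s) ≈ (p + r) + (q + s)
        rearrange = solve 4 (λ p q r s → ((p ⊕ q) ⊕ (r ⊕ s)) ⊜ ((p ⊕ r) ⊕ (q ⊕ s))) refl

      -*- : ∀ x y → - x * - y ≈ x * y
      -*- x y = begin
        - x * - y      ≈⟨ -‿distribˡ-* x (- y) ⟨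
        - (x * - y)    ≈⟨ -‿cong (-‿distribʳ-* x y) ⟨
        - - (x * y)    ≈⟨ -‿involutive (x * y) ⟩
        x * y          ∎

      expand : ∀ x y z w → x * z + y * w - (x * w + y * z) ≈ (x - y) * (z - w)
      expand x y z w = begin
        x * z + y * w - (x * w + y * z)
          ≈⟨ +-cong (+-congˡ (sym (-*- y w)))
               (trans (sym (-‿+-comm _ _)) (+-cong (-‿distribʳ-* x w) (-‿distribˡ-* y z))) ⟩
        x * z + - y * - w + (x * - w + - y * z)
          ≈⟨ solve 4 (λ x n z m →
               (x ⊗ z ⊕ n ⊗ m ⊕ (x ⊗ m ⊕ n ⊗ z)) ⊜ ((x ⊕ n) ⊗ (z ⊕ m)))
               refl x (- y) z (- w) ⟩
        (x - y) * (z - w) ∎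

  record GL₂ : Set ℓ where
    constructor mat
    field
      a b c d : Carrier
      det≉0   : a * d - b * c ≉ 0#

  open GL₂

  infix 4 _~_
  _~_ : Rel GL₂ ℓ
  M ~ N = ∃[ k ] (k ≉ 0# × a N ≈ k * a M × b N ≈ k * b M
                         × c N ≈ k * c M × d N ≈ k * d M)

  infixl 7 _·_
  _·_ : GL₂ → GL₂ → GL₂
  mat a b c d p · mat a′ b′ c′ d′ p′ =
    mat (a * a′ + b * c′) (a * b′ + b * d′)
        (c * a′ + d * c′) (c * b′ + d * d′)
        (λ eq → *-nonzero p p′ (trans (sym det-*) eq))
    where
    abstract
      det-* : (a * a′ + b * c′) * (c * b′ + d * d′)
            - (a * b′ + b * d′) * (c * a′ + d * c′)
            ≈ (a * d - b * c) * (a′ * d′ - b′ * c′)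
      det-* = trans
        (cross {P′ = a * d * (a′ * d′) + b * c * (b′ * c′)}
               {Q′ = a * d * (b′ * c′) + b * c * (a′ * d′)}
          (solve 8 (λ a b c d a′ b′ c′ d′ →
              ((a ⊗ a′ ⊕ b ⊗ c′) ⊗ (c ⊗ b′ ⊕ d ⊗ d′)
                ⊕ ((a ⊗ d) ⊗ (b′ ⊗ c′) ⊕ (b ⊗ c) ⊗ (a′ ⊗ d′)))
            ⊜ (((a ⊗ d) ⊗ (a′ ⊗ d′) ⊕ (b ⊗ c) ⊗ (b′ ⊗ c′))
                ⊕ (a ⊗ b′ ⊕ b ⊗ d′) ⊗ (c ⊗ a′ ⊕ d ⊗ c′)))
            refl a b c d a′ b′ c′ d′))
        (expand (a * d) (b * c) (a′ * d′) (b′ * c′))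

  PGL₂ : Group ℓ ℓ
  PGL₂ = record
    { Carrier = GL₂
    ; _≈_     = _~_
    ; _∙_     = _·_
    ; ε       = I
    ; _⁻¹     = adj
    ; isGroup = record
      { isMonoid = record
        { isSemigroup = record
          { isMagma = record
            { isEquivalence = record
              { refl  = 1# , 1≉0 , one , one , one , one
              ; sym   = λ (k , k≉0 , p , q , r , s) →
                  k ⁻¹ , ⁻¹-nonzero k≉0
                  , undo k≉0 p , undo k≉0 q , undo k≉0 r , undo k≉0 s
              ; trans = λ (k , k≉0 , p , q , r , s) (l , l≉0 , p′ , q′ , r′ , s′) →
                  l * k , *-nonzero l≉0 k≉0
                  , chain p p′ , chain q q′ , chain r r′ , chain s s′
              }
            ; ∙-cong = λ (k , k≉0 , p , q , r , s) (l , l≉0 , p′ , q′ , r′ , s′) →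
                k * l , *-nonzero k≉0 l≉0
                , scale p p′ q r′ , scale p q′ q s′
                , scale r p′ s r′ , scale r q′ s s′
            }
          ; assoc = λ M N L →
              1# , 1≉0
              , trans (assoc′ _ _ _ _ _ _ _ _) one , trans (assoc′ _ _ _ _ _ _ _ _) one
              , trans (assoc′ _ _ _ _ _ _ _ _) one , trans (assoc′ _ _ _ _ _ _ _ _) one
          }
        ; identity =
            (λ M → 1# , 1≉0 , idˡ _ _ , idˡ _ _ , idˡ′ _ _ , idˡ′ _ _)
          , (λ M → 1# , 1≉0 , idʳ _ _ , idʳ′ _ _ , idʳ _ _ , idʳ′ _ _)
        }
      ; inverse =
          (λ { M@(mat a b c d p) → by-det p (adj M · M)
               (trans (+-cong (*-comm d a) (sym (-‿distribˡ-* b c))) refl)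
               (trans (+-cong (*-comm d b) (sym (-‿distribˡ-* b d))) (-‿inverseʳ _))
               (trans (+-cong (trans (sym (-‿distribˡ-* c a)) (-‿cong (*-comm c a))) refl) (-‿inverseˡ _))
               (trans (+-comm _ _) (+-congˡ (trans (sym (-‿distribˡ-* c b)) (-‿cong (*-comm c b))))) })
        , (λ { M@(mat a b c d p) → by-det p (M · adj M)
               (+-congˡ (sym (-‿distribʳ-* b c)))
               (trans (+-cong (trans (sym (-‿distribʳ-* a b)) (-‿cong (*-comm a b))) refl) (-‿inverseˡ _))
               (trans (+-cong (*-comm c d) (sym (-‿distribʳ-* d c))) (-‿inverseʳ _))
               (trans (+-comm _ _) (+-cong (*-comm d a) (trans (sym (-‿distribʳ-* c b)) (-‿cong (*-comm c b))))) })
      ; ⁻¹-cong = λ (k , k≉0 , p , q , r , s) →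
          k , k≉0 , s , neg q , neg r , p
      }
    }
    where
    one : ∀ {x} → x ≈ 1# * x
    one = sym (*-identityˡ _)

    det-1 : 1# * 1# - 0# * 0# ≉ 0#
    det-1 eq = 1≉0 (begin
      1#                ≈⟨ +-identityʳ _ ⟨
      1# + 0#           ≈⟨ +-cong (*-identityˡ 1#) (trans (-‿cong (zeroˡ 0#)) -0#≈0#) ⟨
      1# * 1# - 0# * 0# ≈⟨ eq ⟩
      0#                ∎)

    I : GL₂
    I = mat 1# 0# 0# 1# det-1

    adj : GL₂ → GL₂
    adj (mat a b c d p) = mat d (- b) (- c) a (λ eq → p (trans
      (+-cong (*-comm a d) (-‿cong (sym (-*- b c)))) eq))

    neg : ∀ {k x y} → y ≈ k * x → - y ≈ k * - x
    neg {k} {x} p = trans (-‿cong p) (-‿distribʳ-* k x)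

    scale : ∀ {k l x y z w x′ y′ z′ w′} →
            x′ ≈ k * x → y′ ≈ l * y → z′ ≈ k * z → w′ ≈ l * w →
            x′ * y′ + z′ * w′ ≈ k * l * (x * y + z * w)
    scale {k} {l} {x} {y} {z} {w} p q r s =
      trans (+-cong (*-cong p q) (*-cong r s))
        (solve 6 (λ k l x y z w →
            ((k ⊗ x) ⊗ (l ⊗ y) ⊕ (k ⊗ z) ⊗ (l ⊗ w)) ⊜ ((k ⊗ l) ⊗ (x ⊗ y ⊕ z ⊗ w)))
          refl k l x y z w)

    assoc′ : ∀ x y a b c d u v →
             x * (a * u + b * v) + y * (c * u + d * v)
             ≈ (x * a + y * c) * u + (x * b + y * d) * v
    assoc′ = solve 8 (λ x y a b c d u v →
        (x ⊗ (a ⊗ u ⊕ b ⊗ v) ⊕ y ⊗ (c ⊗ u ⊕ d ⊗ v))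
      ⊜ ((x ⊗ a ⊕ y ⊗ c) ⊗ u ⊕ (x ⊗ b ⊕ y ⊗ d) ⊗ v)) refl

    idˡ : ∀ x y → x ≈ 1# * (1# * x + 0# * y)
    idˡ x y = sym (trans (*-identityˡ _) (trans (+-cong (*-identityˡ x) (zeroˡ y)) (+-identityʳ x)))

    idˡ′ : ∀ x y → y ≈ 1# * (0# * x + 1# * y)
    idˡ′ x y = sym (trans (*-identityˡ _) (trans (+-cong (zeroˡ x) (*-identityˡ y)) (+-identityˡ y)))

    idʳ : ∀ x y → x ≈ 1# * (x * 1# + y * 0#)
    idʳ x y = sym (trans (*-identityˡ _) (trans (+-cong (*-identityʳ x) (zeroʳ y)) (+-identityʳ x)))

    idʳ′ : ∀ x y → y ≈ 1# * (x * 0# + y * 1#)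
    idʳ′ x y = sym (trans (*-identityˡ _) (trans (+-cong (zeroʳ x) (*-identityʳ y)) (+-identityˡ y)))

    by-det : ∀ {k} → k ≉ 0# → ∀ M →
             a M ≈ k → b M ≈ 0# → c M ≈ 0# → d M ≈ k → M ~ I
    by-det {k} k≉0 _ p q r s =
      k ⁻¹ , ⁻¹-nonzero k≉0
      , undo k≉0 (trans p (sym (*-identityʳ k))) , undo k≉0 (trans q (sym (zeroʳ k)))
      , undo k≉0 (trans r (sym (zeroʳ k))) , undo k≉0 (trans s (sym (*-identityʳ k)))

  record P¹ : Set ℓ where
    constructor [_∶_]⟨_⟩
    field
      x y     : Carrier
      nonzero : ¬ (x ≈ 0# × y ≈ 0#)

  infix 4 _≋_ _≭_
  _≋_ _≭_ : Rel P¹ ℓ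
  [ x ∶ y ]⟨ _ ⟩ ≋ [ x′ ∶ y′ ]⟨ _ ⟩ =
    ∃[ k ] (k ≉ 0# × x′ ≈ k * x × y′ ≈ k * y)
  p ≭ q = ¬ (p ≋ q)

  ∞ : P¹
  ∞ = [ 1# ∶ 0# ]⟨ (λ (1≈0 , _) → 1≉0 1≈0) ⟩

  ι : Carrier → P¹
  ι z = [ z ∶ 1# ]⟨ (λ (_ , 1≈0) → 1≉0 1≈0) ⟩

  -- Points are row vectors, on which matrices act from the right:
  --   z ◂ (a b ; c d) = (a z + c) / (b z + d),
  -- so that p ◂ (M · N) = (p ◂ M) ◂ N: products of transformations are
  -- performed from left to right.  The relation c_{oᵢ,e₀}² = c_ξᵢ for
  -- ξᵢ = σᵢ σ₀ depends on this; if products are performed from right to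
  -- left, then c_{oᵢ,e₀}² is the inverse of c_ξᵢ.  For instance, for
  -- Γ = { z ↦ qⁿ z }, σ₀ z = 1/z, σ₁ z = q/z one has c_{a,b}(q) = a/b, so
  -- c_{√q,1}(q)² = q, while c_{a,qa}(q) = 1/q for σ₁ ∘ σ₀ = (z ↦ q z).
  infixl 7 _◂_
  _◂_ : P¹ → GL₂ → P¹
  [ x ∶ y ]⟨ nz ⟩ ◂ mat a b c d p =
    [ x * a + y * c ∶ x * b + y * d ]⟨ (λ (u , v) → nz (x≈0 u v , y≈0 u v)) ⟩
    where
    D = a * d - b * c

    abstract
      cancel : ∀ {t} → t * D ≈ 0# → t ≈ 0#
      cancel {t} eq with t ≟ 0#
      ... | yes t≈0 = t≈0
      ... | no  t≉0 with () ← *-nonzero t≉0 p eq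

      vanish : ∀ {s t d c} → s ≈ 0# → t ≈ 0# → s * d - t * c ≈ 0#
      vanish s≈0 t≈0 = trans
        (+-cong (trans (*-congʳ s≈0) (zeroˡ _))
                (trans (-‿cong (trans (*-congʳ t≈0) (zeroˡ _))) -0#≈0#))
        (+-identityʳ 0#)

      x≈0 : x * a + y * c ≈ 0# → x * b + y * d ≈ 0# → x ≈ 0#
      x≈0 u v = cancel (begin
        x * D                                      ≈⟨ distribˡ x _ _ ⟩
        x * (a * d) + x * - (b * c)                ≈⟨ +-congˡ (-‿distribʳ-* x _) ⟨
        x * (a * d) - x * (b * c)                  ≈⟨ cross (solve 6 (λ x y a b c d →
            (x ⊗ (a ⊗ d) ⊕ (x ⊗ b ⊕ y ⊗ d) ⊗ c) ⊜ ((x ⊗ a ⊕ y ⊗ c) ⊗ d ⊕ x ⊗ (b ⊗ c)))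
            refl x y a b c d) ⟩
        (x * a + y * c) * d - (x * b + y * d) * c  ≈⟨ vanish u v ⟩
        0#                                         ∎)

      y≈0 : x * a + y * c ≈ 0# → x * b + y * d ≈ 0# → y ≈ 0#
      y≈0 u v = cancel (begin
        y * D                                      ≈⟨ distribˡ y _ _ ⟩
        y * (a * d) + y * - (b * c)                ≈⟨ +-congˡ (-‿distribʳ-* y _) ⟨
        y * (a * d) - y * (b * c)                  ≈⟨ cross (solve 6 (λ x y a b c d →
            (y ⊗ (a ⊗ d) ⊕ (x ⊗ a ⊕ y ⊗ c) ⊗ b) ⊜ ((x ⊗ b ⊕ y ⊗ d) ⊗ a ⊕ y ⊗ (b ⊗ c)))
            refl x y a b c d) ⟩
        (x * b + y * d) * a - (x * a + y * c) * b  ≈⟨ vanish v u ⟩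
        0#                                         ∎)

  -- z - p for z in the affine line; the factor is 1 by convention when
  -- p = ∞.  (The choice changes Θ only by constant factors.)
  infixl 6 _⊖_
  _⊖_ : Carrier → P¹ → Carrier
  z ⊖ [ x ∶ y ]⟨ _ ⟩ = if does (y ≟ 0#) then 1# else z - x * y ⁻¹

module Schottky {ℓ} {ℝ : CompleteOrderedField ℓ}
                (𝕂 : CompleteNonArchimedeanField ℝ) where

  private module ℝ = CompleteOrderedField ℝ
  open CompleteNonArchimedeanField 𝕂
  open Projective field′ public
  open GroupTheory PGL₂ public hiding (_^_)
  private
    module PGL = Group PGL₂

  -- The chordal metric is |p ∧ q| / (‖p‖ ‖q‖).

  ‖_‖ : P¹ → ℝ.Carrier
  ‖ [ x ∶ y ]⟨ _ ⟩ ‖ = ℝ.max ∣ x ∣ ∣ y ∣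

  _∧_ : P¹ → P¹ → Carrier
  [ x ∶ y ]⟨ _ ⟩ ∧ [ x′ ∶ y′ ]⟨ _ ⟩ = x * y′ - y * x′

  Close : ℝ.Carrier → Rel P¹ ℓ
  Close ε p q = ∣ p ∧ q ∣ ℝ.< ε ℝ.* (‖ p ‖ ℝ.* ‖ q ‖)

  ConvergesTo : (ℕ → P¹) → P¹ → Set ℓ
  ConvergesTo u p = ∀ ε → ℝ.0# ℝ.< ε →
    ∃[ N ] ∀ n → N ℕ.≤ n → Close ε (u n) p

  Closure : Pred P¹ ℓ → Pred P¹ ℓ
  Closure S p = ∀ ε → ℝ.0# ℝ.< ε → ∃[ s ] (s ∈ S × Close ε s p)

  -- Sequential compactness; P¹ is metrised by the chordal metric.
  IsCompact : Pred P¹ ℓ → Set ℓ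
  IsCompact S = ∀ (u : ℕ → P¹) → (∀ n → u n ∈ S) →
    ∃[ p ] Σ[ φ ∈ (ℕ → ℕ) ]
      ( p ∈ S
      × (∀ n → φ n ℕ.< φ (ℕ.suc n))
      × ConvergesTo (λ n → u (φ n)) p)

  module _ (Γ : Pred GL₂ ℓ) where

    Orbit : P¹ → Pred P¹ ℓ
    Orbit p q = ∃[ γ ] (γ ∈ Γ × p ◂ γ ≋ q)

    LimitPoint : Pred P¹ ℓ
    LimitPoint p = ∃[ q ] Σ[ γ ∈ (ℕ → GL₂) ]
      ( (∀ n → γ n ∈ Γ)
      × (∀ m n → m ≢ n → ¬ (γ m ~ γ n))
      × ConvergesTo (λ n → q ◂ γ n) p)

    Ω : Pred P¹ ℓ
    Ω p = ¬ LimitPoint p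

    -- Discontinuity in the sense of Gerritzen and van der Put.
    record IsDiscontinuous : Set ℓ where
      field
        ordinaryPoint : ∃ Ω
        orbitClosures : ∀ p → IsCompact (Closure (Orbit p))

    record IsSchottky (g : ℕ) : Set ℓ where
      field
        isSubgroup        : IsSubgroup Γ
        finitelyGenerated : IsFinitelyGenerated Γ
        torsionFree       : IsTorsionFree Γ
        discontinuous     : IsDiscontinuous
        rank              : ∃[ b ] IsFreeBasis {I = Fin g} b Γ

    -- Unordered product of f over Γ, a subset of PGL(2): the finite lists
    -- T range over subsets of Γ without repetition up to scalars.
    HasProduct : (GL₂ → Carrier) → Carrier → Set ℓ
    HasProduct f w = ∀ ε → ℝ.0# ℝ.< ε →
      ∃[ S ] (All Γ S × (∀ T → All Γ T →
        Uniqueness.Unique PGL.setoid T → Subset._⊆_ PGL.setoid S T →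
        ∣ foldr _*_ 1# (map f T) - w ∣ ℝ.< ε))

    -- The functions Θ_{a,b} and their multipliers c_{a,b} on Ω, with the
    -- properties that define them (convergence and automorphy hold for
    -- every Schottky group with ∞ ∈ Ω): Θ a b z is the value of the product
    -- away from its poles, and c a b is the homomorphism Γ → 𝕂* by which
    -- Θ a b transforms.  Values outside the stated domains are junk.
    record ThetaFunctions : Set ℓ where
      field
        Θ : P¹ → P¹ → Carrier → Carrier
        c : P¹ → P¹ → GL₂ → Carrier

        Θ-product : ∀ (a b : P¹) (z : Carrier) → a ∈ Ω → b ∈ Ω →
                    ι z ∈ Ω → ι z ∉ Orbit b →
                    HasProduct (λ γ → (z ⊖ a ◂ γ) * (z ⊖ b ◂ γ) ⁻¹) (Θ a b z)

        c-cong    : ∀ (a b : P¹) (γ δ : GL₂) → a ∈ Ω → b ∈ Ω →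
                    γ ∈ Γ → δ ∈ Γ → γ ~ δ → c a b γ ≈ c a b δ
        c-nonzero : ∀ (a b : P¹) (γ : GL₂) → a ∈ Ω → b ∈ Ω →
                    γ ∈ Γ → c a b γ ≉ 0#
        c-homo    : ∀ (a b : P¹) (γ δ : GL₂) → a ∈ Ω → b ∈ Ω →
                    γ ∈ Γ → δ ∈ Γ → c a b (γ · δ) ≈ c a b γ * c a b δ
        Θ-γ       : ∀ (a b : P¹) (γ : GL₂) (z z′ : Carrier) →
                    a ∈ Ω → b ∈ Ω → γ ∈ Γ → ι z ∈ Ω → ι z ∉ Orbit b →
                    ι z ◂ γ ≋ ι z′ → Θ a b z′ ≈ c a b γ * Θ a b z

  Γ₀ : Pred GL₂ ℓ → GL₂ → Pred GL₂ ℓ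
  Γ₀ Γ σ₀ = ⟨ (λ γ → γ ∈ Γ ⊎ γ ~ σ₀) ⟩

  record Hyperelliptic (g : ℕ) : Set (lsuc ℓ) where
    field
      Γ    : Pred GL₂ ℓ
      σ    : Fin (ℕ.suc g) → GL₂
      o e  : Fin (ℕ.suc g) → P¹

    σ₀ : GL₂
    σ₀ = σ zero

    ξ : Fin g → GL₂
    ξ i = σ (suc i) · σ₀

    field
      schottky    : IsSchottky Γ g
      ∞∈Ω         : ∞ ∈ Ω Γ
      normalizes  : ∀ γ → γ ∈ Γ → σ₀ · γ · σ₀ PGL.⁻¹ ∈ Γ
      σ₀²         : σ₀ · σ₀ ~ PGL.ε
      inverts     : ∀ γ → γ ∈ Γ → γ · σ₀ · γ · σ₀ PGL.⁻¹ ∈ [ Γ , Γ ]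
      freeProduct : IsFreeProduct (λ i → ⟨ (_~ σ i) ⟩) (Γ₀ Γ σ₀)
      order-two   : ∀ i → σ i · σ i ~ PGL.ε × ¬ (σ i ~ PGL.ε)
      freeBasis   : IsFreeBasis ξ Γ
      o-fixed     : ∀ i → o i ◂ σ i ≋ o i
      e-fixed     : ∀ i → e i ◂ σ i ≋ e i
      o≭e         : ∀ i → o i ≭ e i
      o∈Ω         : ∀ i → o i ∈ Ω Γ
      e∈Ω         : ∀ i → e i ∈ Ω Γ

  sign : ∀ {n} → Fin n → Fin n → Carrier
  sign i j = (- 1#) ^ (if does (i Fin.≟ j) then 1 else 0)

{-# OPTIONS --safe #-}

-- Idea.  Θ_{a,b}(γu) / Θ_{a,b}(u) is the product over δ ∈ Γ of the cross
-- ratios (γu, u; aδ, bδ), so c_{a,b}(γ) is such a product for every generic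
-- u.  As cross ratios are multiplicative in the pair (a, b) and invariant
-- under PGL(2), this gives c_{a,b} c_{b,d} = c_{a,d} and
-- c_{aτ,bτ}(τ⁻¹γτ) = c_{a,b}(γ) whenever τ normalises Γ.  With τ = σ₀, which
-- inverts c, and oᵢσ₀ = oᵢξᵢ, the square of c_{oᵢ,e₀} is c_{oᵢ,oᵢξᵢ}.
-- For the signs, let i ≠ k and let u be a fixed point of σₖ.  Then
-- c_{oᵢ,eᵢ}(σₖσᵢ) is the product of the cross ratios (uσᵢ, u; oᵢδ, eᵢδ).
-- The factors at δ and σᵢδσᵢ cancel, which leaves the factor at δ = 1; it is
-- -1 because oᵢ, eᵢ, u, uσᵢ are in harmonic position.  That u is not
-- Γ-equivalent to oᵢ or eᵢ follows from the parity of the number of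
-- occurrences of σₖ in words of the free product.
--
-- Generic points are found near ∞: as ∞ is ordinary, there is an R such that
-- every γ ≠ 1 in Γ maps { |z| > R } into { |z| ≤ R }.

module Submission where

open import Defs
open import Algebra.Bundles using (CommutativeRing; Group; RawRing)
import Algebra.Construct.NaturalChoice.Max as Max
import Algebra.Construct.NaturalChoice.MaxOp as MaxOp
import Algebra.Properties.Group as GroupProperties
import Algebra.Solver.Monoid as MonoidSolver
open import Algebra.Solver.Ring.AlmostCommutativeRing
  using (fromCommutativeRing; _-Raw-AlmostCommutative⟶_)
open import Axiom.ExcludedMiddle using (ExcludedMiddle)
open import Data.Bool.Base using (if_then_else_)
open import Data.Fin.Base using (Fin; zero; suc)
import Data.Fin.Properties as Fin
import Data.Integer.Base as ℤ
import Data.Integer.Properties as ℤ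
open import Data.List.Base using (List; []; _∷_; _++_; map; foldr; deduplicate; length; reverse)
import Data.List.Membership.Setoid as Membership
import Data.List.Membership.Setoid.Properties as ∈
import Data.List.Properties as List
import Data.List.Relation.Binary.Subset.Setoid as Subset
open import Data.List.Relation.Unary.All as All using (All; []; _∷_)
import Data.List.Relation.Unary.All.Properties as All
open import Data.List.Relation.Unary.AllPairs using ([]; _∷_)
open import Data.List.Relation.Unary.Any as Any using (here; there)
open import Data.List.Relation.Unary.Linked using (Linked; []; [-]; _∷_)
import Data.List.Relation.Unary.Linked.Properties as Linked
import Data.List.Relation.Unary.Unique.DecSetoid.Properties as UniqueDec
import Data.List.Relation.Unary.Unique.Setoid as Uniqueness
import Data.List.Relation.Unary.Unique.Setoid.Properties as Unique
open import Data.Maybe.Base using (Maybe; just; nothing)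
open import Data.Nat.Base as ℕ using (ℕ; zero; suc)
import Data.Nat.Properties as ℕ
open import Data.Parity.Base using (Parity; 0ℙ; 1ℙ) renaming (_+_ to _⊞_)
import Data.Parity.Properties as ℙ
open import Data.Product.Base using (∃; ∃-syntax; _×_; _,_; proj₁; proj₂)
open import Data.Sign.Base using (Sign)
open import Data.Sum.Base using (_⊎_; inj₁; inj₂)
open import Function.Base using (_∘_)
open import Level using (_⊔_) renaming (suc to lsuc)
open import Relation.Binary.Bundles using (Setoid; TotalOrder)
open import Relation.Binary.Definitions using (Decidable; tri<; tri≈; tri>)
import Relation.Binary.Properties.TotalOrder as TotalOrderProperties
open import Relation.Binary.PropositionalEquality as ≡ using (_≡_; _≢_)
import Relation.Binary.Reasoning.PartialOrder as ≤-Reasoning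
import Relation.Binary.Reasoning.Setoid as ≈-Reasoning
open import Relation.Nullary using (Dec; ¬_; yes; no; does; contradiction)
open import Relation.Nullary.Decidable using (decidable-stable)
open import Relation.Unary using (Pred; _∈_; _∉_)

-- `Θ` is given at affine coordinates only, so the product for `c a b γ` at `u` needs `u` and
-- `u ◂ γ` to be finite. A generic `u` can be chosen that way. A fixed point of `σ k` cannot, but
-- fixed points come in pairs, and at least one of `o k` and `e k` is always admissible. Points near
-- ∞ are available only if the absolute value is unbounded, which has to be proved: if all absolute
-- values were at most 1, the chordal metric would be discrete, and the orbit of ∞, infinite because
-- of the powers of some `ξ i`, could not have a compact closure. The cancellation of factors is
-- made rigorous without estimates. Every finite subset of Γ extends to a finite one that contains 1
-- and is stable under δ ↦ σᵢδσᵢ; on such a set the product is exactly -1, and a limit may be read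
-- off along a cofinal family. Torsion-freeness enters because δ = σᵢδσᵢ must force δ = 1. This
-- yields the value at σₖσᵢ for all k ≠ i in 0, ..., g. The values at ξⱼ follow from ξᵢ⁻¹ = σ₀σᵢ and
-- ξⱼ = (σⱼσᵢ)ξᵢ.

-- A ring solver with integer coefficients.

module IntegerCoefficients {c ℓ} (R : CommutativeRing c ℓ) where
  open CommutativeRing R
  open import Algebra.Properties.Ring ring
  open import Data.Integer.Base using (ℤ; +_; -[1+_]; _⊖_; _◃_)
  open import Algebra.Properties.Semiring.Mult semiring
    using (×-homo-+; ×1-homo-*) renaming (_×_ to _⊛_)
  open ≈-Reasoning setoid

  fromℤ : ℤ → Carrier
  fromℤ (+ n)    = n ⊛ 1#
  fromℤ -[1+ n ] = - (suc n ⊛ 1#)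

  private
    neg-homo : ∀ i → fromℤ (ℤ.- i) ≈ - fromℤ i
    neg-homo (+ zero)  = sym -0#≈0#
    neg-homo (+ suc n) = refl
    neg-homo -[1+ n ]  = sym (-‿involutive _)

    -- The inductive step of `⊖-homo`, because `suc n ⊛ 1#` unfolds to `1# + n ⊛ 1#`.
    cancel-1 : ∀ x y → x - y ≈ (1# + x) - (1# + y)
    cancel-1 x y = begin
      x - y                    ≈⟨ +-identityˡ _ ⟨
      0# + (x - y)             ≈⟨ +-congʳ (-‿inverseʳ 1#) ⟨
      (1# - 1#) + (x - y)      ≈⟨ +-assoc _ _ _ ⟩
      1# + (- 1# + (x - y))    ≈⟨ +-congˡ (+-assoc _ _ _) ⟨
      1# + ((- 1# + x) - y)    ≈⟨ +-congˡ (+-congʳ (+-comm _ _)) ⟩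
      1# + ((x - 1#) - y)      ≈⟨ +-congˡ (+-assoc _ _ _) ⟩
      1# + (x + (- 1# - y))    ≈⟨ +-assoc _ _ _ ⟨
      (1# + x) + (- 1# - y)    ≈⟨ +-congˡ (-‿+-comm 1# y) ⟩
      (1# + x) - (1# + y)      ∎

    ⊖-homo : ∀ m n → fromℤ (m ⊖ n) ≈ m ⊛ 1# - n ⊛ 1#
    ⊖-homo m       zero    = sym (trans (+-congˡ -0#≈0#) (+-identityʳ _))
    ⊖-homo zero    (suc n) = sym (+-identityˡ _)
    ⊖-homo (suc m) (suc n) = begin
      fromℤ (suc m ⊖ suc n)    ≡⟨ ≡.cong fromℤ (ℤ.[1+m]⊖[1+n]≡m⊖n m n) ⟩
      fromℤ (m ⊖ n)            ≈⟨ ⊖-homo m n ⟩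
      m ⊛ 1# - n ⊛ 1#          ≈⟨ cancel-1 _ _ ⟩
      suc m ⊛ 1# - suc n ⊛ 1#  ∎

    +-homo : ∀ i j → fromℤ (i ℤ.+ j) ≈ fromℤ i + fromℤ j
    +-homo (+ m)    (+ n)    = ×-homo-+ 1# m n
    +-homo (+ m)    -[1+ n ] = ⊖-homo m (suc n)
    +-homo -[1+ m ] (+ n)    = trans (⊖-homo n (suc m)) (+-comm _ _)
    +-homo -[1+ m ] -[1+ n ] = begin
      - (suc (suc (m ℕ.+ n)) ⊛ 1#)      ≡⟨ ≡.cong (λ k → - (suc k ⊛ 1#)) (ℕ.+-suc m n) ⟨
      - ((suc m ℕ.+ suc n) ⊛ 1#)        ≈⟨ -‿cong (×-homo-+ 1# (suc m) (suc n)) ⟩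
      - (suc m ⊛ 1# + suc n ⊛ 1#)       ≈⟨ -‿+-comm _ _ ⟨
      - (suc m ⊛ 1#) - suc n ⊛ 1#       ∎

    +◃-homo : ∀ n → fromℤ (Sign.+ ◃ n) ≈ n ⊛ 1#
    +◃-homo zero    = refl
    +◃-homo (suc n) = refl

    -◃-homo : ∀ n → fromℤ (Sign.- ◃ n) ≈ - (n ⊛ 1#)
    -◃-homo zero    = sym -0#≈0#
    -◃-homo (suc n) = refl

    *-homo : ∀ i j → fromℤ (i ℤ.* j) ≈ fromℤ i * fromℤ j
    *-homo (+ m)    (+ n)    = trans (+◃-homo (m ℕ.* n)) (×1-homo-* m n)
    *-homo (+ m)    -[1+ n ] = trans (-◃-homo (m ℕ.* suc n))
      (trans (-‿cong (×1-homo-* m (suc n))) (-‿distribʳ-* _ _))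
    *-homo -[1+ m ] (+ n)    = trans (-◃-homo (suc m ℕ.* n))
      (trans (-‿cong (×1-homo-* (suc m) n)) (-‿distribˡ-* _ _))
    *-homo -[1+ m ] -[1+ n ] = begin
      fromℤ (Sign.+ ◃ (suc m ℕ.* suc n))  ≈⟨ +◃-homo (suc m ℕ.* suc n) ⟩
      (suc m ℕ.* suc n) ⊛ 1#              ≈⟨ ×1-homo-* (suc m) (suc n) ⟩
      (suc m ⊛ 1#) * (suc n ⊛ 1#)         ≈⟨ -‿involutive _ ⟨
      - - ((suc m ⊛ 1#) * (suc n ⊛ 1#))   ≈⟨ -‿cong (-‿distribˡ-* _ _) ⟩
      - (- (suc m ⊛ 1#) * (suc n ⊛ 1#))   ≈⟨ -‿distribʳ-* _ _ ⟩
      - (suc m ⊛ 1#) * - (suc n ⊛ 1#)     ∎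

    ℤ-rawRing : RawRing _ _
    ℤ-rawRing = record
      { Carrier = ℤ ; _≈_ = _≡_ ; _+_ = ℤ._+_ ; _*_ = ℤ._*_
      ; -_ = ℤ.-_ ; 0# = ℤ.0ℤ ; 1# = ℤ.1ℤ }

    morphism : ℤ-rawRing -Raw-AlmostCommutative⟶ fromCommutativeRing R
    morphism = record
      { ⟦_⟧    = fromℤ
      ; +-homo = +-homo
      ; *-homo = *-homo
      ; -‿homo = neg-homo
      ; 0-homo = refl
      -- The coefficient 1 denotes `1# + 0#`, not `1#`. Hence later proofs correct `con ℤ.1ℤ` by
      -- `+-identityʳ 1#`, or pass `1#` to the solver as a variable.
      ; 1-homo = +-identityʳ 1#
      }

    fromℤ-≟ : ∀ i j → Maybe (fromℤ i ≈ fromℤ j)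
    fromℤ-≟ i j with i ℤ.≟ j
    ... | yes ≡.refl = just refl
    ... | no  _      = nothing

  open import Algebra.Solver.Ring ℤ-rawRing (fromCommutativeRing R) morphism fromℤ-≟
    public using (solve; con; _:+_; _:*_; _:-_; :-_; _:=_)

-- Fields.

module FieldProperties {ℓ} (F : Field ℓ) where
  open Field F
  open import Algebra.Properties.Ring ring
  open IntegerCoefficients commutativeRing
  open ≈-Reasoning setoid

  *-cancelˡ : ∀ {x y z} → x ≉ 0# → x * y ≈ x * z → y ≈ z
  *-cancelˡ {x} {y} {z} x≉0 eq = begin
    y               ≈⟨ undo y ⟨
    x ⁻¹ * (x * y)  ≈⟨ *-congˡ eq ⟩
    x ⁻¹ * (x * z)  ≈⟨ undo z ⟩
    z               ∎
    where
    undo : ∀ w → x ⁻¹ * (x * w) ≈ w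
    undo w = begin
      x ⁻¹ * (x * w)  ≈⟨ solve 3 (λ x i w → i :* (x :* w) := (x :* i) :* w) refl x (x ⁻¹) w ⟩
      (x * x ⁻¹) * w  ≈⟨ *-congʳ (inverse x≉0) ⟩
      1# * w          ≈⟨ *-identityˡ w ⟩
      w               ∎

  *-cancelʳ : ∀ {x y z} → x ≉ 0# → y * x ≈ z * x → y ≈ z
  *-cancelʳ x≉0 eq = *-cancelˡ x≉0 (trans (*-comm _ _) (trans eq (*-comm _ _)))

  *-nonzero : ∀ {x y} → x ≉ 0# → y ≉ 0# → x * y ≉ 0#
  *-nonzero x≉0 y≉0 xy≈0 = y≉0 (*-cancelˡ x≉0 (trans xy≈0 (sym (zeroʳ _))))

  inverseˡ : ∀ {x} → x ≉ 0# → x ⁻¹ * x ≈ 1#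
  inverseˡ x≉0 = trans (*-comm _ _) (inverse x≉0)

  xy≈1⇒x≉0 : ∀ {x y} → x * y ≈ 1# → x ≉ 0#
  xy≈1⇒x≉0 xy≈1 x≈0 = 1≉0 (trans (sym xy≈1) (trans (*-congʳ x≈0) (zeroˡ _)))

  ⁻¹-nonzero : ∀ {x} → x ≉ 0# → x ⁻¹ ≉ 0#
  ⁻¹-nonzero x≉0 = xy≈1⇒x≉0 (inverseˡ x≉0)

  -‿nonzero : ∀ {x} → x ≉ 0# → - x ≉ 0#
  -‿nonzero x≉0 -x≈0 = x≉0 (trans (sym (-‿involutive _)) (trans (-‿cong -x≈0) -0#≈0#))

  x*y≈z⇒x≈z/y : ∀ {x y z} → y ≉ 0# → x * y ≈ z → x ≈ z * y ⁻¹
  x*y≈z⇒x≈z/y {x} {y} {z} y≉0 eq = *-cancelʳ y≉0 (begin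
    x * y             ≈⟨ eq ⟩
    z                 ≈⟨ *-identityʳ z ⟨
    z * 1#            ≈⟨ *-congˡ (inverseˡ y≉0) ⟨
    z * (y ⁻¹ * y)    ≈⟨ *-assoc _ _ _ ⟨
    z * y ⁻¹ * y      ∎)

  z/y*y≈z : ∀ {y} z → y ≉ 0# → z * y ⁻¹ * y ≈ z
  z/y*y≈z {y} z y≉0 = trans (*-assoc _ _ _) (trans (*-congˡ (inverseˡ y≉0)) (*-identityʳ z))

  x-y≈0⇒x≈y : ∀ {x y} → x - y ≈ 0# → x ≈ y
  x-y≈0⇒x≈y {x} {y} eq = begin
    x          ≈⟨ solve 2 (λ x y → x := (x :- y) :+ y) refl x y ⟩
    x - y + y  ≈⟨ +-congʳ eq ⟩
    0# + y     ≈⟨ +-identityˡ y ⟩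
    y          ∎

  x≈y⇒x-y≈0 : ∀ {x y} → x ≈ y → x - y ≈ 0#
  x≈y⇒x-y≈0 x≈y = trans (+-congʳ x≈y) (-‿inverseʳ _)

  x²≈1⇒x≈±1 : ∀ {x} → x * x ≈ 1# → x ≈ 1# ⊎ x ≈ - 1#
  x²≈1⇒x≈±1 {x} x²≈1 with x ≟ 1#
  ... | yes x≈1 = inj₁ x≈1
  ... | no  x≉1 = inj₂ (x-y≈0⇒x≈y (*-cancelˡ (λ e → x≉1 (x-y≈0⇒x≈y e)) (begin
    (x - 1#) * (x - - 1#)  ≈⟨ expand (x≈y⇒x-y≈0 x²≈1) ⟩
    0#                     ≈⟨ zeroʳ _ ⟨
    (x - 1#) * 0#          ∎)))
    where
    expand : x * x - 1# ≈ 0# → (x - 1#) * (x - - 1#) ≈ 0#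
    expand eq = begin
      (x - 1#) * (x - - 1#)            ≈⟨ solve 2 (λ x e → (x :- e) :* (x :- (:- e)) := x :* x :- e :* e) refl x 1# ⟩
      x * x - 1# * 1#                  ≈⟨ +-congˡ (-‿cong (*-identityˡ 1#)) ⟩
      x * x - 1#                       ≈⟨ eq ⟩
      0#                               ∎

-- Ordered fields.

module OrderedFieldProperties {ℓ} (ℝ : CompleteOrderedField ℓ) where
  open CompleteOrderedField ℝ public
  open FieldProperties field′ public
  open IntegerCoefficients commutativeRing public
  open TotalOrderProperties totalOrder public
    using (≰⇒>; <⇒≱; <-irrefl; <-trans; <-respʳ-≈; <-respˡ-≈)
  open TotalOrder totalOrder public
    using (poset; ≤-respʳ-≈; ≤-respˡ-≈; antisym; total)
    renaming (refl to ≤-refl; reflexive to ≤-reflexive; trans to ≤-trans)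
  open ≤-Reasoning poset

  <⇒≤ : ∀ {x y} → x < y → x ≤ y
  <⇒≤ = proj₁

  ≮⇒≥ : ∀ {x y} → ¬ (x < y) → y ≤ x
  ≮⇒≥ {x} {y} x≮y with total x y | x ≟ y
  ... | inj₂ y≤x | _       = y≤x
  ... | inj₁ _   | yes x≈y = ≤-reflexive (sym x≈y)
  ... | inj₁ x≤y | no  x≉y = contradiction (x≤y , x≉y) x≮y

  <-≤-trans : ∀ {x y z} → x < y → y ≤ z → x < z
  <-≤-trans {x} {y} {z} p q = begin-strict x <⟨ p ⟩ y ≤⟨ q ⟩ z ∎

  ≤-<-trans : ∀ {x y z} → x ≤ y → y < z → x < z
  ≤-<-trans {x} {y} {z} p q = begin-strict x ≤⟨ p ⟩ y <⟨ q ⟩ z ∎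

  >⇒≉ : ∀ {x y} → x < y → y ≉ x
  >⇒≉ x<y y≈x = proj₂ x<y (sym y≈x)

  *-monoˡ-≤ : ∀ {x y z} → 0# ≤ z → x ≤ y → z * x ≤ z * y
  *-monoˡ-≤ {x} {y} {z} 0≤z x≤y = begin
    z * x                  ≈⟨ +-identityˡ _ ⟨
    0# + z * x             ≤⟨ +-monoˡ-≤ _ (*-nonneg 0≤z 0≤y-x) ⟩
    z * (y - x) + z * x    ≈⟨ solve 3 (λ x y z → z :* (y :- x) :+ z :* x := z :* y) refl x y z ⟩
    z * y                  ∎
    where
    0≤y-x : 0# ≤ y - x
    0≤y-x = ≤-respˡ-≈ (-‿inverseʳ x) (+-monoˡ-≤ (- x) x≤y)

  *-monoʳ-≤ : ∀ {x y z} → 0# ≤ z → x ≤ y → x * z ≤ y * z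
  *-monoʳ-≤ {x} {y} {z} 0≤z x≤y = begin
    x * z  ≈⟨ *-comm x z ⟩
    z * x  ≤⟨ *-monoˡ-≤ 0≤z x≤y ⟩
    z * y  ≈⟨ *-comm z y ⟩
    y * z  ∎

  *-mono-≤ : ∀ {x y z w} → 0# ≤ y → 0# ≤ z → x ≤ y → z ≤ w → x * z ≤ y * w
  *-mono-≤ 0≤y 0≤z x≤y z≤w = ≤-trans (*-monoʳ-≤ 0≤z x≤y) (*-monoˡ-≤ 0≤y z≤w)

  *-monoˡ-< : ∀ {x y z} → 0# < z → x < y → z * x < z * y
  *-monoˡ-< 0<z x<y = *-monoˡ-≤ (<⇒≤ 0<z) (<⇒≤ x<y)
                    , λ eq → proj₂ x<y (*-cancelˡ (>⇒≉ 0<z) eq)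

  *-monoʳ-< : ∀ {x y z} → 0# < z → x < y → x * z < y * z
  *-monoʳ-< 0<z x<y = *-monoʳ-≤ (<⇒≤ 0<z) (<⇒≤ x<y)
                    , λ eq → proj₂ x<y (*-cancelʳ (>⇒≉ 0<z) eq)

  *-cancelˡ-≤ : ∀ {x y z} → 0# < z → z * x ≤ z * y → x ≤ y
  *-cancelˡ-≤ 0<z zx≤zy = ≮⇒≥ λ y<x → <⇒≱ (*-monoˡ-< 0<z y<x) zx≤zy

  *-cancelʳ-≤ : ∀ {x y z} → 0# < z → x * z ≤ y * z → x ≤ y
  *-cancelʳ-≤ 0<z xz≤yz = ≮⇒≥ λ y<x → <⇒≱ (*-monoʳ-< 0<z y<x) xz≤yz

  *-cancelˡ-< : ∀ {x y z} → 0# ≤ z → z * x < z * y → x < y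
  *-cancelˡ-< 0≤z zx<zy = ≰⇒> λ y≤x → <⇒≱ zx<zy (*-monoˡ-≤ 0≤z y≤x)

  *-pos : ∀ {x y} → 0# < x → 0# < y → 0# < x * y
  *-pos 0<x 0<y = *-nonneg (<⇒≤ 0<x) (<⇒≤ 0<y)
                , λ eq → *-nonzero (>⇒≉ 0<x) (>⇒≉ 0<y) (sym eq)

  0<1 : 0# < 1#
  0<1 with total 0# 1#
  ... | inj₁ 0≤1 = 0≤1 , λ eq → 1≉0 (sym eq)
  ... | inj₂ 1≤0 = contradiction (antisym 1≤0 0≤1) 1≉0
    where
    0≤-1 : 0# ≤ - 1#
    0≤-1 = begin
      0#         ≈⟨ -‿inverseʳ 1# ⟨
      1# - 1#    ≤⟨ +-monoˡ-≤ (- 1#) 1≤0 ⟩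
      0# - 1#    ≈⟨ +-identityˡ _ ⟩
      - 1#       ∎
    0≤1 : 0# ≤ 1#
    0≤1 = ≤-respʳ-≈ (trans (solve 1 (λ e → :- e :* :- e := e :* e) refl 1#) (*-identityˡ 1#))
            (*-nonneg 0≤-1 0≤-1)

  ⁻¹-pos : ∀ {x} → 0# < x → 0# < x ⁻¹
  ⁻¹-pos {x} 0<x = *-cancelˡ-< (<⇒≤ 0<x) (begin-strict
    x * 0#    ≈⟨ zeroʳ x ⟩
    0#        <⟨ 0<1 ⟩
    1#        ≈⟨ inverse (>⇒≉ 0<x) ⟨
    x * x ⁻¹  ∎)

  x<x+1 : ∀ x → x < x + 1#
  x<x+1 x = (begin
    x       ≈⟨ +-identityˡ x ⟨
    0# + x  ≤⟨ +-monoˡ-≤ x (<⇒≤ 0<1) ⟩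
    1# + x  ≈⟨ +-comm 1# x ⟩
    x + 1#  ∎)
    , λ eq → 1≉0 (trans (solve 2 (λ x e → e := (x :+ e) :- x) refl x 1#)
                        (trans (+-congʳ (sym eq)) (-‿inverseʳ x)))

  x-1<x : ∀ x → x - 1# < x
  x-1<x x = <-respʳ-≈ (solve 2 (λ x e → (x :- e) :+ e := x) refl x 1#) (x<x+1 (x - 1#))

  private
    maxOp = Max.maxOperator totalOrder

  open MaxOp maxOp public using ()
    renaming ( x≤x⊔y to x≤max; x≤y⊔x to y≤max; ⊔-sel to max-sel; ⊔-cong to max-cong)

  max-lub : ∀ {x y z} → x ≤ z → y ≤ z → max x y ≤ z
  max-lub {x} {y} x≤z y≤z with max-sel x y
  ... | inj₁ eq = ≤-respˡ-≈ (sym eq) x≤z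
  ... | inj₂ eq = ≤-respˡ-≈ (sym eq) y≤z

  max-lub-< : ∀ {x y z} → x < z → y < z → max x y < z
  max-lub-< {x} {y} x<z y<z with max-sel x y
  ... | inj₁ eq = <-respˡ-≈ (sym eq) x<z
  ... | inj₂ eq = <-respˡ-≈ (sym eq) y<z

  *-max-lub : ∀ {c x y z} → c * x ≤ z → c * y ≤ z → c * max x y ≤ z
  *-max-lub {c} {x} {y} p q with max-sel x y
  ... | inj₁ eq = ≤-respˡ-≈ (*-congˡ (sym eq)) p
  ... | inj₂ eq = ≤-respˡ-≈ (*-congˡ (sym eq)) q

-- Non-Archimedean absolute values.

module ValuationProperties {ℓ} {ℝ : CompleteOrderedField ℓ} (𝕂 : CompleteNonArchimedeanField ℝ) where
  private
    module ℝ = OrderedFieldProperties ℝ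
  open CompleteNonArchimedeanField 𝕂
  open FieldProperties field′ public
  open IntegerCoefficients commutativeRing
  open ≤-Reasoning ℝ.poset

  0<∣x∣ : ∀ {x} → x ≉ 0# → ℝ.0# ℝ.< ∣ x ∣
  0<∣x∣ x≉0 = ∣∣-nonneg _ , λ eq → x≉0 (∣x∣≈0⇒x≈0 (ℝ.sym eq))

  ∣1∣≈1 : ∣ 1# ∣ ℝ.≈ ℝ.1#
  ∣1∣≈1 = ℝ.*-cancelˡ (ℝ.>⇒≉ (0<∣x∣ 1≉0)) (ℝ.trans (ℝ.sym (∣∣-* 1# 1#))
    (ℝ.trans (∣∣-cong (*-identityˡ 1#)) (ℝ.sym (ℝ.*-identityʳ _))))

  ∣-1∣≈1 : ∣ - 1# ∣ ℝ.≈ ℝ.1#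
  ∣-1∣≈1 with ℝ.x²≈1⇒x≈±1 (ℝ.trans (ℝ.sym (∣∣-* (- 1#) (- 1#)))
       (ℝ.trans (∣∣-cong (trans (solve 1 (λ e → :- e :* :- e := e :* e) refl 1#) (*-identityˡ 1#))) ∣1∣≈1))
  ... | inj₁ eq = eq
  ... | inj₂ eq = contradiction (begin-strict
    ℝ.0#               ≤⟨ ∣∣-nonneg _ ⟩
    ∣ - 1# ∣           <⟨ ℝ.x<x+1 _ ⟩
    ∣ - 1# ∣ ℝ.+ ℝ.1#  ≈⟨ ℝ.+-congʳ eq ⟩
    ℝ.- ℝ.1# ℝ.+ ℝ.1#  ≈⟨ ℝ.-‿inverseˡ ℝ.1# ⟩
    ℝ.0#               ∎) (ℝ.<-irrefl ℝ.refl)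

  ∣-x∣≈∣x∣ : ∀ x → ∣ - x ∣ ℝ.≈ ∣ x ∣
  ∣-x∣≈∣x∣ x = begin-equality
    ∣ - x ∣               ≈⟨ ∣∣-cong (-1*x≈-x x) ⟨
    ∣ - 1# * x ∣          ≈⟨ ∣∣-* _ _ ⟩
    ∣ - 1# ∣ ℝ.* ∣ x ∣    ≈⟨ ℝ.*-congʳ ∣-1∣≈1 ⟩
    ℝ.1# ℝ.* ∣ x ∣        ≈⟨ ℝ.*-identityˡ _ ⟩
    ∣ x ∣                 ∎
    where open import Algebra.Properties.Ring ring using (-1*x≈-x)

  ∣x+y∣≤ : ∀ {x y r} → ∣ x ∣ ℝ.≤ r → ∣ y ∣ ℝ.≤ r → ∣ x + y ∣ ℝ.≤ r
  ∣x+y∣≤ p q = ℝ.≤-trans (ultrametric _ _) (ℝ.max-lub p q)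

  ∣x+y∣< : ∀ {x y r} → ∣ x ∣ ℝ.< r → ∣ y ∣ ℝ.< r → ∣ x + y ∣ ℝ.< r
  ∣x+y∣< p q = ℝ.≤-<-trans (ultrametric _ _) (ℝ.max-lub-< p q)

  ∣x-y∣≤ : ∀ {x y r} → ∣ x ∣ ℝ.≤ r → ∣ y ∣ ℝ.≤ r → ∣ x - y ∣ ℝ.≤ r
  ∣x-y∣≤ p q = ∣x+y∣≤ p (ℝ.≤-respˡ-≈ (ℝ.sym (∣-x∣≈∣x∣ _)) q)

  ∣x-y∣< : ∀ {x y r} → ∣ x ∣ ℝ.< r → ∣ y ∣ ℝ.< r → ∣ x - y ∣ ℝ.< r
  ∣x-y∣< p q = ∣x+y∣< p (ℝ.<-respˡ-≈ (ℝ.sym (∣-x∣≈∣x∣ _)) q)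

  -- Otherwise `x`, being the difference of `x + y` and `y`, would be smaller than itself.
  ∣y∣<∣x∣⇒∣x∣≤∣x+y∣ : ∀ {x y} → ∣ y ∣ ℝ.< ∣ x ∣ → ∣ x ∣ ℝ.≤ ∣ x + y ∣
  ∣y∣<∣x∣⇒∣x∣≤∣x+y∣ {x} {y} y<x = ℝ.≮⇒≥ λ x+y<x → ℝ.<-irrefl ℝ.refl
    (ℝ.≤-<-trans (ℝ.≤-reflexive (∣∣-cong (solve 2 (λ x y → x := (x :+ y) :- y) refl x y)))
                 (∣x-y∣< x+y<x y<x))

  ∣x-y∣≈∣y-x∣ : ∀ x y → ∣ x - y ∣ ℝ.≈ ∣ y - x ∣
  ∣x-y∣≈∣y-x∣ x y = ℝ.trans (∣∣-cong (solve 2 (λ x y → x :- y := :- (y :- x)) refl x y)) (∣-x∣≈∣x∣ _)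

-- Group actions, the projective line and cross ratios.

record RightAction {g ℓ₁ x ℓ₂} (G : Group g ℓ₁) (X : Setoid x ℓ₂) : Set (g ⊔ ℓ₁ ⊔ x ⊔ ℓ₂) where
  private
    module G = Group G
    module X = Setoid X
  infixl 7 _◂_
  field
    _◂_    : X.Carrier → G.Carrier → X.Carrier
    ◂-cong : ∀ {p q M N} → p X.≈ q → M G.≈ N → p ◂ M X.≈ q ◂ N
    ◂-ε    : ∀ p → p ◂ G.ε X.≈ p
    ◂-∙    : ∀ p M N → p ◂ (M G.∙ N) X.≈ p ◂ M ◂ N

module ProjectiveProperties {ℓ} (F : Field ℓ) where
  open Field F
  open FieldProperties F
  open IntegerCoefficients commutativeRing
  open Projective F
  open ≈-Reasoning setoid

  infix 6 _∧_
  -- Over an arbitrary field. For 𝕂 it unfolds to the same term as the numerator of the chordal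
  -- metric, so the lemmas below apply to both.
  _∧_ : P¹ → P¹ → Carrier
  [ x ∶ y ]⟨ _ ⟩ ∧ [ x′ ∶ y′ ]⟨ _ ⟩ = x * y′ - y * x′

  det : GL₂ → Carrier
  det (mat a b c d _) = a * d - b * c

  det≉0 : ∀ M → det M ≉ 0#
  det≉0 (mat _ _ _ _ p) = p

  ∧-◂ : ∀ M p q → (p ◂ M) ∧ (q ◂ M) ≈ det M * (p ∧ q)
  ∧-◂ (mat a b c d _) [ x ∶ y ]⟨ _ ⟩ [ x′ ∶ y′ ]⟨ _ ⟩ =
    solve 8 (λ a b c d x y x′ y′ →
        (x :* a :+ y :* c) :* (x′ :* b :+ y′ :* d) :- (x :* b :+ y :* d) :* (x′ :* a :+ y′ :* c)
      := (a :* d :- b :* c) :* (x :* y′ :- y :* x′))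
      refl a b c d x y x′ y′

  ∧-scale : ∀ {p q p′ q′} ((k , _) : p ≋ p′) ((l , _) : q ≋ q′) → p′ ∧ q′ ≈ k * l * (p ∧ q)
  ∧-scale {[ x ∶ y ]⟨ _ ⟩} {[ z ∶ w ]⟨ _ ⟩} (k , _ , x′ , y′) (l , _ , z′ , w′) =
    trans (+-cong (*-cong x′ w′) (-‿cong (*-cong y′ z′)))
      (solve 6 (λ k l x y z w →
          (k :* x) :* (l :* w) :- (k :* y) :* (l :* z) := k :* l :* (x :* w :- y :* z))
        refl k l x y z w)

  ≋⇒∧≈0 : ∀ {p q} → p ≋ q → p ∧ q ≈ 0#
  ≋⇒∧≈0 {[ x ∶ y ]⟨ _ ⟩} (k , _ , x′ , y′) =
    trans (+-cong (*-congˡ y′) (-‿cong (*-congˡ x′)))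
      (solve 3 (λ k x y → x :* (k :* y) :- y :* (k :* x) := con (ℤ.0ℤ)) refl k x y)

  private
    proportional : ∀ {x y x′ y′} → x ≉ 0# → ¬ (x′ ≈ 0# × y′ ≈ 0#) → x * y′ ≈ y * x′ →
                   ∃[ k ] (k ≉ 0# × x′ ≈ k * x × y′ ≈ k * y)
    proportional {x} {y} {x′} {y′} x≉0 nz eq =
      x′ * x ⁻¹ , *-nonzero x′≉0 (⁻¹-nonzero x≉0) , sym (z/y*y≈z x′ x≉0)
      , *-cancelˡ x≉0 (begin
          x * y′                ≈⟨ eq ⟩
          y * x′                ≈⟨ *-comm y x′ ⟩
          x′ * y                ≈⟨ *-congʳ (z/y*y≈z x′ x≉0) ⟨
          x′ * x ⁻¹ * x * y     ≈⟨ solve 3 (λ k x y → k :* x :* y := x :* (k :* y)) refl (x′ * x ⁻¹) x y ⟩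
          x * (x′ * x ⁻¹ * y)   ∎)
      where
      x′≉0 : x′ ≉ 0#
      x′≉0 x′≈0 = nz (x′≈0 , *-cancelˡ x≉0 (begin
        x * y′  ≈⟨ eq ⟩
        y * x′  ≈⟨ *-congˡ x′≈0 ⟩
        y * 0#  ≈⟨ zeroʳ y ⟩
        0#      ≈⟨ zeroʳ x ⟨
        x * 0#  ∎))

  ∧≈0⇒≋ : ∀ {p q} → p ∧ q ≈ 0# → p ≋ q
  ∧≈0⇒≋ {[ x ∶ y ]⟨ nz ⟩} {[ x′ ∶ y′ ]⟨ nz′ ⟩} eq with x ≟ 0# | y ≟ 0#
  ... | no  x≉0 | _       = proportional x≉0 nz′ (x-y≈0⇒x≈y eq)
  ... | yes x≈0 | yes y≈0 = contradiction (x≈0 , y≈0) nz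
  ... | yes _   | no  y≉0
    with k , k≉0 , y′≈ , x′≈ ← proportional y≉0 (λ (u , v) → nz′ (v , u)) (sym (x-y≈0⇒x≈y eq))
    = k , k≉0 , x′≈ , y′≈

  ≋-setoid : Setoid ℓ ℓ
  ≋-setoid = record
    { Carrier = P¹
    ; _≈_ = _≋_
    ; isEquivalence = record
      { refl  = 1# , 1≉0 , sym (*-identityˡ _) , sym (*-identityˡ _)
      ; sym   = λ (k , k≉0 , e , f) → k ⁻¹ , ⁻¹-nonzero k≉0 , invert k≉0 e , invert k≉0 f
      ; trans = λ (k , k≉0 , e , f) (l , l≉0 , e′ , f′) →
          l * k , *-nonzero l≉0 k≉0
          , trans e′ (trans (*-congˡ e) (sym (*-assoc l k _)))
          , trans f′ (trans (*-congˡ f) (sym (*-assoc l k _)))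
      }
    }
    where
    invert : ∀ {k x x′} → k ≉ 0# → x′ ≈ k * x → x ≈ k ⁻¹ * x′
    invert k≉0 e = trans (x*y≈z⇒x≈z/y k≉0 (trans (*-comm _ _) (sym e))) (*-comm _ _)

  open Setoid ≋-setoid public using () renaming (refl to ≋-refl; sym to ≋-sym; trans to ≋-trans)

  ◂-action : RightAction PGL₂ ≋-setoid
  ◂-action = record
    { _◂_ = _◂_
    ; ◂-cong = λ { (k , k≉0 , e , f) (l , l≉0 , a , b , c , d) →
        k * l , *-nonzero k≉0 l≉0
        , trans (+-cong (*-cong e a) (*-cong f c)) (scale _ _ _ _ _ _)
        , trans (+-cong (*-cong e b) (*-cong f d)) (scale _ _ _ _ _ _) }
    ; ◂-ε = λ { [ x ∶ y ]⟨ _ ⟩ → 1# , 1≉0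
        , trans (solve 2 (λ x y → x := x :* con ℤ.1ℤ :+ y :* con ℤ.0ℤ) refl x y)
            (trans (+-cong (*-congˡ (+-identityʳ 1#)) refl) (sym (*-identityˡ _)))
        , trans (solve 2 (λ x y → y := x :* con ℤ.0ℤ :+ y :* con ℤ.1ℤ) refl x y)
            (trans (+-congˡ (*-congˡ (+-identityʳ 1#))) (sym (*-identityˡ _))) }
    ; ◂-∙ = λ { [ x ∶ y ]⟨ _ ⟩ (mat a b c d _) (mat a′ b′ c′ d′ _) → 1# , 1≉0
        , trans (assoc′ x y a b c d a′ c′) (sym (*-identityˡ _))
        , trans (assoc′ x y a b c d b′ d′) (sym (*-identityˡ _)) }
    }
    where
    scale : ∀ k l x y a c → (k * x) * (l * a) + (k * y) * (l * c) ≈ k * l * (x * a + y * c)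
    scale = solve 6 (λ k l x y a c →
      (k :* x) :* (l :* a) :+ (k :* y) :* (l :* c) := k :* l :* (x :* a :+ y :* c)) refl
    assoc′ : ∀ x y a b c d u v →
             (x * a + y * c) * u + (x * b + y * d) * v ≈ x * (a * u + b * v) + y * (c * u + d * v)
    assoc′ = solve 8 (λ x y a b c d u v →
        (x :* a :+ y :* c) :* u :+ (x :* b :+ y :* d) :* v
      := x :* (a :* u :+ b :* v) :+ y :* (c :* u :+ d :* v)) refl

  cross-multiply : ∀ {N D N′ D′} → D ≉ 0# → D′ ≉ 0# → N * D′ ≈ N′ * D → N * D ⁻¹ ≈ N′ * D′ ⁻¹
  cross-multiply {N} {D} {N′} {D′} D≉0 D′≉0 eq = x*y≈z⇒x≈z/y D′≉0 (*-cancelʳ D≉0 (begin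
    N * D ⁻¹ * D′ * D    ≈⟨ solve 4 (λ n i d e → n :* i :* d :* e := n :* d :* (e :* i)) refl N (D ⁻¹) D′ D ⟩
    N * D′ * (D * D ⁻¹)  ≈⟨ *-cong eq (inverse D≉0) ⟩
    N′ * D * 1#          ≈⟨ *-identityʳ _ ⟩
    N′ * D               ∎))

  quotient-* : ∀ {N D N′ D′} → D ≉ 0# → D′ ≉ 0# →
               (N * D ⁻¹) * (N′ * D′ ⁻¹) ≈ (N * N′) * (D * D′) ⁻¹
  quotient-* {N} {D} {N′} {D′} D≉0 D′≉0 = x*y≈z⇒x≈z/y (*-nonzero D≉0 D′≉0) (begin
    (N * D ⁻¹) * (N′ * D′ ⁻¹) * (D * D′)    ≈⟨ solve 4 (λ x y d e → x :* y :* (d :* e) := (x :* d) :* (y :* e)) refl (N * D ⁻¹) (N′ * D′ ⁻¹) D D′ ⟩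
    (N * D ⁻¹ * D) * (N′ * D′ ⁻¹ * D′)      ≈⟨ *-cong (z/y*y≈z N D≉0) (z/y*y≈z N′ D′≉0) ⟩
    N * N′                                  ∎)

  quotient≈1 : ∀ {N D} → D ≉ 0# → N ≈ D → N * D ⁻¹ ≈ 1#
  quotient≈1 D≉0 N≈D = trans (*-congʳ N≈D) (inverse D≉0)

  -- In affine coordinates, (u - p)(v - q) / ((u - q)(v - p)). The denominator vanishes when `u ≋ q`
  -- or `v ≋ p`, which explains the hypotheses `u ≭ q` and `v ≭ p` below.
  crossRatio : P¹ → P¹ → P¹ → P¹ → Carrier
  crossRatio u v p q = (u ∧ p) * (v ∧ q) * ((u ∧ q) * (v ∧ p)) ⁻¹

  ≭⇒∧≉0 : ∀ {p q} → p ≭ q → p ∧ q ≉ 0#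
  ≭⇒∧≉0 {p} {q} p≭q eq = p≭q (∧≈0⇒≋ {p} {q} eq)

  ∧-nonzero : ∀ {u v p q} → u ≭ q → v ≭ p → (u ∧ q) * (v ∧ p) ≉ 0#
  ∧-nonzero {u} {v} {p} {q} u≭q v≭p = *-nonzero (≭⇒∧≉0 {u} {q} u≭q) (≭⇒∧≉0 {v} {p} v≭p)

  crossRatio-cong : ∀ {u v p q u′ v′ p′ q′} → u ≋ u′ → v ≋ v′ → p ≋ p′ → q ≋ q′ →
                    u ≭ q → v ≭ p → crossRatio u v p q ≈ crossRatio u′ v′ p′ q′
  crossRatio-cong {u} {v} {p} {q} {u′} {v′} {p′} {q′} U@(i , i≉0 , _) V@(j , j≉0 , _) P@(k , k≉0 , _) Q@(l , l≉0 , _) u≭q v≭p =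
    cross-multiply D≉0 D′≉0 (begin
      (u ∧ p) * (v ∧ q) * ((u′ ∧ q′) * (v′ ∧ p′))
        ≈⟨ *-congˡ (*-cong uq vp) ⟩
      (u ∧ p) * (v ∧ q) * (i * l * (u ∧ q) * (j * k * (v ∧ p)))
        ≈⟨ solve 8 (λ i j k l up vq uq vp →
             up :* vq :* (i :* l :* uq :* (j :* k :* vp)) := i :* k :* up :* (j :* l :* vq) :* (uq :* vp))
             refl i j k l (u ∧ p) (v ∧ q) (u ∧ q) (v ∧ p) ⟩
      i * k * (u ∧ p) * (j * l * (v ∧ q)) * ((u ∧ q) * (v ∧ p))
        ≈⟨ *-congʳ (*-cong (∧-scale {u} {p} {u′} {p′} U P) (∧-scale {v} {q} {v′} {q′} V Q)) ⟨
      (u′ ∧ p′) * (v′ ∧ q′) * ((u ∧ q) * (v ∧ p)) ∎)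
    where
    uq : u′ ∧ q′ ≈ i * l * (u ∧ q)
    uq = ∧-scale {u} {q} {u′} {q′} U Q
    vp : v′ ∧ p′ ≈ j * k * (v ∧ p)
    vp = ∧-scale {v} {p} {v′} {p′} V P
    D≉0 : (u ∧ q) * (v ∧ p) ≉ 0#
    D≉0 = ∧-nonzero {u} {v} {p} {q} u≭q v≭p
    D′≉0 : (u′ ∧ q′) * (v′ ∧ p′) ≉ 0#
    D′≉0 eq = *-nonzero
      (*-nonzero (*-nonzero i≉0 l≉0) (≭⇒∧≉0 {u} {q} u≭q))
      (*-nonzero (*-nonzero j≉0 k≉0) (≭⇒∧≉0 {v} {p} v≭p))
      (trans (sym (*-cong uq vp)) eq)

  crossRatio-◂ : ∀ M {u v p q} → u ≭ q → v ≭ p →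
                 crossRatio (u ◂ M) (v ◂ M) (p ◂ M) (q ◂ M) ≈ crossRatio u v p q
  crossRatio-◂ M {u} {v} {p} {q} u≭q v≭p = cross-multiply D′≉0 D≉0 (begin
      ((u ◂ M) ∧ (p ◂ M)) * ((v ◂ M) ∧ (q ◂ M)) * ((u ∧ q) * (v ∧ p))
        ≈⟨ *-congʳ (*-cong (∧-◂ M u p) (∧-◂ M v q)) ⟩
      (δ * (u ∧ p)) * (δ * (v ∧ q)) * ((u ∧ q) * (v ∧ p))
        ≈⟨ solve 5 (λ δ up vq uq vp →
             (δ :* up) :* (δ :* vq) :* (uq :* vp) := up :* vq :* ((δ :* uq) :* (δ :* vp)))
             refl δ (u ∧ p) (v ∧ q) (u ∧ q) (v ∧ p) ⟩
      (u ∧ p) * (v ∧ q) * ((δ * (u ∧ q)) * (δ * (v ∧ p)))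
        ≈⟨ *-congˡ (*-cong (∧-◂ M u q) (∧-◂ M v p)) ⟨
      (u ∧ p) * (v ∧ q) * (((u ◂ M) ∧ (q ◂ M)) * ((v ◂ M) ∧ (p ◂ M))) ∎)
    where
    δ = det M
    D≉0 : (u ∧ q) * (v ∧ p) ≉ 0#
    D≉0 = ∧-nonzero {u} {v} {p} {q} u≭q v≭p
    D′≉0 : ((u ◂ M) ∧ (q ◂ M)) * ((v ◂ M) ∧ (p ◂ M)) ≉ 0#
    D′≉0 eq = *-nonzero
      (*-nonzero (det≉0 M) (≭⇒∧≉0 {u} {q} u≭q))
      (*-nonzero (det≉0 M) (≭⇒∧≉0 {v} {p} v≭p))
      (trans (sym (*-cong (∧-◂ M u q) (∧-◂ M v p))) eq)

  crossRatio-cocycle : ∀ {u v p q r} → u ≭ q → u ≭ r → v ≭ p → v ≭ q →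
                       crossRatio u v p q * crossRatio u v q r ≈ crossRatio u v p r
  crossRatio-cocycle {u} {v} {p} {q} {r} u≭q u≭r v≭p v≭q = begin
    crossRatio u v p q * crossRatio u v q r
      ≈⟨ quotient-* D₁≉0 D₂≉0 ⟩
    ((u ∧ p) * (v ∧ q) * ((u ∧ q) * (v ∧ r))) * (((u ∧ q) * (v ∧ p)) * ((u ∧ r) * (v ∧ q))) ⁻¹
      ≈⟨ cross-multiply (*-nonzero D₁≉0 D₂≉0) (∧-nonzero {u} {v} {p} {r} u≭r v≭p)
           (solve 6 (λ up uq ur vp vq vr →
               (up :* vq :* (uq :* vr)) :* (ur :* vp) := (up :* vr) :* ((uq :* vp) :* (ur :* vq)))
             refl (u ∧ p) (u ∧ q) (u ∧ r) (v ∧ p) (v ∧ q) (v ∧ r)) ⟩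
    crossRatio u v p r ∎
    where
    D₁≉0 : (u ∧ q) * (v ∧ p) ≉ 0#
    D₁≉0 = ∧-nonzero {u} {v} {p} {q} u≭q v≭p
    D₂≉0 : (u ∧ r) * (v ∧ q) ≉ 0#
    D₂≉0 = ∧-nonzero {u} {v} {q} {r} u≭r v≭q

  crossRatio-swap : ∀ {u v p q} → u ≭ p → u ≭ q → v ≭ p → v ≭ q →
                    crossRatio u v p q * crossRatio v u p q ≈ 1#
  crossRatio-swap {u} {v} {p} {q} u≭p u≭q v≭p v≭q = begin
    crossRatio u v p q * crossRatio v u p q ≈⟨ quotient-* D₁≉0 D₂≉0 ⟩
    _                                       ≈⟨ quotient≈1 (*-nonzero D₁≉0 D₂≉0)
      (solve 4 (λ up vq vp uq → up :* vq :* (vp :* uq) := uq :* vp :* (vq :* up)) refl (u ∧ p) (v ∧ q) (v ∧ p) (u ∧ q)) ⟩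
    1# ∎
    where
    D₁≉0 : (u ∧ q) * (v ∧ p) ≉ 0#
    D₁≉0 = ∧-nonzero {u} {v} {p} {q} u≭q v≭p
    D₂≉0 : (v ∧ q) * (u ∧ p) ≉ 0#
    D₂≉0 = ∧-nonzero {v} {u} {p} {q} v≭q u≭p

  -- By the Plücker relation, numerator minus denominator is `(u ∧ v) * (p ∧ q)`.
  crossRatio≈1 : ∀ {u v p q} → u ≭ q → v ≭ p → p ≭ q → crossRatio u v p q ≈ 1# → u ≋ v
  crossRatio≈1 {u@([ u₁ ∶ u₂ ]⟨ _ ⟩)} {v@([ v₁ ∶ v₂ ]⟨ _ ⟩)} {p@([ p₁ ∶ p₂ ]⟨ _ ⟩)} {q@([ q₁ ∶ q₂ ]⟨ _ ⟩)} u≭q v≭p p≭q eq =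
    ∧≈0⇒≋ {u} {v} (*-cancelʳ (≭⇒∧≉0 {p} {q} p≭q) (begin
      (u ∧ v) * (p ∧ q)
        ≈⟨ solve 8 (λ u₁ u₂ v₁ v₂ p₁ p₂ q₁ q₂ →
             (u₁ :* v₂ :- u₂ :* v₁) :* (p₁ :* q₂ :- p₂ :* q₁)
           := (u₁ :* p₂ :- u₂ :* p₁) :* (v₁ :* q₂ :- v₂ :* q₁) :- (u₁ :* q₂ :- u₂ :* q₁) :* (v₁ :* p₂ :- v₂ :* p₁))
             refl u₁ u₂ v₁ v₂ p₁ p₂ q₁ q₂ ⟩
      (u ∧ p) * (v ∧ q) - (u ∧ q) * (v ∧ p)
        ≈⟨ x≈y⇒x-y≈0 N≈D ⟩
      0#  ≈⟨ zeroˡ _ ⟨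
      0# * (p ∧ q) ∎))
    where
    D≉0 : (u ∧ q) * (v ∧ p) ≉ 0#
    D≉0 = ∧-nonzero {u} {v} {p} {q} u≭q v≭p
    N≈D : (u ∧ p) * (v ∧ q) ≈ (u ∧ q) * (v ∧ p)
    N≈D = begin
      (u ∧ p) * (v ∧ q)                       ≈⟨ z/y*y≈z _ D≉0 ⟨
      crossRatio u v p q * ((u ∧ q) * (v ∧ p)) ≈⟨ *-congʳ eq ⟩
      1# * ((u ∧ q) * (v ∧ p))                ≈⟨ *-identityˡ _ ⟩
      (u ∧ q) * (v ∧ p)                       ∎

  -- What matters is that μ is independent of `z`: it absorbs both the choice of homogeneous
  -- coordinates and the convention at ∞, and it cancels as soon as `p` occurs once in a numerator
  -- and once in a denominator.
  ⊖-∧ : ∀ p → ∃[ μ ] (μ ≉ 0# × (∀ z → z ⊖ p ≈ (ι z ∧ p) * μ))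
  ⊖-∧ [ x ∶ y ]⟨ nz ⟩ with y ≟ 0#
  ... | yes y≈0 = (- x) ⁻¹ , ⁻¹-nonzero -x≉0 , λ z → begin
    1#                            ≈⟨ inverse -x≉0 ⟨
    - x * (- x) ⁻¹                ≈⟨ *-congʳ (begin
      - x                ≈⟨ solve 3 (λ x z e → :- x := z :* con ℤ.0ℤ :- x) refl x z 1# ⟩
      z * 0# - x         ≈⟨ +-cong (*-congˡ (sym y≈0)) (-‿cong (sym (*-identityˡ x))) ⟩
      z * y - 1# * x     ∎) ⟩
    (z * y - 1# * x) * (- x) ⁻¹   ∎
    where
    -x≉0 : - x ≉ 0#
    -x≉0 = -‿nonzero λ x≈0 → nz (x≈0 , y≈0)
  ... | no  y≉0 = y ⁻¹ , ⁻¹-nonzero y≉0 , λ z → begin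
    z - x * y ⁻¹                 ≈⟨ +-congʳ (*-identityʳ z) ⟨
    z * 1# - x * y ⁻¹            ≈⟨ +-congʳ (*-congˡ (inverse y≉0)) ⟨
    z * (y * y ⁻¹) - x * y ⁻¹    ≈⟨ solve 4 (λ z y i x → z :* (y :* i) :- x :* i := (z :* y :- x) :* i) refl z y (y ⁻¹) x ⟩
    (z * y - x) * y ⁻¹           ≈⟨ *-congʳ (+-congˡ (-‿cong (*-identityˡ x))) ⟨
    (z * y - 1# * x) * y ⁻¹      ∎

  -- The factor of Θ_{p,q} at z, times the factor of Θ_{q,p} at w.
  factors≈crossRatio : ∀ {z w p q} → ι z ≭ q → ι w ≭ p →
    ((z ⊖ p) * (z ⊖ q) ⁻¹) * ((w ⊖ q) * (w ⊖ p) ⁻¹) ≈ crossRatio (ι z) (ι w) p q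
  factors≈crossRatio {z} {w} {p} {q} z≭q w≭p
    with μ , μ≉0 , p≈ ← ⊖-∧ p | ν , ν≉0 , q≈ ← ⊖-∧ q = begin
    ((z ⊖ p) * (z ⊖ q) ⁻¹) * ((w ⊖ q) * (w ⊖ p) ⁻¹)
      ≈⟨ quotient-* zq≉0 wp≉0 ⟩
    ((z ⊖ p) * (w ⊖ q)) * ((z ⊖ q) * (w ⊖ p)) ⁻¹
      ≈⟨ cross-multiply (*-nonzero zq≉0 wp≉0) (∧-nonzero {ι z} {ι w} {p} {q} z≭q w≭p) (begin
           (z ⊖ p) * (w ⊖ q) * ((ι z ∧ q) * (ι w ∧ p))
             ≈⟨ *-congʳ (*-cong (p≈ z) (q≈ w)) ⟩
           ((ι z ∧ p) * μ) * ((ι w ∧ q) * ν) * ((ι z ∧ q) * (ι w ∧ p))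
             ≈⟨ solve 6 (λ zp wq zq wp μ ν →
                  (zp :* μ) :* (wq :* ν) :* (zq :* wp) := zp :* wq :* ((zq :* ν) :* (wp :* μ)))
                  refl (ι z ∧ p) (ι w ∧ q) (ι z ∧ q) (ι w ∧ p) μ ν ⟩
           (ι z ∧ p) * (ι w ∧ q) * (((ι z ∧ q) * ν) * ((ι w ∧ p) * μ))
             ≈⟨ *-congˡ (*-cong (q≈ z) (p≈ w)) ⟨
           (ι z ∧ p) * (ι w ∧ q) * ((z ⊖ q) * (w ⊖ p)) ∎) ⟩
    crossRatio (ι z) (ι w) p q ∎
    where
    zq≉0 : z ⊖ q ≉ 0#
    zq≉0 e = *-nonzero (≭⇒∧≉0 {ι z} {q} z≭q) ν≉0 (trans (sym (q≈ z)) e)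
    wp≉0 : w ⊖ p ≉ 0#
    wp≉0 e = *-nonzero (≭⇒∧≉0 {ι w} {p} w≭p) μ≉0 (trans (sym (p≈ w)) e)

  ι-finite : ∀ {p} → p ≭ ∞ → ∃[ z ] ι z ≋ p
  ι-finite {p@([ x ∶ y ]⟨ _ ⟩)} p≭∞ = x * y ⁻¹ , y , y≉0
    , trans (sym (z/y*y≈z x y≉0)) (*-comm _ _) , sym (*-identityʳ y)
    where
    y≉0 : y ≉ 0#
    y≉0 y≈0 = p≭∞ (∧≈0⇒≋ {p} {∞} (begin
      x * 0# - y * 1#   ≈⟨ +-congˡ (-‿cong (trans (*-identityʳ y) y≈0)) ⟩
      x * 0# - 0#       ≈⟨ solve 1 (λ x → x :* con ℤ.0ℤ :- con ℤ.0ℤ := con ℤ.0ℤ) refl x ⟩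
      0#                ∎))

  crossRatio-trans : ∀ {u v w p q} → u ≭ q → v ≭ p → v ≭ q → w ≭ p →
                     crossRatio u v p q * crossRatio v w p q ≈ crossRatio u w p q
  crossRatio-trans {u} {v} {w} {p} {q} u≭q v≭p v≭q w≭p = begin
    crossRatio u v p q * crossRatio v w p q
      ≈⟨ quotient-* D₁≉0 D₂≉0 ⟩
    ((u ∧ p) * (v ∧ q) * ((v ∧ p) * (w ∧ q))) * (((u ∧ q) * (v ∧ p)) * ((v ∧ q) * (w ∧ p))) ⁻¹
      ≈⟨ cross-multiply (*-nonzero D₁≉0 D₂≉0) (∧-nonzero {u} {w} {p} {q} u≭q w≭p)
           (solve 6 (λ up uq vp vq wp wq →
               (up :* vq :* (vp :* wq)) :* (uq :* wp) := (up :* wq) :* ((uq :* vp) :* (vq :* wp)))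
             refl (u ∧ p) (u ∧ q) (v ∧ p) (v ∧ q) (w ∧ p) (w ∧ q)) ⟩
    crossRatio u w p q ∎
    where
    D₁≉0 : (u ∧ q) * (v ∧ p) ≉ 0#
    D₁≉0 = ∧-nonzero {u} {v} {p} {q} u≭q v≭p
    D₂≉0 : (v ∧ q) * (w ∧ p) ≉ 0#
    D₂≉0 = ∧-nonzero {v} {w} {p} {q} v≭q w≭p

-- Unordered infinite products over a subset of a group.

module UnorderedProducts {ℓ} {ℝ : CompleteOrderedField ℓ} (𝕂 : CompleteNonArchimedeanField ℝ)
                         {g ℓ₁ ℓ₂} (G : Group g ℓ₁) (_≈?_ : Decidable (Group._≈_ G))
                         (Γ : Pred (Group.Carrier G) ℓ₂) where
  private
    module ℝ = OrderedFieldProperties ℝ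
    module G = Group G
  open CompleteNonArchimedeanField 𝕂
  open ValuationProperties 𝕂
  open IntegerCoefficients commutativeRing
  open Uniqueness G.setoid using (Unique)
  open Subset G.setoid using (_⊆_)

  ∏ : (G.Carrier → Carrier) → List G.Carrier → Carrier
  ∏ f T = foldr _*_ 1# (map f T)

  -- For `PGL₂` this unfolds to the notion that defines `Θ`; the group is a parameter because later
  -- modules treat it as abstract.
  HasProduct : (G.Carrier → Carrier) → Carrier → Set (ℓ ⊔ g ⊔ ℓ₁ ⊔ ℓ₂)
  HasProduct f w = ∀ ε → ℝ.0# ℝ.< ε →
    ∃[ S ] (All Γ S × (∀ T → All Γ T → Unique T → S ⊆ T → ∣ ∏ f T - w ∣ ℝ.< ε))

  ∏-cong : ∀ {f h T} → (∀ {γ} → γ ∈ Γ → f γ ≈ h γ) → All Γ T → ∏ f T ≈ ∏ h T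
  ∏-cong f≈h []         = refl
  ∏-cong f≈h (γ∈Γ ∷ ps) = *-cong (f≈h γ∈Γ) (∏-cong f≈h ps)

  ∏-* : ∀ f h T → ∏ (λ γ → f γ * h γ) T ≈ ∏ f T * ∏ h T
  ∏-* f h []      = sym (*-identityˡ 1#)
  ∏-* f h (γ ∷ T) = trans (*-congˡ (∏-* f h T))
    (solve 4 (λ a b c d → a :* b :* (c :* d) := a :* c :* (b :* d)) refl (f γ) (h γ) (∏ f T) (∏ h T))

  ∏-1 : ∀ {f T} → (∀ {γ} → γ ∈ Γ → f γ ≈ 1#) → All Γ T → ∏ f T ≈ 1#
  ∏-1 f≈1 []         = refl
  ∏-1 f≈1 (γ∈Γ ∷ ps) = trans (*-cong (f≈1 γ∈Γ) (∏-1 f≈1 ps)) (*-identityˡ 1#)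

  -- Every test set `S`, even one with repetitions, has an admissible `T` above it. Otherwise the
  -- limit condition could hold vacuously, and limits would not be unique.
  irredundant : ∀ {S} → All Γ S → ∃[ T ] (All Γ T × Unique T × S ⊆ T)
  irredundant {S} S⊆Γ = deduplicate _≈?_ S , All.deduplicate⁺ _≈?_ S⊆Γ
    , UniqueDec.deduplicate-! (record { isDecEquivalence = record { isEquivalence = G.isEquivalence ; _≟_ = _≈?_ } }) S
    , ∈.∈-deduplicate⁺ G.setoid _≈?_ (λ x≈y z≈y → G.trans z≈y (G.sym x≈y))

  HasProduct-cong : ∀ {f h u v} → (∀ {γ} → γ ∈ Γ → f γ ≈ h γ) → u ≈ v →
                    HasProduct f u → HasProduct h v
  HasProduct-cong f≈h u≈v P ε 0<ε with S , S⊆Γ , close ← P ε 0<ε =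
    S , S⊆Γ , λ T T⊆Γ uniq S⊆T → ℝ.<-respˡ-≈
      (∣∣-cong (+-cong (∏-cong f≈h T⊆Γ) (-‿cong u≈v))) (close T T⊆Γ uniq S⊆T)

  HasProduct-1 : ∀ {f} → (∀ {γ} → γ ∈ Γ → f γ ≈ 1#) → HasProduct f 1#
  HasProduct-1 f≈1 ε 0<ε = [] , [] , λ T T⊆Γ _ _ → ℝ.<-respˡ-≈
    (ℝ.sym (ℝ.trans (∣∣-cong (x≈y⇒x-y≈0 (∏-1 f≈1 T⊆Γ))) ∣0∣≈0)) 0<ε

  -- If `v` and `w` differed, the choice of `∣ v - w ∣` for ε would contradict a finite set on which
  -- the product is exactly `v`.
  HasProduct-cofinal : ∀ {f w v} → HasProduct f w →
    (∀ {S} → All Γ S → ∃[ T ] (All Γ T × Unique T × S ⊆ T × ∏ f T ≈ v)) → v ≈ w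
  HasProduct-cofinal {f} {w} {v} P cofinal with v ≟ w
  ... | yes v≈w = v≈w
  ... | no  v≉w
    with S , S⊆Γ , close ← P ∣ v - w ∣ (0<∣x∣ (λ e → v≉w (x-y≈0⇒x≈y e)))
    with T , T⊆Γ , uniq , S⊆T , ∏≈v ← cofinal S⊆Γ
    = contradiction (close T T⊆Γ uniq S⊆T) (ℝ.<-irrefl (∣∣-cong (+-congʳ ∏≈v)))

  -- By the ultrametric inequality the three terms in `expand` can be bounded separately: each has
  -- one factor less than δ and another of size at most `m`.
  HasProduct-* : ∀ {f h u v} → HasProduct f u → HasProduct h v →
                 HasProduct (λ γ → f γ * h γ) (u * v)
  HasProduct-* {f} {h} {u} {v} P Q ε 0<ε =
    let S  , S⊆Γ  , closeP = P δ 0<δ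
        S′ , S′⊆Γ , closeQ = Q δ 0<δ
    in S ++ S′ , All.++⁺ S⊆Γ S′⊆Γ , λ T T⊆Γ uniq S⊆T →
        let Δ₁ = closeP T T⊆Γ uniq (S⊆T ∘ ∈.∈-++⁺ˡ G.setoid)
            Δ₂ = closeQ T T⊆Γ uniq (S⊆T ∘ ∈.∈-++⁺ʳ G.setoid S)
        in ℝ.<-respˡ-≈ (∣∣-cong (trans (expand (∏ f T) (∏ h T)) (+-congʳ (sym (∏-* f h T)))))
             (∣x+y∣< (∣x+y∣< (bound (ℝ.≤-trans (ℝ.<⇒≤ Δ₁) (ℝ.≤-trans δ≤1 1≤m)) Δ₂) (bound u≤m Δ₂)) (bound v≤m Δ₁))
    where
    m = ℝ.max ℝ.1# (ℝ.max ∣ u ∣ ∣ v ∣)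
    1≤m : ℝ.1# ℝ.≤ m
    1≤m = ℝ.x≤max _ _
    u≤m : ∣ u ∣ ℝ.≤ m
    u≤m = ℝ.≤-trans (ℝ.x≤max _ _) (ℝ.y≤max _ _)
    v≤m : ∣ v ∣ ℝ.≤ m
    v≤m = ℝ.≤-trans (ℝ.y≤max _ _) (ℝ.y≤max _ _)
    0<m : ℝ.0# ℝ.< m
    0<m = ℝ.<-≤-trans ℝ.0<1 1≤m
    -- With δ = ε / (m μ), the bound μ ≥ 1 gives m δ ≤ ε, and μ ≥ ε together with m ≥ 1 gives δ ≤ 1.
    μ = ℝ.max m ε
    0<μ : ℝ.0# ℝ.< μ
    0<μ = ℝ.<-≤-trans 0<m (ℝ.x≤max _ _)
    -- δ ≤ min 1 (ε / m)
    δ = ε ℝ.* (m ℝ.* μ) ℝ.⁻¹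
    0<mμ : ℝ.0# ℝ.< m ℝ.* μ
    0<mμ = ℝ.*-pos 0<m 0<μ
    0<δ : ℝ.0# ℝ.< δ
    0<δ = ℝ.*-pos 0<ε (ℝ.⁻¹-pos 0<mμ)
    open ≤-Reasoning ℝ.poset
    δmμ≈ε : δ ℝ.* (m ℝ.* μ) ℝ.≈ ε
    δmμ≈ε = ℝ.z/y*y≈z ε (ℝ.>⇒≉ 0<mμ)
    1≤μ : ℝ.1# ℝ.≤ μ
    1≤μ = ℝ.≤-trans 1≤m (ℝ.x≤max _ _)
    δ≤1 : δ ℝ.≤ ℝ.1#
    δ≤1 = ℝ.*-cancelʳ-≤ 0<mμ (begin
      δ ℝ.* (m ℝ.* μ)     ≈⟨ δmμ≈ε ⟩
      ε                   ≤⟨ ℝ.y≤max _ _ ⟩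
      μ                   ≈⟨ ℝ.*-identityˡ μ ⟨
      ℝ.1# ℝ.* μ          ≤⟨ ℝ.*-monoʳ-≤ (ℝ.<⇒≤ 0<μ) 1≤m ⟩
      m ℝ.* μ             ≈⟨ ℝ.*-identityˡ _ ⟨
      ℝ.1# ℝ.* (m ℝ.* μ)  ∎)
    mδ≤ε : m ℝ.* δ ℝ.≤ ε
    mδ≤ε = begin
      m ℝ.* δ             ≈⟨ ℝ.*-identityʳ _ ⟨
      m ℝ.* δ ℝ.* ℝ.1#    ≤⟨ ℝ.*-monoˡ-≤ (ℝ.<⇒≤ (ℝ.*-pos 0<m 0<δ)) 1≤μ ⟩
      m ℝ.* δ ℝ.* μ       ≈⟨ ℝ.*-congʳ (ℝ.*-comm m δ) ⟩
      δ ℝ.* m ℝ.* μ       ≈⟨ ℝ.*-assoc _ _ _ ⟩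
      δ ℝ.* (m ℝ.* μ)     ≈⟨ δmμ≈ε ⟩
      ε                   ∎
    bound : ∀ {s t} → ∣ s ∣ ℝ.≤ m → ∣ t ∣ ℝ.< δ → ∣ s * t ∣ ℝ.< ε
    bound {s} {t} s≤m t<δ = begin-strict
      ∣ s * t ∣          ≈⟨ ∣∣-* s t ⟩
      ∣ s ∣ ℝ.* ∣ t ∣    ≤⟨ ℝ.*-monoʳ-≤ (∣∣-nonneg t) s≤m ⟩
      m ℝ.* ∣ t ∣        <⟨ ℝ.*-monoˡ-< 0<m t<δ ⟩
      m ℝ.* δ            ≤⟨ mδ≤ε ⟩
      ε                  ∎
    expand : ∀ x y → (x - u) * (y - v) + u * (y - v) + v * (x - u) ≈ x * y - u * v
    expand x y = solve 4 (λ x y u v →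
      (x :- u) :* (y :- v) :+ u :* (y :- v) :+ v :* (x :- u) := x :* y :- u :* v) refl x y u v

  HasProduct-unique : ∀ {f h u v} → (∀ {γ} → γ ∈ Γ → f γ ≈ h γ) →
                      HasProduct f u → HasProduct h v → u ≈ v
  HasProduct-unique {f} {h} {u} {v} f≈h P Q with u ≟ v
  ... | yes u≈v = u≈v
  ... | no  u≉v
    with 0<d ← 0<∣x∣ (λ e → u≉v (x-y≈0⇒x≈y e))
    with S , S⊆Γ , closeP ← P _ 0<d | S′ , S′⊆Γ , closeQ ← Q _ 0<d
    with T , T⊆Γ , uniq , SS′⊆T ← irredundant (All.++⁺ S⊆Γ S′⊆Γ)
    = contradiction
      (ℝ.<-respˡ-≈ (∣∣-cong (trans (+-cong (+-congʳ (sym (∏-cong f≈h T⊆Γ))) refl)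
          (solve 3 (λ x u v → (x :- v) :- (x :- u) := u :- v) refl (∏ f T) u v)))
        (∣x-y∣< (closeQ T T⊆Γ uniq (SS′⊆T ∘ ∈.∈-++⁺ʳ G.setoid S))
                (closeP T T⊆Γ uniq (SS′⊆T ∘ ∈.∈-++⁺ˡ G.setoid))))
      (ℝ.<-irrefl ℝ.refl)

  -- If `S` is a test set for `f`, then `map ψ S` is one for `f ∘ φ`: the injection φ sends an
  -- irredundant list containing `map ψ S` to an irredundant list containing `S`.
  HasProduct-reindex : ∀ {f w} (φ ψ : G.Carrier → G.Carrier) →
    (∀ {γ} → γ ∈ Γ → φ γ ∈ Γ) → (∀ {γ} → γ ∈ Γ → ψ γ ∈ Γ) →
    (∀ {γ δ} → γ G.≈ δ → φ γ G.≈ φ δ) →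
    (∀ {γ δ} → φ γ G.≈ φ δ → γ G.≈ δ) → (∀ γ → φ (ψ γ) G.≈ γ) →
    (∀ {γ δ} → γ G.≈ δ → ψ γ G.≈ ψ δ) →
    HasProduct f w → HasProduct (f ∘ φ) w
  HasProduct-reindex {f} {w} φ ψ φ∈ ψ∈ φ-cong φ-inj φψ ψ-cong P ε 0<ε
    with S , S⊆Γ , close ← P ε 0<ε
    = map ψ S , All.map⁺ (All.map ψ∈ S⊆Γ) , λ T T⊆Γ uniq ψS⊆T →
        ≡.subst (λ X → ∣ foldr _*_ 1# X - w ∣ ℝ.< ε) (≡.sym (List.map-∘ T))
          (close (map φ T) (All.map⁺ (All.map φ∈ T⊆Γ)) (Unique.map⁺ G.setoid G.setoid φ-inj uniq)
            (λ {γ} γ∈S → ∈.∈-resp-≈ G.setoid (φψ γ)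
              (∈.∈-map⁺ G.setoid G.setoid φ-cong
                (ψS⊆T (∈.∈-map⁺ G.setoid G.setoid ψ-cong γ∈S)))))

-- Torsion-free subgroups, and identities for group actions.

module SubgroupProperties {g ℓ₁ ℓ₂} (G : Group g ℓ₁) {Γ : Pred (Group.Carrier G) ℓ₂}
                          (isSubgroup : GroupTheory.IsSubgroup G Γ) where
  open Group G
  open GroupTheory G
  open IsSubgroup isSubgroup
  open GroupProperties G
  open import Algebra.Properties.Monoid.Mult monoid using () renaming (×-homo-+ to ^-homo-+)

  ^∈ : ∀ {x} n → x ∈ Γ → x ^ n ∈ Γ
  ^∈ zero    x∈Γ = ε∈
  ^∈ (suc n) x∈Γ = ∙∈ x∈Γ (^∈ n x∈Γ)

  x∙y⁻¹∈ : ∀ {x y} → x ∈ Γ → y ∈ Γ → x ∙ y ⁻¹ ∈ Γ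
  x∙y⁻¹∈ x∈Γ y∈Γ = ∙∈ x∈Γ (⁻¹∈ y∈Γ)

  module _ (torsionFree : IsTorsionFree Γ) where

    x∙x≈ε⇒x≈ε : ∀ {x} → x ∈ Γ → x ∙ x ≈ ε → x ≈ ε
    x∙x≈ε⇒x≈ε x∈Γ eq = torsionFree _ 1 x∈Γ (trans (∙-congˡ (identityʳ _)) eq)

    ^-injective-< : ∀ {x m n} → x ∈ Γ → x ≉ ε → m ℕ.< n → ¬ (x ^ m ≈ x ^ n)
    ^-injective-< {x} {m} x∈Γ x≉ε m<n eq with k , ≡.refl ← ℕ.m≤n⇒∃[o]m+o≡n m<n =
      x≉ε (torsionFree x k x∈Γ (identityʳ-unique (x ^ m) (x ^ suc k)
        (trans (sym (^-homo-+ x m (suc k)))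
          (trans (reflexive (≡.cong (x ^_) (ℕ.+-suc m k))) (sym eq)))))

    ^-injective : ∀ {x m n} → x ∈ Γ → x ≉ ε → m ≢ n → ¬ (x ^ m ≈ x ^ n)
    ^-injective {x} {m} {n} x∈Γ x≉ε m≢n eq with ℕ.<-cmp m n
    ... | tri< m<n _ _ = ^-injective-< x∈Γ x≉ε m<n eq
    ... | tri≈ _ m≡n _ = m≢n m≡n
    ... | tri> _ _ n<m = ^-injective-< x∈Γ x≉ε n<m (sym eq)

module ActionProperties {g ℓ₁ x ℓ₂} {G : Group g ℓ₁} {X : Setoid x ℓ₂} (A : RightAction G X) where
  private
    module G = Group G
  open Setoid X
  open RightAction A
  open GroupTheory G
  open GroupProperties G using (\\-leftDividesˡ; \\-leftDividesʳ)
  open ≈-Reasoning X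

  ◂-congˡ : ∀ {p q M} → p ≈ q → p ◂ M ≈ q ◂ M
  ◂-congˡ p≈q = ◂-cong p≈q G.refl

  ◂-congʳ : ∀ {p M N} → M G.≈ N → p ◂ M ≈ p ◂ N
  ◂-congʳ = ◂-cong refl

  ◂-⁻¹ : ∀ {p q M} → p ◂ M ≈ q → q ◂ M G.⁻¹ ≈ p
  ◂-⁻¹ {p} {q} {M} eq = begin
    q ◂ M G.⁻¹         ≈⟨ ◂-congˡ eq ⟨
    p ◂ M ◂ M G.⁻¹     ≈⟨ ◂-∙ p M _ ⟨
    p ◂ (M G.∙ M G.⁻¹) ≈⟨ ◂-congʳ (G.inverseʳ M) ⟩
    p ◂ G.ε            ≈⟨ ◂-ε p ⟩
    p                  ∎

  ◂-^ : ∀ {p M} → p ◂ M ≈ p → ∀ n → p ◂ (M ^ n) ≈ p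
  ◂-^ {p} {M} eq zero    = ◂-ε p
  ◂-^ {p} {M} eq (suc n) = begin
    p ◂ (M G.∙ M ^ n)  ≈⟨ ◂-∙ p M _ ⟩
    p ◂ M ◂ M ^ n      ≈⟨ ◂-congˡ eq ⟩
    p ◂ M ^ n          ≈⟨ ◂-^ eq n ⟩
    p                  ∎

  ◂-∙⁻¹ : ∀ {p q M N} → p ◂ M ≈ q → p ◂ N ≈ q → p ◂ (M G.∙ N G.⁻¹) ≈ p
  ◂-∙⁻¹ {p} {q} {M} {N} pM≈q pN≈q = begin
    p ◂ (M G.∙ N G.⁻¹)  ≈⟨ ◂-∙ p M _ ⟩
    p ◂ M ◂ N G.⁻¹      ≈⟨ ◂-congˡ pM≈q ⟩
    q ◂ N G.⁻¹          ≈⟨ ◂-⁻¹ pN≈q ⟩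
    p                   ∎

  ◂-conjugate : ∀ p g τ → p ◂ g ◂ τ G.⁻¹ ≈ p ◂ τ G.⁻¹ ◂ (τ G.∙ g G.∙ τ G.⁻¹)
  ◂-conjugate p g τ = begin
    p ◂ g ◂ τ G.⁻¹                               ≈⟨ ◂-∙ p g _ ⟨
    p ◂ (g G.∙ τ G.⁻¹)                           ≈⟨ ◂-congʳ (\\-leftDividesʳ τ _) ⟨
    p ◂ (τ G.⁻¹ G.∙ (τ G.∙ (g G.∙ τ G.⁻¹)))      ≈⟨ ◂-congʳ (G.∙-congˡ (G.assoc τ g _)) ⟨
    p ◂ (τ G.⁻¹ G.∙ (τ G.∙ g G.∙ τ G.⁻¹))        ≈⟨ ◂-∙ p _ _ ⟩
    p ◂ τ G.⁻¹ ◂ (τ G.∙ g G.∙ τ G.⁻¹)            ∎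

  ◂-∙-⁻¹ˡ : ∀ p M N → p ◂ M ◂ (M G.⁻¹ G.∙ N) ≈ p ◂ N
  ◂-∙-⁻¹ˡ p M N = begin
    p ◂ M ◂ (M G.⁻¹ G.∙ N)    ≈⟨ ◂-∙ p M _ ⟨
    p ◂ (M G.∙ (M G.⁻¹ G.∙ N)) ≈⟨ ◂-congʳ (\\-leftDividesˡ M N) ⟩
    p ◂ N                     ∎

-- The chordal metric under projective transformations.

module ChordalProperties {ℓ} {ℝ : CompleteOrderedField ℓ} (𝕂 : CompleteNonArchimedeanField ℝ) where
  private
    module ℝ = OrderedFieldProperties ℝ
  open CompleteNonArchimedeanField 𝕂
  open ValuationProperties 𝕂
  open IntegerCoefficients commutativeRing
  open ProjectiveProperties field′ hiding (_∧_)
  open Schottky 𝕂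
  open ≤-Reasoning ℝ.poset

  ‖‖-pos : ∀ p → ℝ.0# ℝ.< ‖ p ‖
  ‖‖-pos [ x ∶ y ]⟨ nz ⟩ with x ≟ 0# | y ≟ 0#
  ... | no x≉0  | _       = ℝ.<-≤-trans (0<∣x∣ x≉0) (ℝ.x≤max _ _)
  ... | yes _   | no y≉0  = ℝ.<-≤-trans (0<∣x∣ y≉0) (ℝ.y≤max _ _)
  ... | yes x≈0 | yes y≈0 = contradiction (x≈0 , y≈0) nz

  ≋⇒Close : ∀ {ε} p q → ℝ.0# ℝ.< ε → p ≋ q → Close ε p q
  ≋⇒Close {ε} p q 0<ε p≋q = begin-strict
    ∣ p ∧ q ∣                ≈⟨ ∣∣-cong (≋⇒∧≈0 {p} {q} p≋q) ⟩
    ∣ 0# ∣                   ≈⟨ ∣0∣≈0 ⟩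
    ℝ.0#                     <⟨ ℝ.*-pos 0<ε (ℝ.*-pos (‖‖-pos p) (‖‖-pos q)) ⟩
    ε ℝ.* (‖ p ‖ ℝ.* ‖ q ‖)  ∎

  -- Cramer's rule: `det M` times a coordinate of `p` is a combination of the coordinates of `p ◂ M`
  -- whose coefficients are, up to sign, entries of `M`. The 1 in the maximum `L` makes it positive.
  matrixBound : ∀ M → ∃[ L ] (ℝ.0# ℝ.< L × (∀ p → ∣ det M ∣ ℝ.* ‖ p ‖ ℝ.≤ L ℝ.* ‖ p ◂ M ‖))
  matrixBound M@(mat a b c d _) = L , 0<L , λ { p@([ x ∶ y ]⟨ _ ⟩) →
    ℝ.*-max-lub
      (bound (p ◂ M) d c d≤L c≤L x (solve 6 (λ x y a b c d →
        (a :* d :- b :* c) :* x := (x :* a :+ y :* c) :* d :- (x :* b :+ y :* d) :* c) refl x y a b c d))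
      (bound (p ◂ M) (- b) (- a) (neg b≤L) (neg a≤L) y (solve 6 (λ x y a b c d →
        (a :* d :- b :* c) :* y := (x :* a :+ y :* c) :* (:- b) :- (x :* b :+ y :* d) :* (:- a)) refl x y a b c d)) }
    where
    L = ℝ.max ℝ.1# (ℝ.max (ℝ.max ∣ a ∣ ∣ b ∣) (ℝ.max ∣ c ∣ ∣ d ∣))
    0<L : ℝ.0# ℝ.< L
    0<L = ℝ.<-≤-trans ℝ.0<1 (ℝ.x≤max _ _)
    a≤L : ∣ a ∣ ℝ.≤ L
    a≤L = ℝ.≤-trans (ℝ.x≤max _ _) (ℝ.≤-trans (ℝ.x≤max _ _) (ℝ.y≤max _ _))
    b≤L : ∣ b ∣ ℝ.≤ L
    b≤L = ℝ.≤-trans (ℝ.y≤max _ _) (ℝ.≤-trans (ℝ.x≤max _ _) (ℝ.y≤max _ _))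
    c≤L : ∣ c ∣ ℝ.≤ L
    c≤L = ℝ.≤-trans (ℝ.x≤max _ _) (ℝ.≤-trans (ℝ.y≤max _ _) (ℝ.y≤max _ _))
    d≤L : ∣ d ∣ ℝ.≤ L
    d≤L = ℝ.≤-trans (ℝ.y≤max _ _) (ℝ.≤-trans (ℝ.y≤max _ _) (ℝ.y≤max _ _))
    neg : ∀ {s} → ∣ s ∣ ℝ.≤ L → ∣ - s ∣ ℝ.≤ L
    neg = ℝ.≤-respˡ-≈ (ℝ.sym (∣-x∣≈∣x∣ _))
    term : ∀ {s t r} → ∣ s ∣ ℝ.≤ r → ∣ t ∣ ℝ.≤ L → ∣ s * t ∣ ℝ.≤ L ℝ.* r
    term {s} {t} {r} s≤r t≤L = begin
      ∣ s * t ∣        ≈⟨ ∣∣-* s t ⟩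
      ∣ s ∣ ℝ.* ∣ t ∣  ≤⟨ ℝ.*-mono-≤ (ℝ.≤-trans (∣∣-nonneg s) s≤r) (∣∣-nonneg t) s≤r t≤L ⟩
      r ℝ.* L          ≈⟨ ℝ.*-comm r L ⟩
      L ℝ.* r          ∎
    bound : ∀ q s t → ∣ s ∣ ℝ.≤ L → ∣ t ∣ ℝ.≤ L → ∀ x →
            (a * d - b * c) * x ≈ P¹.x q * s - P¹.y q * t →
            ∣ a * d - b * c ∣ ℝ.* ∣ x ∣ ℝ.≤ L ℝ.* ‖ q ‖
    bound q s t s≤L t≤L x eq = begin
      ∣ a * d - b * c ∣ ℝ.* ∣ x ∣    ≈⟨ ∣∣-* _ _ ⟨
      ∣ (a * d - b * c) * x ∣        ≈⟨ ∣∣-cong eq ⟩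
      ∣ P¹.x q * s - P¹.y q * t ∣    ≤⟨ ∣x-y∣≤ (term (ℝ.x≤max _ _) s≤L) (term (ℝ.y≤max _ _) t≤L) ⟩
      L ℝ.* ‖ q ‖                    ∎

  ‖‖-scale : ∀ p q ((k , _) : p ≋ q) → ∣ k ∣ ℝ.* ‖ p ‖ ℝ.≤ ‖ q ‖
  ‖‖-scale p q (k , _ , x , y) = ℝ.*-max-lub
    (ℝ.≤-respˡ-≈ (ℝ.trans (∣∣-cong x) (∣∣-* _ _)) (ℝ.x≤max _ _))
    (ℝ.≤-respˡ-≈ (ℝ.trans (∣∣-cong y) (∣∣-* _ _)) (ℝ.y≤max _ _))

  -- Transformations are Lipschitz: `p ∧ q` is multiplied by `det M`, and by `matrixBound` each of
  -- the two norms shrinks at most by the factor ∣det M∣ / L. Hence K = L² / ∣det M∣.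
  Close-◂ : ∀ M → ∃[ K ] (ℝ.0# ℝ.< K × (∀ {ε} p q p′ q′ → p ◂ M ≋ p′ → q ◂ M ≋ q′ →
            ℝ.0# ℝ.< ε → Close ε p q → Close (K ℝ.* ε) p′ q′))
  Close-◂ M with L , 0<L , bound ← matrixBound M =
    K , ℝ.*-pos (ℝ.*-pos 0<L 0<L) (ℝ.⁻¹-pos 0<D) , close
    where
    D = ∣ det M ∣
    0<D : ℝ.0# ℝ.< D
    0<D = 0<∣x∣ (det≉0 M)
    K = L ℝ.* L ℝ.* D ℝ.⁻¹
    close : ∀ {ε} p q p′ q′ → p ◂ M ≋ p′ → q ◂ M ≋ q′ →
            ℝ.0# ℝ.< ε → Close ε p q → Close (K ℝ.* ε) p′ q′
    close {ε} p q p′ q′ P@(k , k≉0 , _) Q@(l , l≉0 , _) 0<ε p~q = ℝ.*-cancelˡ-< (ℝ.<⇒≤ 0<D) (begin-strict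
      D ℝ.* ∣ p′ ∧ q′ ∣
        ≈⟨ ℝ.*-congˡ (∣∣-cong (trans (∧-scale {p ◂ M} {q ◂ M} {p′} {q′} P Q) (*-congˡ (∧-◂ M p q)))) ⟩
      D ℝ.* ∣ k * l * (det M * (p ∧ q)) ∣
        ≈⟨ ℝ.*-congˡ (ℝ.trans (∣∣-* _ _) (ℝ.*-cong (∣∣-* _ _) (∣∣-* _ _))) ⟩
      D ℝ.* (∣ k ∣ ℝ.* ∣ l ∣ ℝ.* (D ℝ.* ∣ p ∧ q ∣))
        ≈⟨ ℝ.solve 4 (λ D k l w → D ℝ.:* (k ℝ.:* l ℝ.:* (D ℝ.:* w)) ℝ.:= (D ℝ.:* D ℝ.:* (k ℝ.:* l)) ℝ.:* w) ℝ.refl D (∣ k ∣) (∣ l ∣) (∣ p ∧ q ∣) ⟩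
      (D ℝ.* D ℝ.* (∣ k ∣ ℝ.* ∣ l ∣)) ℝ.* ∣ p ∧ q ∣
        <⟨ ℝ.*-monoˡ-< (ℝ.*-pos (ℝ.*-pos 0<D 0<D) (ℝ.*-pos (0<∣x∣ k≉0) (0<∣x∣ l≉0))) p~q ⟩
      (D ℝ.* D ℝ.* (∣ k ∣ ℝ.* ∣ l ∣)) ℝ.* (ε ℝ.* (‖ p ‖ ℝ.* ‖ q ‖))
        ≈⟨ ℝ.solve 6 (λ D k l ε p q → (D ℝ.:* D ℝ.:* (k ℝ.:* l)) ℝ.:* (ε ℝ.:* (p ℝ.:* q))
             ℝ.:= ε ℝ.:* ((k ℝ.:* (D ℝ.:* p)) ℝ.:* (l ℝ.:* (D ℝ.:* q)))) ℝ.refl D (∣ k ∣) (∣ l ∣) ε (‖ p ‖) (‖ q ‖) ⟩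
      ε ℝ.* ((∣ k ∣ ℝ.* (D ℝ.* ‖ p ‖)) ℝ.* (∣ l ∣ ℝ.* (D ℝ.* ‖ q ‖)))
        ≤⟨ ℝ.*-monoˡ-≤ (ℝ.<⇒≤ 0<ε) (ℝ.*-mono-≤ (L‖‖-nonneg p′) 0≤lDq
             (transport p p′ P) (transport q q′ Q)) ⟩
      ε ℝ.* ((L ℝ.* ‖ p′ ‖) ℝ.* (L ℝ.* ‖ q′ ‖))
        ≈⟨ ℝ.*-identityˡ _ ⟨
      ℝ.1# ℝ.* (ε ℝ.* ((L ℝ.* ‖ p′ ‖) ℝ.* (L ℝ.* ‖ q′ ‖)))
        ≈⟨ ℝ.*-congʳ (ℝ.inverse (ℝ.>⇒≉ 0<D)) ⟨
      D ℝ.* D ℝ.⁻¹ ℝ.* (ε ℝ.* ((L ℝ.* ‖ p′ ‖) ℝ.* (L ℝ.* ‖ q′ ‖)))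
        ≈⟨ ℝ.solve 6 (λ D i L ε p q → D ℝ.:* i ℝ.:* (ε ℝ.:* ((L ℝ.:* p) ℝ.:* (L ℝ.:* q)))
             ℝ.:= D ℝ.:* (((L ℝ.:* L ℝ.:* i) ℝ.:* ε) ℝ.:* (p ℝ.:* q))) ℝ.refl D (D ℝ.⁻¹) L ε (‖ p′ ‖) (‖ q′ ‖) ⟩
      D ℝ.* (K ℝ.* ε ℝ.* (‖ p′ ‖ ℝ.* ‖ q′ ‖)) ∎)
      where
      L‖‖-nonneg : ∀ r → ℝ.0# ℝ.≤ L ℝ.* ‖ r ‖
      L‖‖-nonneg r = ℝ.<⇒≤ (ℝ.*-pos 0<L (‖‖-pos r))
      0≤lDq : ℝ.0# ℝ.≤ ∣ l ∣ ℝ.* (D ℝ.* ‖ q ‖)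
      0≤lDq = ℝ.<⇒≤ (ℝ.*-pos (0<∣x∣ l≉0) (ℝ.*-pos 0<D (‖‖-pos q)))
      transport : ∀ r r′ (R@(m , _) : r ◂ M ≋ r′) → ∣ m ∣ ℝ.* (D ℝ.* ‖ r ‖) ℝ.≤ L ℝ.* ‖ r′ ‖
      transport r r′ R@(m , _) = begin
        ∣ m ∣ ℝ.* (D ℝ.* ‖ r ‖)      ≤⟨ ℝ.*-monoˡ-≤ (∣∣-nonneg m) (bound r) ⟩
        ∣ m ∣ ℝ.* (L ℝ.* ‖ r ◂ M ‖)  ≈⟨ ℝ.solve 3 (λ m L r → m ℝ.:* (L ℝ.:* r) ℝ.:= L ℝ.:* (m ℝ.:* r)) ℝ.refl (∣ m ∣) L (‖ r ◂ M ‖) ⟩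
        L ℝ.* (∣ m ∣ ℝ.* ‖ r ◂ M ‖)  ≤⟨ ℝ.*-monoˡ-≤ (ℝ.<⇒≤ 0<L) (‖‖-scale (r ◂ M) r′ R) ⟩
        L ℝ.* ‖ r′ ‖                 ∎

  ConvergesTo-◂ : ∀ {u v : ℕ → P¹} {p q} M → (∀ n → u n ◂ M ≋ v n) → p ◂ M ≋ q →
                  ConvergesTo u p → ConvergesTo v q
  ConvergesTo-◂ {u} {v} {p} {q} M uM≋v pM≋q conv ε 0<ε =
    let K , 0<K , close = Close-◂ M
        N , near = conv (K ℝ.⁻¹ ℝ.* ε) (ℝ.*-pos (ℝ.⁻¹-pos 0<K) 0<ε)
    in N , λ n N≤n → ℝ.<-respʳ-≈
         (ℝ.*-congʳ (ℝ.trans (ℝ.sym (ℝ.*-assoc K _ ε)) (ℝ.trans (ℝ.*-congʳ (ℝ.inverse (ℝ.>⇒≉ 0<K))) (ℝ.*-identityˡ ε))))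
         (close (u n) p (v n) q (uM≋v n) pM≋q (ℝ.*-pos (ℝ.⁻¹-pos 0<K) 0<ε) (near n N≤n))

-- Real sequences that increase by at least 1.

module RealSequences {ℓ} (em : ExcludedMiddle ℓ) (ℝ : CompleteOrderedField ℓ) where
  open OrderedFieldProperties ℝ
  open ≤-Reasoning poset

  unbounded : (P : Pred Carrier ℓ) → ∃ P → ¬ (∃ (_IsUpperBoundOf P)) → ∀ r → ∃[ s ] (s ∈ P × r < s)
  unbounded P _ ¬bounded r = decidable-stable em λ ¬∃ →
    ¬bounded (r , λ s s∈P → ≮⇒≥ λ r<s → ¬∃ (s , s∈P , r<s))

  module _ (s : ℕ → Carrier) (s+1≤s : ∀ n → s n + 1# ≤ s (suc n)) where

    s-mono-≤ : ∀ {m n} → m ℕ.≤ n → s m ≤ s n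
    s-mono-≤ {m} {n} m≤n with ℕ.m≤n⇒m<n∨m≡n m≤n
    ... | inj₂ ≡.refl = ≤-refl
    s-mono-≤ {m} {suc n} _ | inj₁ m<1+n = begin
      s m       ≤⟨ s-mono-≤ (ℕ.≤-pred m<1+n) ⟩
      s n       ≤⟨ <⇒≤ (x<x+1 (s n)) ⟩
      s n + 1#  ≤⟨ s+1≤s n ⟩
      s (suc n) ∎

    -- The Archimedean argument: if `t` were the supremum, some `s n` would exceed `t - 1#`, and
    -- then `s (suc n)` would exceed `t`.
    s-divergent : ∀ r → ∃[ N ] ∀ n → N ℕ.≤ n → r < s n
    s-divergent r =
      let x , (N , x≈s) , r<x = unbounded (λ x → ∃[ n ] x ≈ s n) (s 0 , 0 , refl) ¬bounded r
      in N , λ n N≤n → <-≤-trans (<-respʳ-≈ x≈s r<x) (s-mono-≤ N≤n)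
      where
      ¬bounded : ¬ ∃ (_IsUpperBoundOf (λ x → ∃[ n ] x ≈ s n))
      ¬bounded bounded with supremum _ (s 0 , 0 , refl) bounded
      ... | t , isUpper , isLeast with em {P = ∃[ n ] t - 1# < s n}
      ...   | yes (n , t-1<s) = <-irrefl refl (begin-strict
        t            ≈⟨ solve 2 (λ t e → t := (t :- e) :+ e) refl t 1# ⟩
        t - 1# + 1#  <⟨ +-monoˡ-≤ 1# (<⇒≤ t-1<s) , (λ e → proj₂ t-1<s (trans
                          (solve 2 (λ t e → t := (t :+ e) :- e) refl (t - 1#) 1#)
                          (trans (+-congʳ e) (solve 2 (λ t e → (t :+ e) :- e := t) refl (s n) 1#)))) ⟩
        s n + 1#     ≤⟨ s+1≤s n ⟩
        s (suc n)    ≤⟨ isUpper _ (suc n , refl) ⟩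
        t            ∎)
      ...   | no ¬∃ = <⇒≱ (x-1<x t) (isLeast (t - 1#) λ { x (n , x≈s) →
        ≤-respˡ-≈ (sym x≈s) (≮⇒≥ λ t-1<s → ¬∃ (n , t-1<s)) })

-- Ordinary points, and unboundedness of the absolute value.

module OrdinaryPoints {ℓ} (em : ExcludedMiddle ℓ)
    {ℝ : CompleteOrderedField ℓ} (𝕂 : CompleteNonArchimedeanField ℝ)
    (Γ : Pred (Schottky.GL₂ 𝕂) ℓ)
    (isSubgroup : Schottky.IsSubgroup 𝕂 Γ) (torsionFree : Schottky.IsTorsionFree 𝕂 Γ) where

  open Schottky 𝕂
  private
    module ℝ = OrderedFieldProperties ℝ
    module PGL = Group PGL₂
  open CompleteNonArchimedeanField 𝕂 hiding (_^_)
  open ValuationProperties 𝕂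
  open ProjectiveProperties field′ hiding (_∧_)
  open ChordalProperties 𝕂
  open ActionProperties ◂-action
  open GroupTheory PGL₂ using (_^_)
  open SubgroupProperties PGL₂ isSubgroup
  open IsSubgroup isSubgroup
  private
    module PGLₚ = GroupProperties PGL₂
  open ≤-Reasoning ℝ.poset

  -- Otherwise the constant sequence `u ◂ γ ^ n` would exhibit `u` as a limit point, since the
  -- powers of γ are distinct in a torsion-free group.
  stabiliser-trivial : ∀ {u γ} → u ∈ Ω Γ → γ ∈ Γ → u ◂ γ ≋ u → γ ~ PGL.ε
  stabiliser-trivial {u} {γ} u∈Ω γ∈Γ uγ≋u = decidable-stable em λ γ≁ε → u∈Ω
    ( u , (λ n → γ ^ n) , (λ n → ^∈ {γ} n γ∈Γ)
    , (λ m n → ^-injective torsionFree {γ} {m} {n} γ∈Γ γ≁ε)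
    , λ ε 0<ε → 0 , λ n _ → ≋⇒Close (u ◂ γ ^ n) u 0<ε (◂-^ {u} {γ} uγ≋u n) )

  orbit-injective : ∀ {u v α β} → u ∈ Ω Γ → α ∈ Γ → β ∈ Γ → u ◂ α ≋ v → u ◂ β ≋ v → α ~ β
  orbit-injective {u} {v} {α} {β} u∈Ω α∈Γ β∈Γ uα≋v uβ≋v = PGLₚ.x∙y⁻¹≈ε⇒x≈y α β
    (stabiliser-trivial {u} {α · β PGL.⁻¹} u∈Ω (x∙y⁻¹∈ {α} {β} α∈Γ β∈Γ) (◂-∙⁻¹ {u} {v} {α} {β} uα≋v uβ≋v))

  -- If `q ◂ γ n` tends to `v`, then the conjugates τ γₙ τ⁻¹ move `q ◂ τ PGL.⁻¹` towards `u`.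
  Ω-◂ : ∀ {u v} τ → (∀ {γ} → γ ∈ Γ → τ · γ · τ PGL.⁻¹ ∈ Γ) → u ◂ τ ≋ v → u ∈ Ω Γ → v ∈ Ω Γ
  Ω-◂ {u} {v} τ conj uτ≋v u∈Ω (q , γ , γ∈Γ , distinct , conv) = u∈Ω
    ( q ◂ τ PGL.⁻¹ , (λ n → τ · γ n · τ PGL.⁻¹) , (λ n → conj (γ∈Γ n))
    , (λ m n m≢n eq → distinct m n m≢n
        (PGLₚ.∙-cancelˡ τ (γ m) (γ n) (PGLₚ.∙-cancelʳ (τ PGL.⁻¹) (τ · γ m) (τ · γ n) eq)))
    , ConvergesTo-◂ {λ n → q ◂ γ n} {λ n → q ◂ τ PGL.⁻¹ ◂ (τ · γ n · τ PGL.⁻¹)} {v} {u} (τ PGL.⁻¹)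
        (λ n → ◂-conjugate q (γ n) τ) (◂-⁻¹ {u} {v} {τ} uτ≋v) conv )

  -- If all absolute values were at most 1, points at chordal distance less than 1 would coincide; a
  -- convergent subsequence of `u ◂ δ n`, which compactness supplies, would then repeat a point and
  -- hence an element of Γ. So some `∣ y ∣` exceeds 1, and multiplication by `y` rules out a
  -- supremum.
  values-unbounded : (δ : ℕ → GL₂) → (∀ n → δ n ∈ Γ) → (∀ m n → m ≢ n → ¬ δ m ~ δ n) →
                     ∀ {u} → u ∈ Ω Γ → IsCompact (Closure (Orbit Γ u)) → ∀ r → ∃[ x ] r ℝ.< ∣ x ∣
  values-unbounded δ δ∈Γ distinct {u} u∈Ω compact r = decidable-stable em λ ¬∃ → ¬bounded (r , λ x → ℝ.≮⇒≥ λ r<x → ¬∃ (x , r<x))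
    where
    module _ (trivial : ∀ x → ∣ x ∣ ℝ.≤ ℝ.1#) where
      ∣x∣<1⇒x≈0 : ∀ x → ∣ x ∣ ℝ.< ℝ.1# → x ≈ 0#
      ∣x∣<1⇒x≈0 x x<1 with x ≟ 0#
      ... | yes x≈0 = x≈0
      ... | no  x≉0 = contradiction (begin-strict
        ℝ.1#                  ≈⟨ ∣1∣≈1 ⟨
        ∣ 1# ∣                ≈⟨ ∣∣-cong (inverse x≉0) ⟨
        ∣ x * x ⁻¹ ∣          ≈⟨ ∣∣-* _ _ ⟩
        ∣ x ∣ ℝ.* ∣ x ⁻¹ ∣    ≤⟨ ℝ.*-monoˡ-≤ (∣∣-nonneg x) (trivial (x ⁻¹)) ⟩
        ∣ x ∣ ℝ.* ℝ.1#        ≈⟨ ℝ.*-identityʳ _ ⟩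
        ∣ x ∣                 <⟨ x<1 ⟩
        ℝ.1#                  ∎) (ℝ.<-irrefl ℝ.refl)
      ‖‖≤1 : ∀ p → ‖ p ‖ ℝ.≤ ℝ.1#
      ‖‖≤1 p = ℝ.max-lub (trivial _) (trivial _)
      Close⇒≋ : ∀ p q → Close ℝ.1# p q → p ≋ q
      Close⇒≋ p q p~q = ∧≈0⇒≋ {p} {q} (∣x∣<1⇒x≈0 _ (begin-strict
        ∣ p ∧ q ∣                    <⟨ p~q ⟩
        ℝ.1# ℝ.* (‖ p ‖ ℝ.* ‖ q ‖)   ≈⟨ ℝ.*-identityˡ _ ⟩
        ‖ p ‖ ℝ.* ‖ q ‖              ≤⟨ ℝ.*-mono-≤ (ℝ.<⇒≤ ℝ.0<1) (ℝ.<⇒≤ (‖‖-pos q)) (‖‖≤1 p) (‖‖≤1 q) ⟩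
        ℝ.1# ℝ.* ℝ.1#                ≈⟨ ℝ.*-identityˡ _ ⟩
        ℝ.1#                         ∎))
      -- A convergent subsequence of the orbit would be eventually constant.
      ¬convergent : ∀ {p} (φ : ℕ → ℕ) → (∀ n → φ n ℕ.< φ (suc n)) → ¬ ConvergesTo (λ n → u ◂ δ (φ n)) p
      ¬convergent {p} φ incr conv = collide (conv ℝ.1# ℝ.0<1)
        where
        collide : ¬ (∃[ N ] ∀ n → N ℕ.≤ n → Close ℝ.1# (u ◂ δ (φ n)) p)
        collide (N , near) = distinct (φ N) (φ (suc N)) (ℕ.<⇒≢ (incr N))
          (orbit-injective {u} {p} {δ (φ N)} {δ (φ (suc N))} u∈Ω (δ∈Γ _) (δ∈Γ _)
            (Close⇒≋ (u ◂ δ (φ N)) p (near N ℕ.≤-refl))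
            (Close⇒≋ (u ◂ δ (φ (suc N))) p (near (suc N) (ℕ.n≤1+n N))))

      ¬trivial : ¬ IsCompact (Closure (Orbit Γ u))
      ¬trivial compact =
        let p , φ , _ , incr , conv = compact (λ n → u ◂ δ n) (λ n ε 0<ε →
               u ◂ δ n , (δ n , δ∈Γ n , ≋-refl {u ◂ δ n})
               , ≋⇒Close (u ◂ δ n) (u ◂ δ n) 0<ε (≋-refl {u ◂ δ n}))
        in ¬convergent {p} φ incr conv

    large : ∃[ y ] ℝ.1# ℝ.< ∣ y ∣
    large = decidable-stable em λ ¬∃ → ¬trivial (λ x → ℝ.≮⇒≥ λ 1<x → ¬∃ (x , 1<x)) compact

    Values : Pred ℝ.Carrier ℓ
    Values t = ∃[ x ] t ℝ.≈ ∣ x ∣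

    -- If |y| > 1, then s / |y| is an upper bound along with s.
    ¬least : ∀ y s → ℝ.1# ℝ.< ∣ y ∣ → s ℝ.IsUpperBoundOf Values →
             ¬ (∀ t → t ℝ.IsUpperBoundOf Values → s ℝ.≤ t)
    ¬least y s 1<y isUpper isLeast = ℝ.<-irrefl ℝ.refl (begin-strict
      s                              ≈⟨ ℝ.*-identityʳ s ⟨
      s ℝ.* ℝ.1#                     <⟨ ℝ.*-monoˡ-< 0<s 1<y ⟩
      s ℝ.* ∣ y ∣                    ≤⟨ ℝ.*-monoʳ-≤ (∣∣-nonneg y) s≤s/y ⟩
      s ℝ.* ∣ y ∣ ℝ.⁻¹ ℝ.* ∣ y ∣     ≈⟨ ℝ.z/y*y≈z s (ℝ.>⇒≉ 0<y) ⟩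
      s                              ∎)
      where
      0<y : ℝ.0# ℝ.< ∣ y ∣
      0<y = ℝ.<-trans ℝ.0<1 1<y
      0<s : ℝ.0# ℝ.< s
      0<s = ℝ.<-≤-trans ℝ.0<1 (ℝ.≤-respˡ-≈ ∣1∣≈1 (isUpper _ (1# , ℝ.refl)))
      s≤s/y : s ℝ.≤ s ℝ.* ∣ y ∣ ℝ.⁻¹
      s≤s/y = isLeast _ λ { t (x , t≈x) → ℝ.*-cancelʳ-≤ 0<y (begin
        t ℝ.* ∣ y ∣                    ≈⟨ ℝ.*-congʳ t≈x ⟩
        ∣ x ∣ ℝ.* ∣ y ∣                ≈⟨ ∣∣-* x y ⟨
        ∣ x * y ∣                      ≤⟨ isUpper _ (x * y , ℝ.refl) ⟩
        s                              ≈⟨ ℝ.z/y*y≈z s (ℝ.>⇒≉ 0<y) ⟨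
        s ℝ.* ∣ y ∣ ℝ.⁻¹ ℝ.* ∣ y ∣     ∎) }

    ¬bounded : ¬ (∃[ r ] ∀ x → ∣ x ∣ ℝ.≤ r)
    ¬bounded (r , bound) =
      let y , 1<y               = large
          s , isUpper , isLeast = ℝ.supremum Values (∣ 1# ∣ , 1# , ℝ.refl)
            (r , λ { t (x , t≈x) → ℝ.≤-respˡ-≈ (ℝ.sym t≈x) (bound x) })
      in ¬least y s 1<y isUpper isLeast

-- A disc about ∞ that is disjoint from its translates, and generic points in it.

module NeighbourhoodOfInfinity {ℓ} (em : ExcludedMiddle ℓ)
    {ℝ : CompleteOrderedField ℓ} (𝕂 : CompleteNonArchimedeanField ℝ)
    (Γ : Pred (Schottky.GL₂ 𝕂) ℓ)
    (isSubgroup : Schottky.IsSubgroup 𝕂 Γ) (torsionFree : Schottky.IsTorsionFree 𝕂 Γ)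
    (∞∈Ω : Schottky.∞ 𝕂 ∈ Schottky.Ω 𝕂 Γ) where

  open Schottky 𝕂
  private
    module ℝ where
      open OrderedFieldProperties ℝ public
      open RealSequences em ℝ public
    module PGL = Group PGL₂
    module PGLₚ = GroupProperties PGL₂
  open CompleteNonArchimedeanField 𝕂 hiding (_^_)
  open ValuationProperties 𝕂
  open IntegerCoefficients commutativeRing
  open ProjectiveProperties field′ hiding (_∧_)
  open ChordalProperties 𝕂
  open ActionProperties ◂-action
  open SubgroupProperties PGL₂ isSubgroup
  open OrdinaryPoints em 𝕂 Γ isSubgroup torsionFree
  open IsSubgroup isSubgroup
  open GL₂
  open ≤-Reasoning ℝ.poset

  -- `b γ` is the second coordinate of `∞ ◂ γ`, so it vanishes only if γ fixes ∞.
  b≉0 : ∀ {γ} → γ ∈ Γ → ¬ γ ~ PGL.ε → b γ ≉ 0#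
  b≉0 {γ} γ∈Γ γ≁ε b≈0 = γ≁ε (stabiliser-trivial {∞} {γ} ∞∈Ω γ∈Γ (∧≈0⇒≋ {∞ ◂ γ} {∞}
    (trans (solve 4 (λ e a c bd → (e :* a :+ con ℤ.0ℤ :* c) :* con ℤ.0ℤ :- bd :* e := :- bd :* e) refl 1# (a γ) (c γ) (1# * b γ + 0# * d γ))
      (trans (*-congʳ (-‿cong (+-congʳ (*-congˡ b≈0))))
        (solve 2 (λ e d → :- (e :* con ℤ.0ℤ :+ con ℤ.0ℤ :* d) :* e := con ℤ.0ℤ) refl 1# (d γ))))))

  private
    module _ (γ : ℕ → GL₂) (s : ℕ → ℝ.Carrier) (γ∈Γ : ∀ n → γ n ∈ Γ)
             (lower : ∀ n → s n ℝ.* ∣ b (γ n) ∣ ℝ.< ∣ a (γ n) ∣)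
             (upper : ∀ n → ∣ a (γ n) ∣ ℝ.≤ s (suc n) ℝ.* ∣ b (γ n) ∣)
             (step  : ∀ n → s n ℝ.+ ℝ.1# ℝ.≤ s (suc n)) where

      -- The ratio of `∣ a ∣` to `∣ b ∣` depends only on the class in PGL(2). It is at most
      -- `s (suc m)` for `γ m` and exceeds `s n` for `γ n`.
      distinct-< : ∀ {m n} → m ℕ.< n → ¬ γ m ~ γ n
      distinct-< {m} {n} m<n (k , _ , a≈ , b≈ , _) = ℝ.<-irrefl ℝ.refl (begin-strict
        ∣ a (γ n) ∣                              ≈⟨ ℝ.trans (∣∣-cong a≈) (∣∣-* _ _) ⟩
        ∣ k ∣ ℝ.* ∣ a (γ m) ∣                    ≤⟨ ℝ.*-monoˡ-≤ (∣∣-nonneg k) (upper m) ⟩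
        ∣ k ∣ ℝ.* (s (suc m) ℝ.* ∣ b (γ m) ∣)    ≈⟨ ℝ.solve 3 (λ k s b → k ℝ.:* (s ℝ.:* b) ℝ.:= s ℝ.:* (k ℝ.:* b)) ℝ.refl (∣ k ∣) (s (suc m)) (∣ b (γ m) ∣) ⟩
        s (suc m) ℝ.* (∣ k ∣ ℝ.* ∣ b (γ m) ∣)    ≈⟨ ℝ.*-congˡ (ℝ.trans (∣∣-cong b≈) (∣∣-* _ _)) ⟨
        s (suc m) ℝ.* ∣ b (γ n) ∣                ≤⟨ ℝ.*-monoʳ-≤ (∣∣-nonneg _) (ℝ.s-mono-≤ s step m<n) ⟩
        s n ℝ.* ∣ b (γ n) ∣                      <⟨ lower n ⟩
        ∣ a (γ n) ∣                              ∎)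

      -- The chordal distance from `∞ ◂ γ n` to ∞ is at most ∣b∣ / ∣a∣, which is less than the
      -- inverse of `s n` once `s n` is positive.
      ∞-limit : LimitPoint Γ ∞
      ∞-limit = ∞ , γ , γ∈Γ , distinct , λ ε 0<ε →
        let N , large = ℝ.s-divergent s step (ε ℝ.⁻¹)
        in N , λ n N≤n → close n ε 0<ε (large n N≤n)
        where
        distinct : ∀ m n → m ≢ n → ¬ γ m ~ γ n
        distinct m n m≢n eq with ℕ.<-cmp m n
        ... | tri< m<n _ _ = distinct-< m<n eq
        ... | tri≈ _ m≡n _ = m≢n m≡n
        ... | tri> _ _ n<m = distinct-< n<m (PGL.sym {γ m} {γ n} eq)
        close : ∀ n ε → ℝ.0# ℝ.< ε → ε ℝ.⁻¹ ℝ.< s n → Close ε (∞ ◂ γ n) ∞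
        close n ε 0<ε ε⁻¹<s = begin-strict
          ∣ (∞ ◂ γ n) ∧ ∞ ∣
            ≈⟨ ℝ.trans (∣∣-cong (trans (solve 3 (λ x y e → x :* con ℤ.0ℤ :- y :* e := :- (y :* e)) refl (1# * a (γ n) + 0# * c (γ n)) y 1#)
                 (-‿cong (trans (*-identityʳ y) y≈b)))) (∣-x∣≈∣x∣ _) ⟩
          ∣ b (γ n) ∣
            ≈⟨ ℝ.trans (ℝ.*-congʳ (ℝ.inverse (ℝ.>⇒≉ 0<ε))) (ℝ.*-identityˡ _) ⟨
          ε ℝ.* ε ℝ.⁻¹ ℝ.* ∣ b (γ n) ∣
            ≈⟨ ℝ.*-assoc _ _ _ ⟩
          ε ℝ.* (ε ℝ.⁻¹ ℝ.* ∣ b (γ n) ∣)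
            ≤⟨ ℝ.*-monoˡ-≤ (ℝ.<⇒≤ 0<ε) (ℝ.*-monoʳ-≤ (∣∣-nonneg _) (ℝ.<⇒≤ ε⁻¹<s)) ⟩
          ε ℝ.* (s n ℝ.* ∣ b (γ n) ∣)
            <⟨ ℝ.*-monoˡ-< 0<ε (lower n) ⟩
          ε ℝ.* ∣ a (γ n) ∣
            ≈⟨ ℝ.*-congˡ (ℝ.*-identityʳ _) ⟨
          ε ℝ.* (∣ a (γ n) ∣ ℝ.* ℝ.1#)
            ≤⟨ ℝ.*-monoˡ-≤ (ℝ.<⇒≤ 0<ε) (ℝ.*-mono-≤ (ℝ.<⇒≤ (‖‖-pos (∞ ◂ γ n))) (ℝ.<⇒≤ ℝ.0<1)
                 (ℝ.≤-respˡ-≈ (∣∣-cong x≈a) (ℝ.x≤max _ _)) (ℝ.≤-respˡ-≈ ∣1∣≈1 (ℝ.x≤max _ _))) ⟩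
          ε ℝ.* (‖ ∞ ◂ γ n ‖ ℝ.* ‖ ∞ ‖) ∎
          where
          y = 1# * b (γ n) + 0# * d (γ n)
          first : ∀ x y → 1# * x + 0# * y ≈ x
          first x y = trans (+-cong (*-identityˡ x) (zeroˡ y)) (+-identityʳ x)
          y≈b : y ≈ b (γ n)
          y≈b = first _ _
          x≈a : 1# * a (γ n) + 0# * c (γ n) ≈ a (γ n)
          x≈a = first _ _

  -- a / b is the affine coordinate of `∞ ◂ γ`. Were these coordinates unbounded, one could choose
  -- elements of Γ whose coordinates grow past thresholds at least 1 apart, and ∞ would be a limit
  -- point.
  bounded : ∃[ R ] (ℝ.1# ℝ.≤ R × (∀ γ → γ ∈ Γ → ¬ γ ~ PGL.ε → ∣ a γ ∣ ℝ.≤ R ℝ.* ∣ b γ ∣))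
  bounded = decidable-stable em λ ¬bounded → escape ¬bounded
    where
    escape : ¬ ¬ (∃[ R ] (ℝ.1# ℝ.≤ R × (∀ γ → γ ∈ Γ → ¬ γ ~ PGL.ε → ∣ a γ ∣ ℝ.≤ R ℝ.* ∣ b γ ∣)))
    escape ¬bounded = ∞∈Ω (∞-limit γ s (λ n → proj₁ (proj₂ (next (s n)))) lower upper s+1≤s)
      where
      next : ∀ r → ∃[ γ ] (γ ∈ Γ × ¬ γ ~ PGL.ε × r ℝ.* ∣ b γ ∣ ℝ.< ∣ a γ ∣)
      next r = decidable-stable em λ ¬∃ → ¬bounded (ℝ.max ℝ.1# r , ℝ.x≤max _ _ , λ γ γ∈Γ γ≁ε →
        ℝ.≮⇒≥ λ Rb<a → ¬∃ (γ , γ∈Γ , γ≁ε ,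
          ℝ.≤-<-trans (ℝ.*-monoʳ-≤ (∣∣-nonneg _) (ℝ.y≤max _ _)) Rb<a))
      size : GL₂ → ℝ.Carrier
      size γ = ∣ a γ ∣ ℝ.* ∣ b γ ∣ ℝ.⁻¹
      s : ℕ → ℝ.Carrier
      s zero    = ℝ.0#
      s (suc n) = size (proj₁ (next (s n))) ℝ.+ ℝ.1#
      γ : ℕ → GL₂
      γ n = proj₁ (next (s n))
      lower : ∀ n → s n ℝ.* ∣ b (γ n) ∣ ℝ.< ∣ a (γ n) ∣
      lower n = proj₂ (proj₂ (proj₂ (next (s n))))
      0<∣b∣ : ∀ n → ℝ.0# ℝ.< ∣ b (γ n) ∣
      0<∣b∣ n = 0<∣x∣ (b≉0 {γ n} (proj₁ (proj₂ (next (s n)))) (proj₁ (proj₂ (proj₂ (next (s n))))))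
      size-b : ∀ n → size (γ n) ℝ.* ∣ b (γ n) ∣ ℝ.≈ ∣ a (γ n) ∣
      size-b n = ℝ.z/y*y≈z _ (ℝ.>⇒≉ (0<∣b∣ n))
      upper : ∀ n → ∣ a (γ n) ∣ ℝ.≤ s (suc n) ℝ.* ∣ b (γ n) ∣
      upper n = ℝ.≤-trans (ℝ.≤-reflexive (ℝ.sym (size-b n)))
        (ℝ.*-monoʳ-≤ (∣∣-nonneg _) (ℝ.<⇒≤ (ℝ.x<x+1 _)))
      s+1≤s : ∀ n → s n ℝ.+ ℝ.1# ℝ.≤ s (suc n)
      s+1≤s n = ℝ.+-monoˡ-≤ ℝ.1# (ℝ.*-cancelʳ-≤ (0<∣b∣ n)
        (ℝ.≤-trans (ℝ.<⇒≤ (lower n)) (ℝ.≤-reflexive (ℝ.sym (size-b n)))))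

  R : ℝ.Carrier
  R = proj₁ bounded

  1≤R : ℝ.1# ℝ.≤ R
  1≤R = proj₁ (proj₂ bounded)

  0≤R : ℝ.0# ℝ.≤ R
  0≤R = ℝ.≤-trans (ℝ.<⇒≤ ℝ.0<1) 1≤R

  ∣a∣≤R∣b∣ : ∀ {γ} → γ ∈ Γ → ¬ γ ~ PGL.ε → ∣ a γ ∣ ℝ.≤ R ℝ.* ∣ b γ ∣
  ∣a∣≤R∣b∣ {γ} = proj₂ (proj₂ bounded) γ

  -- The bound on `a` for the inverse of γ: the adjugate has first row `d γ`, `- b γ`.
  ∣d∣≤R∣b∣ : ∀ {γ} → γ ∈ Γ → ¬ γ ~ PGL.ε → ∣ d γ ∣ ℝ.≤ R ℝ.* ∣ b γ ∣
  ∣d∣≤R∣b∣ {γ} γ∈Γ γ≁ε = ℝ.≤-respʳ-≈ (ℝ.*-congˡ (∣-x∣≈∣x∣ (b γ)))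
    (∣a∣≤R∣b∣ {γ PGL.⁻¹} (⁻¹∈ {γ} γ∈Γ) λ γ⁻¹~ε → γ≁ε (PGLₚ.⁻¹-injective {γ} {PGL.ε}
      (PGL.trans {γ PGL.⁻¹} {PGL.ε} {PGL.ε PGL.⁻¹} γ⁻¹~ε (PGL.sym {PGL.ε PGL.⁻¹} {PGL.ε} PGLₚ.ε⁻¹≈ε))))

  -- the entries in the first row of γ² are a² + bc and b (a + d)
  ∣c∣≤R²∣b∣ : ∀ {γ} → γ ∈ Γ → ¬ γ ~ PGL.ε → ∣ c γ ∣ ℝ.≤ R ℝ.* R ℝ.* ∣ b γ ∣
  ∣c∣≤R²∣b∣ {γ} γ∈Γ γ≁ε = ℝ.*-cancelˡ-≤ (0<∣x∣ (b≉0 {γ} γ∈Γ γ≁ε)) (begin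
    B ℝ.* ∣ c γ ∣                          ≈⟨ ∣∣-* _ _ ⟨
    ∣ b γ * c γ ∣                          ≈⟨ ∣∣-cong (solve 3 (λ a b c → b :* c := (a :* a :+ b :* c) :- a :* a) refl (a γ) (b γ) (c γ)) ⟩
    ∣ (a γ * a γ + b γ * c γ) - a γ * a γ ∣ ≤⟨ ∣x-y∣≤ γ²-bound a²-bound ⟩
    R ℝ.* (R ℝ.* (B ℝ.* B))                ≈⟨ ℝ.solve 2 (λ R B → R ℝ.:* (R ℝ.:* (B ℝ.:* B)) ℝ.:= B ℝ.:* (R ℝ.:* R ℝ.:* B)) ℝ.refl R B ⟩
    B ℝ.* (R ℝ.* R ℝ.* B)                  ∎)
    where
    B = ∣ b γ ∣
    0≤B : ℝ.0# ℝ.≤ B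
    0≤B = ∣∣-nonneg _
    0≤RB : ℝ.0# ℝ.≤ R ℝ.* B
    0≤RB = ℝ.*-nonneg 0≤R 0≤B
    a≤ : ∣ a γ ∣ ℝ.≤ R ℝ.* B
    a≤ = ∣a∣≤R∣b∣ {γ} γ∈Γ γ≁ε
    a²-bound : ∣ a γ * a γ ∣ ℝ.≤ R ℝ.* (R ℝ.* (B ℝ.* B))
    a²-bound = begin
      ∣ a γ * a γ ∣              ≈⟨ ∣∣-* _ _ ⟩
      ∣ a γ ∣ ℝ.* ∣ a γ ∣        ≤⟨ ℝ.*-mono-≤ 0≤RB (∣∣-nonneg _) a≤ a≤ ⟩
      (R ℝ.* B) ℝ.* (R ℝ.* B)    ≈⟨ ℝ.solve 2 (λ R B → (R ℝ.:* B) ℝ.:* (R ℝ.:* B) ℝ.:= R ℝ.:* (R ℝ.:* (B ℝ.:* B))) ℝ.refl R B ⟩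
      R ℝ.* (R ℝ.* (B ℝ.* B))    ∎
    product-bound : ∀ x → ∣ x ∣ ℝ.≤ R ℝ.* B → ∣ x * b γ ∣ ℝ.≤ R ℝ.* (B ℝ.* B)
    product-bound x x≤ = begin
      ∣ x * b γ ∣        ≈⟨ ∣∣-* _ _ ⟩
      ∣ x ∣ ℝ.* B        ≤⟨ ℝ.*-monoʳ-≤ 0≤B x≤ ⟩
      R ℝ.* B ℝ.* B      ≈⟨ ℝ.*-assoc _ _ _ ⟩
      R ℝ.* (B ℝ.* B)    ∎
    γ²-bound : ∣ a γ * a γ + b γ * c γ ∣ ℝ.≤ R ℝ.* (R ℝ.* (B ℝ.* B))
    γ²-bound = begin
      ∣ a γ * a γ + b γ * c γ ∣          ≤⟨ ∣a∣≤R∣b∣ {γ · γ} (∙∈ {γ} {γ} γ∈Γ γ∈Γ) (λ eq → γ≁ε (x∙x≈ε⇒x≈ε torsionFree {γ} γ∈Γ eq)) ⟩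
      R ℝ.* ∣ a γ * b γ + b γ * d γ ∣    ≤⟨ ℝ.*-monoˡ-≤ 0≤R (∣x+y∣≤ (product-bound _ a≤)
                                             (ℝ.≤-respˡ-≈ (∣∣-cong (*-comm _ _)) (product-bound _ (∣d∣≤R∣b∣ {γ} γ∈Γ γ≁ε)))) ⟩
      R ℝ.* (R ℝ.* (B ℝ.* B))            ∎

  Big : Pred P¹ ℓ
  Big [ x ∶ y ]⟨ _ ⟩ = R ℝ.* ∣ y ∣ ℝ.< ∣ x ∣

  Big-resp : ∀ {p q} → p ≋ q → Big p → Big q
  Big-resp {[ x ∶ y ]⟨ _ ⟩} {[ x′ ∶ y′ ]⟨ _ ⟩} (k , k≉0 , x≈ , y≈) big = begin-strict
    R ℝ.* ∣ y′ ∣              ≈⟨ ℝ.*-congˡ (ℝ.trans (∣∣-cong y≈) (∣∣-* k y)) ⟩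
    R ℝ.* (∣ k ∣ ℝ.* ∣ y ∣)   ≈⟨ ℝ.solve 3 (λ R k y → R ℝ.:* (k ℝ.:* y) ℝ.:= k ℝ.:* (R ℝ.:* y)) ℝ.refl R (∣ k ∣) (∣ y ∣) ⟩
    ∣ k ∣ ℝ.* (R ℝ.* ∣ y ∣)   <⟨ ℝ.*-monoˡ-< (0<∣x∣ k≉0) big ⟩
    ∣ k ∣ ℝ.* ∣ x ∣           ≈⟨ ℝ.trans (∣∣-cong x≈) (∣∣-* k x) ⟨
    ∣ x′ ∣                    ∎

  -- In the disc `x * b γ` dominates `y * d γ`, so the second coordinate of `p ◂ γ` has size at
  -- least ∣x∣ ∣b∣. The bounds on `a` and `c` keep the first coordinate within `R` times that.
  Big-disjoint : ∀ {p γ} → Big p → γ ∈ Γ → ¬ γ ~ PGL.ε → ¬ Big (p ◂ γ)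
  Big-disjoint {[ x ∶ y ]⟨ _ ⟩} {γ} big γ∈Γ γ≁ε big′ = ℝ.<⇒≱ big′ (begin
    ∣ x * a γ + y * c γ ∣              ≤⟨ ∣x+y∣≤ xa≤ yc≤ ⟩
    R ℝ.* (∣ x ∣ ℝ.* B)                ≤⟨ ℝ.*-monoˡ-≤ 0≤R (ℝ.≤-respˡ-≈ (∣∣-* x (b γ)) (∣y∣<∣x∣⇒∣x∣≤∣x+y∣ yd<xb)) ⟩
    R ℝ.* ∣ x * b γ + y * d γ ∣        ∎)
    where
    B = ∣ b γ ∣
    0<B : ℝ.0# ℝ.< B
    0<B = 0<∣x∣ (b≉0 {γ} γ∈Γ γ≁ε)
    Ry≤x : R ℝ.* ∣ y ∣ ℝ.≤ ∣ x ∣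
    Ry≤x = ℝ.<⇒≤ big
    xa≤ : ∣ x * a γ ∣ ℝ.≤ R ℝ.* (∣ x ∣ ℝ.* B)
    xa≤ = begin
      ∣ x * a γ ∣              ≈⟨ ∣∣-* _ _ ⟩
      ∣ x ∣ ℝ.* ∣ a γ ∣        ≤⟨ ℝ.*-monoˡ-≤ (∣∣-nonneg x) (∣a∣≤R∣b∣ {γ} γ∈Γ γ≁ε) ⟩
      ∣ x ∣ ℝ.* (R ℝ.* B)      ≈⟨ ℝ.solve 3 (λ x R B → x ℝ.:* (R ℝ.:* B) ℝ.:= R ℝ.:* (x ℝ.:* B)) ℝ.refl (∣ x ∣) R B ⟩
      R ℝ.* (∣ x ∣ ℝ.* B)      ∎
    yc≤ : ∣ y * c γ ∣ ℝ.≤ R ℝ.* (∣ x ∣ ℝ.* B)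
    yc≤ = begin
      ∣ y * c γ ∣                    ≈⟨ ∣∣-* _ _ ⟩
      ∣ y ∣ ℝ.* ∣ c γ ∣              ≤⟨ ℝ.*-monoˡ-≤ (∣∣-nonneg y) (∣c∣≤R²∣b∣ {γ} γ∈Γ γ≁ε) ⟩
      ∣ y ∣ ℝ.* (R ℝ.* R ℝ.* B)      ≈⟨ ℝ.solve 3 (λ y R B → y ℝ.:* (R ℝ.:* R ℝ.:* B) ℝ.:= R ℝ.:* ((R ℝ.:* y) ℝ.:* B)) ℝ.refl (∣ y ∣) R B ⟩
      R ℝ.* ((R ℝ.* ∣ y ∣) ℝ.* B)    ≤⟨ ℝ.*-monoˡ-≤ 0≤R (ℝ.*-monoʳ-≤ (ℝ.<⇒≤ 0<B) Ry≤x) ⟩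
      R ℝ.* (∣ x ∣ ℝ.* B)            ∎
    yd<xb : ∣ y * d γ ∣ ℝ.< ∣ x * b γ ∣
    yd<xb = begin-strict
      ∣ y * d γ ∣              ≈⟨ ∣∣-* _ _ ⟩
      ∣ y ∣ ℝ.* ∣ d γ ∣        ≤⟨ ℝ.*-monoˡ-≤ (∣∣-nonneg y) (∣d∣≤R∣b∣ {γ} γ∈Γ γ≁ε) ⟩
      ∣ y ∣ ℝ.* (R ℝ.* B)      ≈⟨ ℝ.solve 3 (λ y R B → y ℝ.:* (R ℝ.:* B) ℝ.:= (R ℝ.:* y) ℝ.:* B) ℝ.refl (∣ y ∣) R B ⟩
      (R ℝ.* ∣ y ∣) ℝ.* B      <⟨ ℝ.*-monoʳ-< 0<B big ⟩
      ∣ x ∣ ℝ.* B              ≈⟨ ∣∣-* _ _ ⟨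
      ∣ x * b γ ∣              ∎

  -- For `p` outside the disc, `‖ p ‖` is at most R ∣y∣ and `‖ q ‖` at most `∣ x′ ∣`, while
  -- `∣ p ∧ q ∣` is at least `∣ y * x′ ∣`; so the distance would be at least 1 / R.
  Close⇒Big : ∀ {p q} → Big q → Close (R ℝ.⁻¹) p q → Big p
  Close⇒Big {p@([ x ∶ y ]⟨ _ ⟩)} {q@([ x′ ∶ y′ ]⟨ _ ⟩)} big p~q = ℝ.≰⇒> λ x≤Ry → small x≤Ry
    where
    0<R : ℝ.0# ℝ.< R
    0<R = ℝ.<-≤-trans ℝ.0<1 1≤R
    1≤ : ∀ {t} → ℝ.0# ℝ.≤ t → t ℝ.≤ R ℝ.* t
    1≤ {t} 0≤t = ℝ.≤-respˡ-≈ (ℝ.*-identityˡ t) (ℝ.*-monoʳ-≤ 0≤t 1≤R)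
    small : ¬ (∣ x ∣ ℝ.≤ R ℝ.* ∣ y ∣)
    small x≤Ry = ℝ.<-irrefl ℝ.refl (begin-strict
      ∣ y * x′ ∣                                  ≤⟨ ∣y∣<∣x∣⇒∣x∣≤∣x+y∣ xy′<yx′ ⟩
      ∣ y * x′ + - (x * y′) ∣                     ≈⟨ ∣x-y∣≈∣y-x∣ _ _ ⟩
      ∣ x * y′ - y * x′ ∣                         <⟨ p~q ⟩
      R ℝ.⁻¹ ℝ.* (‖ p ‖ ℝ.* ‖ q ‖)
        ≤⟨ ℝ.*-monoˡ-≤ (ℝ.<⇒≤ (ℝ.⁻¹-pos 0<R)) (ℝ.*-mono-≤ (ℝ.*-nonneg 0≤R (∣∣-nonneg y)) (ℝ.≤-trans (∣∣-nonneg x′) (ℝ.x≤max _ _))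
             (ℝ.max-lub x≤Ry (1≤ (∣∣-nonneg y))) (ℝ.max-lub ℝ.≤-refl (ℝ.≤-trans (1≤ (∣∣-nonneg y′)) (ℝ.<⇒≤ big)))) ⟩
      R ℝ.⁻¹ ℝ.* ((R ℝ.* ∣ y ∣) ℝ.* ∣ x′ ∣)
        ≈⟨ ℝ.solve 4 (λ i R y x → i ℝ.:* ((R ℝ.:* y) ℝ.:* x) ℝ.:= (i ℝ.:* R) ℝ.:* (y ℝ.:* x)) ℝ.refl (R ℝ.⁻¹) R (∣ y ∣) (∣ x′ ∣) ⟩
      (R ℝ.⁻¹ ℝ.* R) ℝ.* (∣ y ∣ ℝ.* ∣ x′ ∣)       ≈⟨ ℝ.*-cong (ℝ.inverseˡ (ℝ.>⇒≉ 0<R)) (ℝ.sym (∣∣-* y x′)) ⟩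
      ℝ.1# ℝ.* ∣ y * x′ ∣                         ≈⟨ ℝ.*-identityˡ _ ⟩
      ∣ y * x′ ∣                                  ∎)
      where
      0<y : ℝ.0# ℝ.< ∣ y ∣
      0<y = ∣∣-nonneg y , λ 0≈y → ℝ.<⇒≱ (‖‖-pos p) (ℝ.max-lub
        (ℝ.≤-trans x≤Ry (ℝ.≤-reflexive (ℝ.trans (ℝ.*-congˡ (ℝ.sym 0≈y)) (ℝ.zeroʳ R)))) (ℝ.≤-reflexive (ℝ.sym 0≈y)))
      xy′<yx′ : ∣ - (x * y′) ∣ ℝ.< ∣ y * x′ ∣
      xy′<yx′ = begin-strict
        ∣ - (x * y′) ∣               ≈⟨ ∣-x∣≈∣x∣ _ ⟩
        ∣ x * y′ ∣                   ≈⟨ ∣∣-* _ _ ⟩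
        ∣ x ∣ ℝ.* ∣ y′ ∣             ≤⟨ ℝ.*-monoʳ-≤ (∣∣-nonneg y′) x≤Ry ⟩
        R ℝ.* ∣ y ∣ ℝ.* ∣ y′ ∣       ≈⟨ ℝ.solve 3 (λ R y z → R ℝ.:* y ℝ.:* z ℝ.:= y ℝ.:* (R ℝ.:* z)) ℝ.refl R (∣ y ∣) (∣ y′ ∣) ⟩
        ∣ y ∣ ℝ.* (R ℝ.* ∣ y′ ∣)     <⟨ ℝ.*-monoˡ-< 0<y big ⟩
        ∣ y ∣ ℝ.* ∣ x′ ∣             ≈⟨ ∣∣-* _ _ ⟨
        ∣ y * x′ ∣                   ∎

  Big-orbit : ∀ {p α β} → α ∈ Γ → β ∈ Γ → Big (p ◂ α) → Big (p ◂ β) → α ~ β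
  Big-orbit {p} {α} {β} α∈Γ β∈Γ bigα bigβ = decidable-stable em λ α≁β →
    Big-disjoint {p ◂ α} {α PGL.⁻¹ · β} bigα (∙∈ {α PGL.⁻¹} {β} (⁻¹∈ {α} α∈Γ) β∈Γ)
      (λ eq → α≁β (PGL.sym {β} {α} (PGL.trans {β} {(α PGL.⁻¹) PGL.⁻¹} {α}
        (PGLₚ.inverseʳ-unique (α PGL.⁻¹) β eq) (PGLₚ.⁻¹-involutive α))))
      (Big-resp {p ◂ β} {p ◂ α ◂ (α PGL.⁻¹ · β)}
        (≋-sym {p ◂ α ◂ (α PGL.⁻¹ · β)} {p ◂ β} (◂-∙-⁻¹ˡ p α β)) bigβ)

  -- Two late terms of a sequence tending to `p` would both lie in the disc, and `Big-orbit` would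
  -- identify the group elements behind them.
  Big⇒Ω : ∀ {p} → Big p → p ∈ Ω Γ
  Big⇒Ω {p} big (q , γ , γ∈Γ , distinct , conv) =
    collide (conv (R ℝ.⁻¹) (ℝ.⁻¹-pos (ℝ.<-≤-trans ℝ.0<1 1≤R)))
    where
    collide : ¬ (∃[ N ] ∀ n → N ℕ.≤ n → Close (R ℝ.⁻¹) (q ◂ γ n) p)
    collide (N , near) = distinct N (suc N) (ℕ.<⇒≢ (ℕ.n<1+n N))
      (Big-orbit {q} {γ N} {γ (suc N)} (γ∈Γ N) (γ∈Γ (suc N))
        (Close⇒Big {q ◂ γ N} {p} big (near N ℕ.≤-refl))
        (Close⇒Big {q ◂ γ (suc N)} {p} big (near (suc N) (ℕ.n≤1+n N))))

  Big-ι : ∀ {z} → R ℝ.< ∣ z ∣ → Big (ι z)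
  Big-ι {z} R<z = ℝ.<-respˡ-≈ (ℝ.sym (ℝ.trans (ℝ.*-congˡ ∣1∣≈1) (ℝ.*-identityʳ R))) R<z

  Big-orbit-unique : ∀ {p z w} → R ℝ.< ∣ z ∣ → R ℝ.< ∣ w ∣ →
                     ι z ∈ Orbit Γ p → ι w ∈ Orbit Γ p → ∣ z ∣ ℝ.≈ ∣ w ∣
  Big-orbit-unique {p} {z} {w} R<z R<w (α , α∈Γ , pα≋z) (β , β∈Γ , pβ≋w) =
    ∣∣-cong (equal (≋-trans {ι z} {p ◂ α} {ι w} (≋-sym {p ◂ α} {ι z} pα≋z)
      (≋-trans {p ◂ α} {p ◂ β} {ι w} (◂-congʳ {p} {α} {β} (Big-orbit {p} {α} {β} α∈Γ β∈Γ
        (Big-resp {ι z} {p ◂ α} (≋-sym {p ◂ α} {ι z} pα≋z) (Big-ι R<z))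
        (Big-resp {ι w} {p ◂ β} (≋-sym {p ◂ β} {ι w} pβ≋w) (Big-ι R<w)))) pβ≋w)))
    where
    equal : ι z ≋ ι w → z ≈ w
    equal (k , _ , w≈kz , 1≈k) = sym (trans w≈kz (trans (*-congʳ (sym (trans 1≈k (*-identityʳ k)))) (*-identityˡ z)))

  -- An orbit meets the disc in at most one point, so a radius as large as the size of that point
  -- suffices.
  avoid : ∀ p → ∃[ B ] (R ℝ.≤ B × (∀ z → B ℝ.< ∣ z ∣ → ι z ∉ Orbit Γ p))
  avoid p = cases em
    where
    cases : Dec (∃[ w ] (R ℝ.< ∣ w ∣ × ι w ∈ Orbit Γ p)) →
            ∃[ B ] (R ℝ.≤ B × (∀ z → B ℝ.< ∣ z ∣ → ι z ∉ Orbit Γ p))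
    cases (yes (w , R<w , w∈)) = ∣ w ∣ , ℝ.<⇒≤ R<w , λ z w<z z∈ →
      ℝ.<-irrefl (ℝ.sym (Big-orbit-unique {p} {z} {w} (ℝ.<-trans R<w w<z) R<w z∈ w∈)) w<z
    cases (no ¬∃) = R , ℝ.≤-refl , λ z R<z z∈ → ¬∃ (z , R<z , z∈)

  avoid-all : ∀ ps → ∃[ B ] (R ℝ.≤ B × (∀ z → B ℝ.< ∣ z ∣ → All (λ p → ι z ∉ Orbit Γ p) ps))
  avoid-all []       = R , ℝ.≤-refl , λ _ _ → []
  avoid-all (p ∷ ps) =
    let B , R≤B , away = avoid p
        C , _   , rest = avoid-all ps
    in ℝ.max B C , ℝ.≤-trans R≤B (ℝ.x≤max _ _)
     , λ z B⊔C<z → away z (ℝ.≤-<-trans (ℝ.x≤max _ _) B⊔C<z) ∷ rest z (ℝ.≤-<-trans (ℝ.y≤max _ _) B⊔C<z)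

  generic-ordinary : (∀ r → ∃[ x ] r ℝ.< ∣ x ∣) →
                     ∀ ps → ∃[ u ] (u ∈ Ω Γ × All (λ p → u ∉ Orbit Γ p) ps)
  generic-ordinary unbounded ps =
    let B , R≤B , away = avoid-all ps
        z , B<z        = unbounded B
    in ι z , Big⇒Ω {ι z} (Big-ι (ℝ.≤-<-trans R≤B B<z)) , away z B<z

-- Multipliers as products of cross ratios.

module ThetaMultipliers {ℓ} (em : ExcludedMiddle ℓ)
    {ℝ : CompleteOrderedField ℓ} (𝕂 : CompleteNonArchimedeanField ℝ)
    (Γ : Pred (Schottky.GL₂ 𝕂) ℓ)
    (isSubgroup : Schottky.IsSubgroup 𝕂 Γ) (torsionFree : Schottky.IsTorsionFree 𝕂 Γ)
    (T : Schottky.ThetaFunctions 𝕂 Γ) where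

  open Schottky 𝕂
  private
    module PGL = Group PGL₂
    module PGLₚ = GroupProperties PGL₂
  open CompleteNonArchimedeanField 𝕂 hiding (_^_)
  open ValuationProperties 𝕂
  open ProjectiveProperties field′ hiding (_∧_)
  open ActionProperties ◂-action
  open RightAction ◂-action using (◂-ε; ◂-∙)
  open OrdinaryPoints em 𝕂 Γ isSubgroup torsionFree
  open IsSubgroup isSubgroup renaming (resp to Γ-resp)
  open ThetaFunctions T
  open UnorderedProducts 𝕂 PGL₂ (λ _ _ → em) Γ hiding (HasProduct)

  Ω-resp : ∀ {p q} → p ≋ q → p ∈ Ω Γ → q ∈ Ω Γ
  Ω-resp {p} {q} p≋q = Ω-◂ {p} {q} PGL.ε
    (λ {γ} γ∈Γ → Γ-resp {γ} {PGL.ε · γ · PGL.ε PGL.⁻¹} (PGL.sym {PGL.ε · γ · PGL.ε PGL.⁻¹} {γ} (conjugate γ)) γ∈Γ)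
    (≋-trans {p ◂ PGL.ε} {p} {q} (◂-ε p) p≋q)
    where
    conjugate : ∀ γ → PGL.ε · γ · PGL.ε PGL.⁻¹ ~ γ
    conjugate γ = PGL.trans {PGL.ε · γ · PGL.ε PGL.⁻¹} {γ · PGL.ε} {γ}
      (PGL.∙-cong {PGL.ε · γ} {γ} {PGL.ε PGL.⁻¹} {PGL.ε} (PGL.identityˡ γ) PGLₚ.ε⁻¹≈ε) (PGL.identityʳ γ)

  Orbit-resp : ∀ {a p q} → p ≋ q → p ∈ Orbit Γ a → q ∈ Orbit Γ a
  Orbit-resp {a} {p} {q} p≋q (δ , δ∈Γ , aδ≋p) = δ , δ∈Γ , ≋-trans {a ◂ δ} {p} {q} aδ≋p p≋q

  Orbit-◂ : ∀ {a p γ} → γ ∈ Γ → p ◂ γ ∈ Orbit Γ a → p ∈ Orbit Γ a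
  Orbit-◂ {a} {p} {γ} γ∈Γ (δ , δ∈Γ , aδ≋pγ) = δ · γ PGL.⁻¹ , ∙∈ {δ} {γ PGL.⁻¹} δ∈Γ (⁻¹∈ {γ} γ∈Γ)
    , ≋-trans {a ◂ (δ · γ PGL.⁻¹)} {a ◂ δ ◂ γ PGL.⁻¹} {p} (◂-∙ a δ (γ PGL.⁻¹))
        (◂-⁻¹ {p} {a ◂ δ} {γ} (≋-sym {a ◂ δ} {p ◂ γ} aδ≋pγ))

  ∉Orbit⇒≭ : ∀ {p a δ} → p ∉ Orbit Γ a → δ ∈ Γ → p ≭ a ◂ δ
  ∉Orbit⇒≭ {p} {a} {δ} p∉ δ∈Γ p≋aδ = p∉ (δ , δ∈Γ , ≋-sym {p} {a ◂ δ} p≋aδ)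

  factor : P¹ → P¹ → Carrier → GL₂ → Carrier
  factor a b z δ = (z ⊖ a ◂ δ) * (z ⊖ b ◂ δ) ⁻¹

  factors : ∀ {a b z w δ} → ι z ∉ Orbit Γ b → ι w ∉ Orbit Γ a → δ ∈ Γ →
            factor a b z δ * factor b a w δ ≈ crossRatio (ι z) (ι w) (a ◂ δ) (b ◂ δ)
  factors {a} {b} {z} {w} {δ} z∉b w∉a δ∈Γ =
    factors≈crossRatio {z} {w} {a ◂ δ} {b ◂ δ}
      (∉Orbit⇒≭ {ι z} {b} {δ} z∉b δ∈Γ) (∉Orbit⇒≭ {ι w} {a} {δ} w∉a δ∈Γ)

  -- This lets `Θ b a z` stand for the inverse of `Θ a b z`, so that quotients of theta values
  -- become products of limits and no limit has to be inverted.
  Θ-swap : ∀ {a b z} → a ∈ Ω Γ → b ∈ Ω Γ → ι z ∈ Ω Γ → ι z ∉ Orbit Γ a → ι z ∉ Orbit Γ b →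
           Θ a b z * Θ b a z ≈ 1#
  Θ-swap {a} {b} {z} a∈Ω b∈Ω z∈Ω z∉a z∉b = HasProduct-unique
    (λ {δ} δ∈Γ → trans (factors {a} {b} {z} {z} {δ} z∉b z∉a δ∈Γ)
      (quotient≈1 (∧-nonzero {ι z} {ι z} {a ◂ δ} {b ◂ δ}
        (∉Orbit⇒≭ {ι z} {b} {δ} z∉b δ∈Γ) (∉Orbit⇒≭ {ι z} {a} {δ} z∉a δ∈Γ)) (*-comm _ _)))
    (HasProduct-* (Θ-product a b z a∈Ω b∈Ω z∈Ω z∉b) (Θ-product b a z b∈Ω a∈Ω z∈Ω z∉a))
    (HasProduct-1 {f = λ _ → 1#} (λ _ → refl))

  -- With affine coordinates `z` of `u` and `w` of `u ◂ γ`, the multiplier is `Θ a b w * Θ b a z`,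
  -- and the factors of the two products combine into cross ratios.
  c-product : ∀ {a b γ u} → a ∈ Ω Γ → b ∈ Ω Γ → γ ∈ Γ → u ∈ Ω Γ →
              u ∉ Orbit Γ a → u ∉ Orbit Γ b → u ≭ ∞ → u ◂ γ ≭ ∞ →
              HasProduct Γ (λ δ → crossRatio (u ◂ γ) u (a ◂ δ) (b ◂ δ)) (c a b γ)
  c-product {a} {b} {γ} {u} a∈Ω b∈Ω γ∈Γ u∈Ω u∉a u∉b u≭∞ uγ≭∞ =
    at (ι-finite {u} u≭∞) (ι-finite {u ◂ γ} uγ≭∞)
    where
    at : ∃[ z ] ι z ≋ u → ∃[ w ] ι w ≋ u ◂ γ →
         HasProduct Γ (λ δ → crossRatio (u ◂ γ) u (a ◂ δ) (b ◂ δ)) (c a b γ)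
    at (z , z≋u) (w , w≋uγ) = HasProduct-cong
      (λ {δ} δ∈Γ → trans (factors {a} {b} {w} {z} {δ} w∉b z∉a δ∈Γ)
        (crossRatio-cong {ι w} {ι z} {a ◂ δ} {b ◂ δ} {u ◂ γ} {u} {a ◂ δ} {b ◂ δ}
          w≋uγ z≋u (≋-refl {a ◂ δ}) (≋-refl {b ◂ δ})
          (∉Orbit⇒≭ {ι w} {b} {δ} w∉b δ∈Γ) (∉Orbit⇒≭ {ι z} {a} {δ} z∉a δ∈Γ)))
      value
      (HasProduct-* (Θ-product a b w a∈Ω b∈Ω w∈Ω w∉b) (Θ-product b a z b∈Ω a∈Ω z∈Ω z∉a))
      where
      open ≈-Reasoning setoid
      z∈Ω : ι z ∈ Ω Γ
      z∈Ω = Ω-resp {u} {ι z} (≋-sym {ι z} {u} z≋u) u∈Ω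
      z∉a : ι z ∉ Orbit Γ a
      z∉a z∈ = u∉a (Orbit-resp {a} {ι z} {u} z≋u z∈)
      z∉b : ι z ∉ Orbit Γ b
      z∉b z∈ = u∉b (Orbit-resp {b} {ι z} {u} z≋u z∈)
      zγ≋w : ι z ◂ γ ≋ ι w
      zγ≋w = ≋-trans {ι z ◂ γ} {u ◂ γ} {ι w} (◂-congˡ {ι z} {u} {γ} z≋u) (≋-sym {ι w} {u ◂ γ} w≋uγ)
      w∈Ω : ι w ∈ Ω Γ
      w∈Ω = Ω-◂ {ι z} {ι w} γ (λ {δ} δ∈Γ → ∙∈ {γ · δ} {γ PGL.⁻¹} (∙∈ {γ} {δ} γ∈Γ δ∈Γ) (⁻¹∈ {γ} γ∈Γ)) zγ≋w z∈Ω
      w∉b : ι w ∉ Orbit Γ b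
      w∉b w∈ = u∉b (Orbit-◂ {b} {u} {γ} γ∈Γ (Orbit-resp {b} {ι w} {u ◂ γ} w≋uγ w∈))
      value : Θ a b w * Θ b a z ≈ c a b γ
      value = begin
        Θ a b w * Θ b a z              ≈⟨ *-congʳ (Θ-γ a b γ z w a∈Ω b∈Ω γ∈Γ z∈Ω z∉b zγ≋w) ⟩
        c a b γ * Θ a b z * Θ b a z    ≈⟨ *-assoc _ _ _ ⟩
        c a b γ * (Θ a b z * Θ b a z)  ≈⟨ *-congˡ (Θ-swap {a} {b} {z} a∈Ω b∈Ω z∈Ω z∉a z∉b) ⟩
        c a b γ * 1#                   ≈⟨ *-identityʳ _ ⟩
        c a b γ                        ∎

-- What the computation of c_{a,b} needs to know of Γ acting on P¹.  The group
-- and the points are abstract because the unfolding of _~_ and _≋_ would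
-- otherwise prevent the inference of implicit arguments.

record Uniformisation {ℓ} {ℝ : CompleteOrderedField ℓ} (𝕂 : CompleteNonArchimedeanField ℝ)
                      {G : Group ℓ ℓ} {X : Setoid ℓ ℓ} (A : RightAction G X)
                      (Γ : Pred (Group.Carrier G) ℓ) : Set (lsuc ℓ) where
  private
    module G = Group G
    module GT = GroupTheory G
  open CompleteNonArchimedeanField 𝕂 using (Carrier; _≈_; _≉_; _*_; 0#; 1#)
  open Setoid X public using () renaming (Carrier to P; _≈_ to _≋_)
  open RightAction A public

  infix 4 _≭_
  _≭_ : P → P → Set ℓ
  p ≭ q = ¬ p ≋ q

  Orbit : P → Pred P ℓ
  Orbit p q = ∃[ γ ] (γ ∈ Γ × p ◂ γ ≋ q)

  infix 4 _≟G_ _≟P_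
  field
    _≟G_               : Decidable G._≈_
    _≟P_               : Decidable _≋_
    isSubgroup         : GT.IsSubgroup Γ
    torsionFree        : GT.IsTorsionFree Γ
    Ω                  : Pred P ℓ
    Ω-◂                : ∀ {u v} τ → (∀ {γ} → γ ∈ Γ → τ G.∙ γ G.∙ τ G.⁻¹ ∈ Γ) →
                         u ◂ τ ≋ v → u ∈ Ω → v ∈ Ω
    stabiliser-trivial : ∀ {u γ} → u ∈ Ω → γ ∈ Γ → u ◂ γ ≋ u → γ G.≈ G.ε
    ∞                  : P
    generic            : ∀ ps → ∃[ u ] (u ∈ Ω × All (λ p → u ∉ Orbit p) ps)

    crossRatio         : P → P → P → P → Carrier
    crossRatio-cong    : ∀ {u v p q u′ v′ p′ q′} → u ≋ u′ → v ≋ v′ → p ≋ p′ → q ≋ q′ →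
                         u ≭ q → v ≭ p → crossRatio u v p q ≈ crossRatio u′ v′ p′ q′
    crossRatio-◂       : ∀ M {u v p q} → u ≭ q → v ≭ p →
                         crossRatio (u ◂ M) (v ◂ M) (p ◂ M) (q ◂ M) ≈ crossRatio u v p q
    crossRatio-cocycle : ∀ {u v p q r} → u ≭ q → u ≭ r → v ≭ p → v ≭ q →
                         crossRatio u v p q * crossRatio u v q r ≈ crossRatio u v p r
    crossRatio-trans   : ∀ {u v w p q} → u ≭ q → v ≭ p → v ≭ q → w ≭ p →
                         crossRatio u v p q * crossRatio v w p q ≈ crossRatio u w p q
    crossRatio-swap    : ∀ {u v p q} → u ≭ p → u ≭ q → v ≭ p → v ≭ q →
                         crossRatio u v p q * crossRatio v u p q ≈ 1#
    crossRatio≈1       : ∀ {u v p q} → u ≭ q → v ≭ p → p ≭ q → crossRatio u v p q ≈ 1# → u ≋ v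

    c                  : P → P → G.Carrier → Carrier
    c-cong             : ∀ {a b γ δ} → a ∈ Ω → b ∈ Ω → γ ∈ Γ → δ ∈ Γ → γ G.≈ δ → c a b γ ≈ c a b δ
    c-nonzero          : ∀ {a b γ} → a ∈ Ω → b ∈ Ω → γ ∈ Γ → c a b γ ≉ 0#
    c-homo             : ∀ {a b γ δ} → a ∈ Ω → b ∈ Ω → γ ∈ Γ → δ ∈ Γ →
                         c a b (γ G.∙ δ) ≈ c a b γ * c a b δ

  open UnorderedProducts 𝕂 G _≟G_ Γ public

  field
    c-product          : ∀ {a b γ u} → a ∈ Ω → b ∈ Ω → γ ∈ Γ → u ∈ Ω →
                         u ∉ Orbit a → u ∉ Orbit b → u ≭ ∞ → u ◂ γ ≭ ∞ →
                         HasProduct (λ δ → crossRatio (u ◂ γ) u (a ◂ δ) (b ◂ δ)) (c a b γ)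

-- Formal properties of the multipliers.

module Multipliers {ℓ} {ℝ : CompleteOrderedField ℓ} {𝕂 : CompleteNonArchimedeanField ℝ}
                   {G : Group ℓ ℓ} {X : Setoid ℓ ℓ} {A : RightAction G X}
                   {Γ : Pred (Group.Carrier G) ℓ} (U : Uniformisation 𝕂 A Γ) where
  private
    module G where
      open Group G public
      open GroupTheory G public
      open GroupProperties G public
    module X = Setoid X
    module X-Reasoning = ≈-Reasoning X
  open G using (_∙_)
  open CompleteNonArchimedeanField 𝕂 hiding (_^_)
  open ValuationProperties 𝕂
  open Uniformisation U
  open ActionProperties A
  open SubgroupProperties G isSubgroup
  open G.IsSubgroup isSubgroup renaming (resp to Γ-resp)

  -- Both inclusions are kept, since reindexing a product by δ ↦ τδτ⁻¹ requires a bijection of Γ.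
  Normalises : Pred G.Carrier ℓ
  Normalises τ = (∀ {γ} → γ ∈ Γ → τ ∙ γ ∙ τ G.⁻¹ ∈ Γ) × (∀ {γ} → γ ∈ Γ → τ G.⁻¹ ∙ γ ∙ τ ∈ Γ)

  Γ-normalises : ∀ {τ} → τ ∈ Γ → Normalises τ
  Γ-normalises τ∈Γ = (λ γ∈Γ → ∙∈ (∙∈ τ∈Γ γ∈Γ) (⁻¹∈ τ∈Γ)) , (λ γ∈Γ → ∙∈ (∙∈ (⁻¹∈ τ∈Γ) γ∈Γ) τ∈Γ)

  Ω-Γ : ∀ {u γ} → u ∈ Ω → γ ∈ Γ → u ◂ γ ∈ Ω
  Ω-Γ {γ = γ} u∈Ω γ∈Γ = Ω-◂ γ (proj₁ (Γ-normalises γ∈Γ)) X.refl u∈Ω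

  ∉Orbit⇒≭ : ∀ {u p δ} → u ∉ Orbit p → δ ∈ Γ → u ≭ p ◂ δ
  ∉Orbit⇒≭ u∉ δ∈Γ u≋pδ = u∉ (_ , δ∈Γ , X.sym u≋pδ)

  ∉Orbit⇒≭₀ : ∀ {u p} → u ∉ Orbit p → u ≭ p
  ∉Orbit⇒≭₀ u∉ u≋p = ∉Orbit⇒≭ u∉ ε∈ (X.trans u≋p (X.sym (◂-ε _)))

  ∉Orbit-◂ : ∀ {u p γ} → γ ∈ Γ → u ∉ Orbit p → u ◂ γ ∉ Orbit p
  ∉Orbit-◂ {u} {p} {γ} γ∈Γ u∉ (δ , δ∈Γ , pδ≋uγ) = u∉ (δ ∙ γ G.⁻¹ , x∙y⁻¹∈ δ∈Γ γ∈Γ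
    , X.trans (◂-∙ p δ _) (◂-⁻¹ (X.sym pδ≋uγ)))

  c-cocycle : ∀ {a b d γ} → a ∈ Ω → b ∈ Ω → d ∈ Ω → γ ∈ Γ → c a b γ * c b d γ ≈ c a d γ
  c-cocycle {a} {b} {d} {γ} a∈Ω b∈Ω d∈Ω γ∈Γ
    -- Avoiding the orbit of ∞ keeps both `u` and `u ◂ γ` finite.
    with u , u∈Ω , u∉a ∷ u∉b ∷ u∉d ∷ u∉∞ ∷ [] ← generic (a ∷ b ∷ d ∷ ∞ ∷ []) =
    HasProduct-unique
      (λ δ∈Γ → crossRatio-cocycle
        (∉Orbit⇒≭ (∉Orbit-◂ γ∈Γ u∉b) δ∈Γ) (∉Orbit⇒≭ (∉Orbit-◂ γ∈Γ u∉d) δ∈Γ)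
        (∉Orbit⇒≭ u∉a δ∈Γ) (∉Orbit⇒≭ u∉b δ∈Γ))
      (HasProduct-* (c-product a∈Ω b∈Ω γ∈Γ u∈Ω u∉a u∉b u≭∞ uγ≭∞)
                    (c-product b∈Ω d∈Ω γ∈Γ u∈Ω u∉b u∉d u≭∞ uγ≭∞))
      (c-product a∈Ω d∈Ω γ∈Γ u∈Ω u∉a u∉d u≭∞ uγ≭∞)
    where
    u≭∞  = ∉Orbit⇒≭₀ u∉∞
    uγ≭∞ = ∉Orbit⇒≭₀ (∉Orbit-◂ γ∈Γ u∉∞)

  -- Applying τ to the four points turns the factor of `c a b γ` at τδτ⁻¹, taken at `u`, into the
  -- factor of `c a′ b′ γ′` at δ, taken at `u ◂ τ`.
  c-transport : ∀ {a b a′ b′ τ γ γ′} → a ∈ Ω → b ∈ Ω → a′ ∈ Ω → b′ ∈ Ω → Normalises τ →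
                a ◂ τ ≋ a′ → b ◂ τ ≋ b′ → γ ∈ Γ → γ′ ∈ Γ → γ ∙ τ G.≈ τ ∙ γ′ →
                c a b γ ≈ c a′ b′ γ′
  c-transport {a} {b} {a′} {b′} {τ} {γ} {γ′} a∈Ω b∈Ω a′∈Ω b′∈Ω (conj , conj⁻¹) aτ≋a′ bτ≋b′ γ∈Γ γ′∈Γ γτ≈τγ′
    -- The last point keeps `u ◂ τ` and `u ◂ τ ◂ γ′` finite.
    with u , u∈Ω , u∉a ∷ u∉b ∷ u∉∞ ∷ u∉∞τ⁻¹ ∷ [] ← generic (a ∷ b ∷ ∞ ∷ ∞ ◂ τ G.⁻¹ ∷ []) =
    HasProduct-unique
      (λ {δ} δ∈Γ → trans
        (sym (crossRatio-◂ τ (∉Orbit⇒≭ (∉Orbit-◂ γ∈Γ u∉b) (conj δ∈Γ)) (∉Orbit⇒≭ u∉a (conj δ∈Γ))))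
        (sym (crossRatio-cong uτγ′≋uγτ X.refl (moved a a′ δ aτ≋a′) (moved b b′ δ bτ≋b′)
          (∉Orbit⇒≭ (∉Orbit-◂ γ′∈Γ (transported u∉b bτ≋b′)) δ∈Γ)
          (∉Orbit⇒≭ (transported u∉a aτ≋a′) δ∈Γ))))
      (HasProduct-reindex (λ δ → τ ∙ δ ∙ τ G.⁻¹) (λ δ → τ G.⁻¹ ∙ δ ∙ τ) conj conj⁻¹
        (λ eq → G.∙-congʳ (G.∙-congˡ eq))
        (λ eq → G.∙-cancelˡ τ _ _ (G.∙-cancelʳ (τ G.⁻¹) _ _ eq))
        (λ δ → G.trans (G.∙-congʳ (G.trans (G.∙-congˡ (G.assoc _ _ _)) (G.\\-leftDividesˡ τ (δ ∙ τ))))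
                 (G.//-rightDividesʳ τ δ))
        (λ eq → G.∙-congʳ (G.∙-congˡ eq))
        (c-product a∈Ω b∈Ω γ∈Γ u∈Ω u∉a u∉b (∉Orbit⇒≭₀ u∉∞) (∉Orbit⇒≭₀ (∉Orbit-◂ γ∈Γ u∉∞))))
      (c-product a′∈Ω b′∈Ω γ′∈Γ (Ω-◂ τ conj X.refl u∈Ω)
        (transported u∉a aτ≋a′) (transported u∉b bτ≋b′)
        (λ uτ≋∞ → ∉Orbit⇒≭₀ u∉∞τ⁻¹ (X.sym (◂-⁻¹ uτ≋∞)))
        (λ uτγ′≋∞ → ∉Orbit⇒≭₀ (∉Orbit-◂ γ∈Γ u∉∞τ⁻¹)
          (X.sym (◂-⁻¹ (X.trans (X.sym uτγ′≋uγτ) uτγ′≋∞)))))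
    where
    uτγ′≋uγτ : u ◂ τ ◂ γ′ ≋ u ◂ γ ◂ τ
    uτγ′≋uγτ = X.trans (X.sym (◂-∙ u τ γ′)) (X.trans (◂-congʳ (G.sym γτ≈τγ′)) (◂-∙ u γ τ))
    moved : ∀ p p′ δ → p ◂ τ ≋ p′ → p′ ◂ δ ≋ p ◂ (τ ∙ δ ∙ τ G.⁻¹) ◂ τ
    moved p p′ δ pτ≋p′ = begin
      p′ ◂ δ                        ≈⟨ ◂-congˡ pτ≋p′ ⟨
      p ◂ τ ◂ δ                     ≈⟨ ◂-∙ p τ δ ⟨
      p ◂ (τ ∙ δ)                   ≈⟨ ◂-congʳ (G.//-rightDividesˡ τ (τ ∙ δ)) ⟨
      p ◂ (τ ∙ δ ∙ τ G.⁻¹ ∙ τ)      ≈⟨ ◂-∙ p _ τ ⟩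
      p ◂ (τ ∙ δ ∙ τ G.⁻¹) ◂ τ      ∎
      where open X-Reasoning
    transported : ∀ {p p′} → u ∉ Orbit p → p ◂ τ ≋ p′ → u ◂ τ ∉ Orbit p′
    transported {p} {p′} u∉p pτ≋p′ (δ , δ∈Γ , p′δ≋uτ) = u∉p (τ ∙ δ ∙ τ G.⁻¹ , conj δ∈Γ , (begin
      p ◂ (τ ∙ δ ∙ τ G.⁻¹)                 ≈⟨ ◂-⁻¹ X.refl ⟨
      p ◂ (τ ∙ δ ∙ τ G.⁻¹) ◂ τ ◂ τ G.⁻¹    ≈⟨ ◂-congˡ (moved p p′ δ pτ≋p′) ⟨
      p′ ◂ δ ◂ τ G.⁻¹                      ≈⟨ ◂-⁻¹ (X.sym p′δ≋uτ) ⟩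
      u                                    ∎))
      where open X-Reasoning

  module _ {a b} (a∈Ω : a ∈ Ω) (b∈Ω : b ∈ Ω) where

    c-ε : c a b G.ε ≈ 1#
    c-ε = *-cancelˡ (c-nonzero a∈Ω b∈Ω ε∈) (trans (sym (c-homo a∈Ω b∈Ω ε∈ ε∈))
      (trans (c-cong a∈Ω b∈Ω (∙∈ ε∈ ε∈) ε∈ (G.identityˡ G.ε)) (sym (*-identityʳ _))))

    c-inverse : ∀ {x y} → x ∈ Γ → y ∈ Γ → x ∙ y G.≈ G.ε → c a b x * c a b y ≈ 1#
    c-inverse x∈Γ y∈Γ xy≈ε = trans (sym (c-homo a∈Ω b∈Ω x∈Γ y∈Γ))
      (trans (c-cong a∈Ω b∈Ω (∙∈ x∈Γ y∈Γ) ε∈ xy≈ε) c-ε)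

    c-conjugate : ∀ {x y z} → x ∈ Γ → y ∈ Γ → z ∈ Γ → x ∙ y G.≈ y ∙ z → c a b x ≈ c a b z
    c-conjugate {x} {y} {z} x∈Γ y∈Γ z∈Γ eq = *-cancelʳ (c-nonzero a∈Ω b∈Ω y∈Γ) (begin
      c a b x * c a b y   ≈⟨ c-homo a∈Ω b∈Ω x∈Γ y∈Γ ⟨
      c a b (x ∙ y)       ≈⟨ c-cong a∈Ω b∈Ω (∙∈ x∈Γ y∈Γ) (∙∈ y∈Γ z∈Γ) eq ⟩
      c a b (y ∙ z)       ≈⟨ c-homo a∈Ω b∈Ω y∈Γ z∈Γ ⟩
      c a b y * c a b z   ≈⟨ *-comm _ _ ⟩
      c a b z * c a b y   ∎)
      where open ≈-Reasoning setoid

    private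
      commutator : ∀ {x y z} → x ∈ Γ → y ∈ Γ → z G.≈ x ∙ y ∙ x G.⁻¹ ∙ y G.⁻¹ → z ∈ Γ × c a b z ≈ 1#
      commutator {x} {y} {z} x∈Γ y∈Γ z≈ = z∈Γ , *-cancelʳ (c-nonzero a∈Ω b∈Ω y∈Γ) (begin
        c a b z * c a b y   ≈⟨ c-homo a∈Ω b∈Ω z∈Γ y∈Γ ⟨
        c a b (z ∙ y)       ≈⟨ c-conjugate (∙∈ z∈Γ y∈Γ) x∈Γ y∈Γ zyx≈xy ⟩
        c a b y             ≈⟨ *-identityˡ _ ⟨
        1# * c a b y        ∎)
        where
        open ≈-Reasoning setoid
        zyx≈xy : z ∙ y ∙ x G.≈ x ∙ y
        zyx≈xy = G.trans (G.∙-congʳ (G.trans (G.∙-congʳ z≈) (G.//-rightDividesˡ y _))) (G.//-rightDividesˡ x _)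
        z∈Γ : z ∈ Γ
        z∈Γ = Γ-resp (G.sym z≈) (∙∈ (∙∈ (∙∈ x∈Γ y∈Γ) (⁻¹∈ x∈Γ)) (⁻¹∈ y∈Γ))

    -- Membership in Γ is carried through the induction because the laws of `c` hold only there.
    c-[Γ,Γ] : ∀ {z} → z ∈ G.[ Γ , Γ ] → z ∈ Γ × c a b z ≈ 1#
    c-[Γ,Γ] (G.gen (_ , _ , x∈Γ , y∈Γ , z≈)) = commutator x∈Γ y∈Γ z≈
    c-[Γ,Γ] G.unit = ε∈ , c-ε
    c-[Γ,Γ] (G.mul p q) with x∈Γ , cx≈1 ← c-[Γ,Γ] p | y∈Γ , cy≈1 ← c-[Γ,Γ] q =
      ∙∈ x∈Γ y∈Γ , trans (c-homo a∈Ω b∈Ω x∈Γ y∈Γ) (trans (*-cong cx≈1 cy≈1) (*-identityˡ 1#))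
    c-[Γ,Γ] (G.inv {x} p) with x∈Γ , cx≈1 ← c-[Γ,Γ] p =
      ⁻¹∈ x∈Γ , trans (sym (*-identityˡ _)) (trans (*-congʳ (sym cx≈1)) (c-inverse x∈Γ (⁻¹∈ x∈Γ) (G.inverseʳ x)))
    c-[Γ,Γ] (G.resp x≈y p) with x∈Γ , cx≈1 ← c-[Γ,Γ] p =
      Γ-resp x≈y x∈Γ , trans (c-cong a∈Ω b∈Ω (Γ-resp x≈y x∈Γ) x∈Γ (G.sym x≈y)) cx≈1

  -- An involution normalising Γ, and the sign attached to its fixed points.

  module Involution {s : G.Carrier} (s²≈ε : s ∙ s G.≈ G.ε) (normalises : Normalises s)
                    {o e : P} (o∈Ω : o ∈ Ω) (e∈Ω : e ∈ Ω) (o≭e : o ≭ e)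
                    (os≋o : o ◂ s ≋ o) (es≋e : e ◂ s ≋ e) where

    s⁻¹≈s : s G.⁻¹ G.≈ s
    s⁻¹≈s = G.sym (G.inverseˡ-unique s s s²≈ε)

    ◂-s-s : ∀ p → p ◂ s ◂ s ≋ p
    ◂-s-s p = X.trans (X.sym (◂-∙ p s s)) (X.trans (◂-congʳ s²≈ε) (◂-ε p))

    conj : G.Carrier → G.Carrier
    conj δ = s ∙ δ ∙ s

    conj∈ : ∀ {δ} → δ ∈ Γ → conj δ ∈ Γ
    conj∈ δ∈Γ = Γ-resp (G.∙-congˡ s⁻¹≈s) (proj₁ normalises δ∈Γ)

    conj-cong : ∀ {δ δ′} → δ G.≈ δ′ → conj δ G.≈ conj δ′
    conj-cong eq = G.∙-congʳ (G.∙-congˡ eq)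

    conj-involutive : ∀ δ → conj (conj δ) G.≈ δ
    conj-involutive δ = begin
      s ∙ (s ∙ δ ∙ s) ∙ s        ≈⟨ G.assoc _ _ _ ⟩
      s ∙ (s ∙ δ ∙ s ∙ s)        ≈⟨ G.∙-congˡ (cancelʳ (s ∙ δ)) ⟩
      s ∙ (s ∙ δ)                ≈⟨ G.assoc _ _ _ ⟨
      s ∙ s ∙ δ                  ≈⟨ G.∙-congʳ s²≈ε ⟩
      G.ε ∙ δ                    ≈⟨ G.identityˡ δ ⟩
      δ                          ∎
      where
      open ≈-Reasoning G.setoid
      cancelʳ : ∀ x → x ∙ s ∙ s G.≈ x
      cancelʳ x = G.trans (G.assoc x s s) (G.trans (G.∙-congˡ s²≈ε) (G.identityʳ x))

    conj-ε : conj G.ε G.≈ G.ε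
    conj-ε = G.trans (G.∙-congʳ (G.identityʳ s)) s²≈ε

    ◂-conj : ∀ {p} δ → p ◂ s ≋ p → p ◂ conj δ ≋ p ◂ δ ◂ s
    ◂-conj {p} δ ps≋p = begin
      p ◂ (s ∙ δ ∙ s)    ≈⟨ ◂-∙ p _ s ⟩
      p ◂ (s ∙ δ) ◂ s    ≈⟨ ◂-congˡ (◂-∙ p s δ) ⟩
      p ◂ s ◂ δ ◂ s      ≈⟨ ◂-congˡ (◂-congˡ ps≋p) ⟩
      p ◂ δ ◂ s          ∎
      where open X-Reasoning

    module _ {u : P} (u∈Ω : u ∈ Ω) (u∉o : u ∉ Orbit o) (u∉e : u ∉ Orbit e) (us≭u : u ◂ s ≭ u) where

      private
        us∉ : ∀ {p} → p ◂ s ≋ p → u ∉ Orbit p → u ◂ s ∉ Orbit p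
        us∉ {p} ps≋p u∉p (δ , δ∈Γ , pδ≋us) = u∉p (conj δ , conj∈ δ∈Γ
          , X.trans (◂-conj δ ps≋p) (X.trans (◂-congˡ pδ≋us) (◂-s-s u)))

        us∉o = us∉ os≋o u∉o
        us∉e = us∉ es≋e u∉e

      -- Given a third fixed point `v`, invariance under `s` equates the cross ratios of (us, v; o,
      -- e) and (u, v; o, e). Then (us, u; o, e) has cross ratio 1, which forces us = u.
      fixed-point : ∀ {v} → v ◂ s ≋ v → v ≋ o ⊎ v ≋ e
      fixed-point {v} vs≋v with v ≟P o | v ≟P e
      ... | yes v≋o | _       = inj₁ v≋o
      ... | no  _   | yes v≋e = inj₂ v≋e
      ... | no  v≭o | no  v≭e = contradiction
        (crossRatio≈1 (∉Orbit⇒≭₀ us∉e) (∉Orbit⇒≭₀ u∉o) o≭e (begin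
          crossRatio (u ◂ s) u o e
            ≈⟨ crossRatio-trans (∉Orbit⇒≭₀ us∉e) v≭o v≭e (∉Orbit⇒≭₀ u∉o) ⟨
          crossRatio (u ◂ s) v o e * crossRatio v u o e
            ≈⟨ *-congʳ (crossRatio-cong X.refl (X.sym vs≋v) (X.sym os≋o) (X.sym es≋e) (∉Orbit⇒≭₀ us∉e) v≭o) ⟩
          crossRatio (u ◂ s) (v ◂ s) (o ◂ s) (e ◂ s) * crossRatio v u o e
            ≈⟨ *-congʳ (crossRatio-◂ s (∉Orbit⇒≭₀ u∉e) v≭o) ⟩
          crossRatio u v o e * crossRatio v u o e
            ≈⟨ crossRatio-swap (∉Orbit⇒≭₀ u∉o) (∉Orbit⇒≭₀ u∉e) v≭o v≭e ⟩
          1# ∎)) us≭u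
        where open ≈-Reasoning setoid

      -- An element commuting with `s` permutes `o` and `e`. If it fixes one of them it is trivial;
      -- if it exchanges them its square is trivial, and Γ has no torsion.
      conj-fixed : ∀ {δ} → δ ∈ Γ → conj δ G.≈ δ → δ G.≈ G.ε
      conj-fixed {δ} δ∈Γ fixed
        with fixed-point (X.trans (X.sym (◂-conj δ os≋o)) (◂-congʳ fixed))
           | fixed-point (X.trans (X.sym (◂-conj δ es≋e)) (◂-congʳ fixed))
      ... | inj₁ oδ≋o | _         = stabiliser-trivial o∈Ω δ∈Γ oδ≋o
      ... | inj₂ _    | inj₂ eδ≋e = stabiliser-trivial e∈Ω δ∈Γ eδ≋e
      ... | inj₂ oδ≋e | inj₁ eδ≋o = x∙x≈ε⇒x≈ε torsionFree δ∈Γ (stabiliser-trivial o∈Ω (∙∈ δ∈Γ δ∈Γ)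
        (X.trans (◂-∙ o δ δ) (X.trans (◂-congˡ oδ≋e) eδ≋o)))

      f : G.Carrier → Carrier
      f δ = crossRatio (u ◂ s) u (o ◂ δ) (e ◂ δ)

      f-cong : ∀ {δ δ′} → δ ∈ Γ → δ G.≈ δ′ → f δ ≈ f δ′
      f-cong δ∈Γ eq = crossRatio-cong X.refl X.refl (◂-congʳ eq) (◂-congʳ eq)
        (∉Orbit⇒≭ us∉e δ∈Γ) (∉Orbit⇒≭ u∉o δ∈Γ)

      -- Applying `s` to the factor at `conj δ` carries its last two points to those at δ but
      -- exchanges `u` and `u ◂ s`, which inverts the cross ratio.
      f-conj : ∀ {δ} → δ ∈ Γ → f δ * f (conj δ) ≈ 1#
      f-conj {δ} δ∈Γ = begin
        f δ * crossRatio (u ◂ s) u (o ◂ conj δ) (e ◂ conj δ)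
          ≈⟨ *-congˡ (crossRatio-cong X.refl (X.sym (◂-s-s u)) (◂-conj δ os≋o) (◂-conj δ es≋e)
               (∉Orbit⇒≭ us∉e (conj∈ δ∈Γ)) (∉Orbit⇒≭ u∉o (conj∈ δ∈Γ))) ⟩
        f δ * crossRatio (u ◂ s) (u ◂ s ◂ s) (o ◂ δ ◂ s) (e ◂ δ ◂ s)
          ≈⟨ *-congˡ (crossRatio-◂ s (∉Orbit⇒≭ u∉e δ∈Γ) (∉Orbit⇒≭ us∉o δ∈Γ)) ⟩
        f δ * crossRatio u (u ◂ s) (o ◂ δ) (e ◂ δ)
          ≈⟨ crossRatio-swap (∉Orbit⇒≭ us∉o δ∈Γ) (∉Orbit⇒≭ us∉e δ∈Γ) (∉Orbit⇒≭ u∉o δ∈Γ) (∉Orbit⇒≭ u∉e δ∈Γ) ⟩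
        1# ∎
        where open ≈-Reasoning setoid

      -- o, e, u, us are in harmonic position.
      f-ε : f G.ε ≈ - 1#
      f-ε with x²≈1⇒x≈±1 (trans (*-congˡ (f-cong ε∈ (G.sym conj-ε))) (f-conj ε∈))
      ... | inj₂ fε≈-1 = fε≈-1
      ... | inj₁ fε≈1  = contradiction
        (crossRatio≈1 (∉Orbit⇒≭ us∉e ε∈) (∉Orbit⇒≭ u∉o ε∈)
          (λ eq → o≭e (X.trans (X.sym (◂-ε o)) (X.trans eq (◂-ε e)))) fε≈1) us≭u

      private
        open Membership G.setoid using () renaming (_∈_ to _∈ₗ_; _∉_ to _∉ₗ_)
        open Uniqueness G.setoid using (Unique)
        open Subset G.setoid using (_⊆_)

        -- `ε∈T` and `closed` serve the induction: for a δ outside `T` they show that `conj δ`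
        -- differs from δ and is outside `T` as well.
        record Symmetric (S : List G.Carrier) : Set ℓ where
          field
            T      : List G.Carrier
            T⊆Γ    : All Γ T
            unique : Unique T
            S⊆T    : S ⊆ T
            ε∈T    : G.ε ∈ₗ T
            closed : ∀ {δ} → δ ∈ₗ T → conj δ ∈ₗ T
            ∏T     : ∏ f T ≈ - 1#

      -- Apart from δ = ε, the elements of Γ come in pairs {δ, sδs} whose
      -- factors cancel.
      symmetric : ∀ {S} → All Γ S → Symmetric S
      symmetric [] = record
        { T      = G.ε ∷ []
        ; T⊆Γ    = ε∈ ∷ []
        ; unique = [] ∷ []
        ; S⊆T    = λ ()
        ; ε∈T    = here G.refl
        ; closed = λ { (here δ≈ε) → here (G.trans (conj-cong δ≈ε) conj-ε) }
        ; ∏T     = trans (*-identityʳ _) f-ε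
        }
      symmetric {δ ∷ S} (δ∈Γ ∷ S⊆Γ) with S′ ← symmetric S⊆Γ
        with Any.any? (δ ≟G_) (Symmetric.T S′)
      ... | yes δ∈T = record
        { Symmetric S′ ; S⊆T = λ { (here x≈δ) → ∈.∈-resp-≈ G.setoid (G.sym x≈δ) δ∈T
                                 ; (there x∈S) → Symmetric.S⊆T S′ x∈S } }
      ... | no  δ∉T = record
        { T      = δ ∷ conj δ ∷ T
        ; T⊆Γ    = δ∈Γ ∷ conj∈ δ∈Γ ∷ T⊆Γ
        ; unique = (δ≉conj-δ ∷ distinct δ∉T) ∷ distinct conj-δ∉T ∷ unique
        ; S⊆T    = λ { (here x≈δ) → here x≈δ ; (there x∈S) → there (there (S⊆T x∈S)) }
        ; ε∈T    = there (there ε∈T)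
        ; closed = λ { (here x≈δ)          → there (here (conj-cong x≈δ))
                     ; (there (here x≈δ′)) → here (G.trans (conj-cong x≈δ′) (conj-involutive δ))
                     ; (there (there x∈T)) → there (there (closed x∈T)) }
        ; ∏T     = begin
            f δ * (f (conj δ) * ∏ f T)   ≈⟨ *-assoc _ _ _ ⟨
            f δ * f (conj δ) * ∏ f T     ≈⟨ *-cong (f-conj δ∈Γ) ∏T ⟩
            1# * - 1#                    ≈⟨ *-identityˡ _ ⟩
            - 1#                         ∎
        }
        where
        open Symmetric S′
        open ≈-Reasoning setoid
        distinct : ∀ {x} → x ∉ₗ T → All (λ y → ¬ x G.≈ y) T
        distinct x∉T = All.¬Any⇒All¬ T x∉T
        δ≉conj-δ : ¬ δ G.≈ conj δ
        δ≉conj-δ eq = δ∉T (∈.∈-resp-≈ G.setoid (G.sym (conj-fixed δ∈Γ (G.sym eq))) ε∈T)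
        conj-δ∉T : conj δ ∉ₗ T
        conj-δ∉T conj-δ∈T = δ∉T (∈.∈-resp-≈ G.setoid (conj-involutive δ) (closed conj-δ∈T))

      -- The symmetric finite sets are cofinal and the product over each is exactly `- 1#`. The
      -- condition on γ makes its factors agree with `f`.
      c≈-1 : ∀ {γ} → γ ∈ Γ → u ◂ γ ≋ u ◂ s → u ≭ ∞ → u ◂ s ≭ ∞ → c o e γ ≈ - 1#
      c≈-1 {γ} γ∈Γ uγ≋us u≭∞ us≭∞ = sym (HasProduct-cofinal
        (c-product o∈Ω e∈Ω γ∈Γ u∈Ω u∉o u∉e u≭∞ (λ uγ≋∞ → us≭∞ (X.trans (X.sym uγ≋us) uγ≋∞)))
        (λ S⊆Γ → let open Symmetric (symmetric S⊆Γ) in T , T⊆Γ , unique , S⊆T ,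
          trans (∏-cong (λ δ∈Γ → crossRatio-cong uγ≋us X.refl X.refl X.refl
            (∉Orbit⇒≭ (∉Orbit-◂ γ∈Γ u∉e) δ∈Γ) (∉Orbit⇒≭ u∉o δ∈Γ)) T⊆Γ) ∏T))

    module _ {t : G.Carrier} (ts∈Γ : t ∙ s ∈ Γ) (ts≉ε : ¬ t ∙ s G.≈ G.ε) where

      private
        ◂-ts : ∀ {v} → v ◂ t ≋ v → v ◂ (t ∙ s) ≋ v ◂ s
        ◂-ts {v} vt≋v = X.trans (◂-∙ v t s) (◂-congˡ vt≋v)

        s-moves : ∀ {v} → v ∈ Ω → v ◂ t ≋ v → v ◂ s ≭ v
        s-moves v∈Ω vt≋v vs≋v = ts≉ε (stabiliser-trivial v∈Ω ts∈Γ (X.trans (◂-ts vt≋v) vs≋v))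

        -- Otherwise `t ∙ s` would send `p` to `q` and `q` back to `p`, so its square would fix an
        -- ordinary point.
        ¬swapped : ∀ {p q} → p ∈ Ω → p ◂ t ≋ p → q ◂ t ≋ q → p ≋ ∞ → ¬ q ◂ s ≋ ∞
        ¬swapped {p} {q} p∈Ω pt≋p qt≋q p≋∞ qs≋∞ = ts≉ε (x∙x≈ε⇒x≈ε torsionFree ts∈Γ
          (stabiliser-trivial p∈Ω (∙∈ ts∈Γ ts∈Γ) (begin
            p ◂ (t ∙ s ∙ (t ∙ s))    ≈⟨ ◂-∙ p _ _ ⟩
            p ◂ (t ∙ s) ◂ (t ∙ s)    ≈⟨ ◂-congˡ (◂-ts pt≋p) ⟩
            p ◂ s ◂ (t ∙ s)          ≈⟨ ◂-congˡ (◂-congˡ (X.trans p≋∞ (X.sym qs≋∞))) ⟩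
            q ◂ s ◂ s ◂ (t ∙ s)      ≈⟨ ◂-congˡ (◂-s-s q) ⟩
            q ◂ (t ∙ s)              ≈⟨ ◂-ts qt≋q ⟩
            q ◂ s                    ≈⟨ X.trans qs≋∞ (X.sym p≋∞) ⟩
            p                        ∎)))
          where open X-Reasoning

      c-at-fixed-point : ∀ {p} → p ∈ Ω → p ◂ t ≋ p → p ∉ Orbit o → p ∉ Orbit e →
                         p ≭ ∞ → p ◂ s ≭ ∞ → c o e (t ∙ s) ≈ - 1#
      c-at-fixed-point p∈Ω pt≋p p∉o p∉e = c≈-1 p∈Ω p∉o p∉e (s-moves p∈Ω pt≋p) ts∈Γ (◂-ts pt≋p)

      -- The base point and its image under `s` must be finite, and one of `p`, `q` always
      -- qualifies: they cannot both be ∞ or both be sent to ∞, being distinct, and `¬swapped`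
      -- excludes the mixed cases.
      c-involutions : ∀ {p q} → p ∈ Ω → q ∈ Ω → p ≭ q → p ◂ t ≋ p → q ◂ t ≋ q →
                      p ∉ Orbit o → p ∉ Orbit e → q ∉ Orbit o → q ∉ Orbit e → c o e (t ∙ s) ≈ - 1#
      c-involutions {p} {q} p∈Ω q∈Ω p≭q pt≋p qt≋q p∉o p∉e q∉o q∉e
        with p ≟P ∞ | p ◂ s ≟P ∞ | q ≟P ∞ | q ◂ s ≟P ∞
      ... | no p≭∞  | no ps≭∞  | _       | _        = c-at-fixed-point p∈Ω pt≋p p∉o p∉e p≭∞ ps≭∞
      ... | _       | _        | no q≭∞  | no qs≭∞  = c-at-fixed-point q∈Ω qt≋q q∉o q∉e q≭∞ qs≭∞
      ... | yes p≋∞ | _        | yes q≋∞ | _        = contradiction (X.trans p≋∞ (X.sym q≋∞)) p≭q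
      ... | yes p≋∞ | _        | no _    | yes qs≋∞ = contradiction qs≋∞ (¬swapped p∈Ω pt≋p qt≋q p≋∞)
      ... | no _    | yes ps≋∞ | yes q≋∞ | _        = contradiction ps≋∞ (¬swapped q∈Ω qt≋q pt≋p q≋∞)
      ... | no _    | yes ps≋∞ | no _    | yes qs≋∞ = contradiction
        (X.trans (X.sym (◂-s-s p)) (X.trans (◂-congˡ (X.trans ps≋∞ (X.sym qs≋∞))) (◂-s-s q))) p≭q

-- Parity of letters in a free product of groups of order two.

module FreeProduct {g ℓ} (G : Group g ℓ) where
  open Group G
  open GroupTheory G

  module OfInvolutions {n} (σ : Fin n → Carrier)
    (σ² : ∀ i → σ i ∙ σ i ≈ ε) (σ≉ε : ∀ i → ¬ σ i ≈ ε)
    (reduced≉ε : ∀ s w → IsReduced (λ i → ⟨ (_≈ σ i) ⟩) (s ∷ w) → ¬ product (map proj₂ (s ∷ w)) ≈ ε) where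

    open GroupProperties G
    open ≈-Reasoning setoid

    value : List (Fin n) → Carrier
    value w = product (map σ w)

    value-++ : ∀ v w → value (v ++ w) ≈ value v ∙ value w
    value-++ []      w = sym (identityˡ _)
    value-++ (i ∷ v) w = trans (∙-congˡ (value-++ v w)) (sym (assoc _ _ _))

    value-reverse : ∀ w → value (reverse w) ≈ value w ⁻¹
    value-reverse []      = sym ε⁻¹≈ε
    value-reverse (i ∷ w) = begin
      value (reverse (i ∷ w))          ≡⟨ ≡.cong value (List.unfold-reverse i w) ⟩
      value (reverse w ++ (i ∷ []))       ≈⟨ value-++ (reverse w) (i ∷ []) ⟩
      value (reverse w) ∙ (σ i ∙ ε)    ≈⟨ ∙-cong (value-reverse w) (trans (identityʳ _) (inverseˡ-unique (σ i) (σ i) (σ² i))) ⟩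
      value w ⁻¹ ∙ σ i ⁻¹              ≈⟨ ⁻¹-anti-homo-∙ (σ i) (value w) ⟨
      (σ i ∙ value w) ⁻¹               ∎

    occurs : Fin n → Fin n → Parity
    occurs k i with k Fin.≟ i
    ... | yes _ = 1ℙ
    ... | no  _ = 0ℙ

    parity : Fin n → List (Fin n) → Parity
    parity k []      = 0ℙ
    parity k (i ∷ w) = occurs k i ⊞ parity k w

    parity-++ : ∀ k v w → parity k (v ++ w) ≡ parity k v ⊞ parity k w
    parity-++ k []      w = ≡.refl
    parity-++ k (i ∷ v) w = ≡.trans (≡.cong (occurs k i ⊞_) (parity-++ k v w)) (≡.sym (ℙ.+-assoc (occurs k i) _ _))

    parity-reverse : ∀ k w → parity k (reverse w) ≡ parity k w
    parity-reverse k []      = ≡.refl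
    parity-reverse k (i ∷ w) = ≡.trans (≡.cong (parity k) (List.unfold-reverse i w))
      (≡.trans (parity-++ k (reverse w) (i ∷ []))
        (≡.trans (≡.cong₂ _⊞_ (parity-reverse k w) (ℙ.+-identityʳ (occurs k i))) (ℙ.+-comm (parity k w) (occurs k i))))

    linked-or-repeats : ∀ (w : List (Fin n)) → Linked _≢_ w ⊎ ∃[ u ] ∃[ i ] ∃[ v ] w ≡ u ++ i ∷ i ∷ v
    linked-or-repeats []          = inj₁ []
    linked-or-repeats (i ∷ [])    = inj₁ [-]
    linked-or-repeats (i ∷ j ∷ w) with i Fin.≟ j | linked-or-repeats (j ∷ w)
    ... | yes ≡.refl | _                     = inj₂ ([] , i , w , ≡.refl)
    ... | no  i≢j    | inj₁ l                = inj₁ (i≢j ∷ l)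
    ... | no  _      | inj₂ (u , k , v , eq) = inj₂ (i ∷ u , k , v , ≡.cong (i ∷_) eq)

    reduced : ∀ {w} → Linked _≢_ w → IsReduced (λ i → ⟨ (_≈ σ i) ⟩) (map (λ i → i , σ i) w)
    reduced l = All.map⁺ (All.universal (λ i → gen refl , σ≉ε i) _) , Linked.map⁺ l

    linked⇒[] : ∀ w → Linked _≢_ w → value w ≈ ε → w ≡ []
    linked⇒[] []      l eq = ≡.refl
    linked⇒[] (i ∷ w) l eq = contradiction
      (trans (reflexive (≡.cong product (≡.sym (List.map-∘ (i ∷ w))))) eq)
      (reduced≉ε _ _ (reduced l))

    -- Deleting two equal neighbouring letters changes neither value nor parity; a word without such
    -- neighbours is reduced, so it has value `ε` only if it is empty. The bound `m` makes the
    -- recursion structural.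
    value≈ε⇒even : ∀ k m w → length w ℕ.≤ m → value w ≈ ε → parity k w ≡ 0ℙ
    value≈ε⇒even k m w len eq = by-cases m w len eq (linked-or-repeats w)
      where
      by-cases : ∀ m w → length w ℕ.≤ m → value w ≈ ε →
                 Linked _≢_ w ⊎ ∃[ u ] ∃[ i ] ∃[ v ] w ≡ u ++ i ∷ i ∷ v → parity k w ≡ 0ℙ
      by-cases m       w len eq (inj₁ l) = ≡.cong (parity k) (linked⇒[] w l eq)
      -- Splitting the prefix makes the length visibly a successor.
      by-cases zero    _ len eq (inj₂ ([]    , i , v , ≡.refl)) = contradiction len λ ()
      by-cases zero    _ len eq (inj₂ (j ∷ u , i , v , ≡.refl)) = contradiction len λ ()
      by-cases (suc m) _ len eq (inj₂ (u , i , v , ≡.refl)) = even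
        where
        shorter : length (u ++ v) ℕ.≤ m
        shorter = ℕ.≤-pred (ℕ.≤-trans (ℕ.≤-trans (ℕ.s≤s (ℕ.≤-reflexive (List.length-++ u)))
          (ℕ.≤-trans (ℕ.≤-reflexive (≡.sym (ℕ.+-suc (length u) (length v))))
            (ℕ.≤-trans (ℕ.+-monoʳ-≤ (length u) (ℕ.n≤1+n _)) (ℕ.≤-reflexive (≡.sym (List.length-++ u)))))) len)
        value≈ : value (u ++ v) ≈ ε
        value≈ = begin
          value (u ++ v)                     ≈⟨ value-++ u v ⟩
          value u ∙ value v                  ≈⟨ ∙-congˡ (identityˡ _) ⟨
          value u ∙ (ε ∙ value v)            ≈⟨ ∙-congˡ (∙-congʳ (σ² i)) ⟨
          value u ∙ (σ i ∙ σ i ∙ value v)    ≈⟨ ∙-congˡ (assoc _ _ _) ⟩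
          value u ∙ value (i ∷ i ∷ v)        ≈⟨ value-++ u _ ⟨
          value (u ++ i ∷ i ∷ v)             ≈⟨ eq ⟩
          ε                                  ∎
        even : parity k (u ++ i ∷ i ∷ v) ≡ 0ℙ
        even = ≡.trans (parity-++ k u _)
          (≡.trans (≡.cong (parity k u ⊞_) (≡.trans (≡.sym (ℙ.+-assoc (occurs k i) _ _))
              (≡.cong (_⊞ parity k v) (ℙ.p+p≡0ℙ (occurs k i)))))
            (≡.trans (≡.sym (parity-++ k u v)) (value≈ε⇒even k m (u ++ v) shorter value≈)))

    -- The word i w k w⁻¹ would have value `ε`, yet `k` occurs in it an odd number of times.
    not-conjugate : ∀ {i k} w → k ≢ i → ¬ value w ∙ σ k ≈ σ i ∙ value w
    not-conjugate {i} {k} w k≢i eq = odd≢even (≡.trans (≡.sym odd) (value≈ε⇒even k _ word ℕ.≤-refl value≈))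
      where
      odd≢even : 1ℙ ≢ 0ℙ
      odd≢even ()
      word = (i ∷ w) ++ (k ∷ reverse w)
      value≈ : value word ≈ ε
      value≈ = begin
        value word                                 ≈⟨ value-++ (i ∷ w) _ ⟩
        σ i ∙ value w ∙ (σ k ∙ value (reverse w))  ≈⟨ ∙-cong (sym eq) (∙-congˡ (value-reverse w)) ⟩
        value w ∙ σ k ∙ (σ k ∙ value w ⁻¹)         ≈⟨ assoc _ _ _ ⟩
        value w ∙ (σ k ∙ (σ k ∙ value w ⁻¹))       ≈⟨ ∙-congˡ (assoc _ _ _) ⟨
        value w ∙ (σ k ∙ σ k ∙ value w ⁻¹)         ≈⟨ ∙-congˡ (∙-congʳ (σ² k)) ⟩
        value w ∙ (ε ∙ value w ⁻¹)                 ≈⟨ ∙-congˡ (identityˡ _) ⟩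
        value w ∙ value w ⁻¹                       ≈⟨ inverseʳ _ ⟩
        ε                                          ∎
      occurs-self : occurs k k ≡ 1ℙ
      occurs-self with k Fin.≟ k
      ... | yes _  = ≡.refl
      ... | no k≢k = contradiction ≡.refl k≢k
      occurs-other : occurs k i ≡ 0ℙ
      occurs-other with k Fin.≟ i
      ... | yes k≡i = contradiction k≡i k≢i
      ... | no _    = ≡.refl
      odd : parity k word ≡ 1ℙ
      odd = ≡.trans (parity-++ k (i ∷ w) _)
        (≡.trans (≡.cong₂ _⊞_ (≡.cong (_⊞ parity k w) occurs-other) (≡.cong₂ _⊞_ occurs-self (parity-reverse k w)))
          (half (parity k w)))
        where
        half : ∀ p → p ⊞ (1ℙ ⊞ p) ≡ 1ℙ
        half 0ℙ = ≡.refl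
        half 1ℙ = ≡.refl

-- The multipliers of a hyperelliptic Schottky group.

module HyperellipticGroup
    {ℓ} {ℝ : CompleteOrderedField ℓ} {𝕂 : CompleteNonArchimedeanField ℝ}
    {G : Group ℓ ℓ} {X : Setoid ℓ ℓ} {A : RightAction G X}
    {Γ : Pred (Group.Carrier G) ℓ} (U : Uniformisation 𝕂 A Γ) where
  open Group G using (_∙_; ε; _⁻¹) renaming (_≈_ to _~_)
  open GroupTheory G
  open Uniformisation U

  module FixedPoints
      {n} (σ : Fin (suc n) → Group.Carrier G) (o e : Fin (suc n) → P)
      (σ² : ∀ i → σ i ∙ σ i ~ ε) (σ≁ε : ∀ i → ¬ σ i ~ ε)
      (reduced≁ε : ∀ s w → IsReduced (λ i → ⟨ (_~ σ i) ⟩) (s ∷ w) → ¬ product (map proj₂ (s ∷ w)) ~ ε)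
      (normalizes : ∀ γ → γ ∈ Γ → σ zero ∙ γ ∙ σ zero ⁻¹ ∈ Γ)
      (inverts : ∀ γ → γ ∈ Γ → γ ∙ σ zero ∙ γ ∙ σ zero ⁻¹ ∈ [ Γ , Γ ])
      (ξ∈Γ : ∀ i → σ (suc i) ∙ σ zero ∈ Γ)
      (Γ⊆⟨ξ⟩ : ∀ {γ} → γ ∈ Γ → γ ∈ ⟨ (λ x → ∃[ i ] x ~ σ (suc i) ∙ σ zero) ⟩)
      (o-fixed : ∀ i → o i ◂ σ i ≋ o i) (e-fixed : ∀ i → e i ◂ σ i ≋ e i) (o≭e : ∀ i → o i ≭ e i)
      (o∈Ω : ∀ i → o i ∈ Ω) (e∈Ω : ∀ i → e i ∈ Ω) where

    private
      module G where
        open Group G public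
        open GroupProperties G public
      module X = Setoid X
      module ~-Reasoning = ≈-Reasoning G.setoid
      module ≋-Reasoning = ≈-Reasoning X
    open MonoidSolver G.monoid using (_⊕_; _⊜_) renaming (solve to solveG)
    open CompleteNonArchimedeanField 𝕂 hiding (_^_; _⁻¹)
    open FieldProperties field′
    open IntegerCoefficients commutativeRing
    open ActionProperties A
    open SubgroupProperties G isSubgroup
    open IsSubgroup isSubgroup renaming (resp to Γ-resp)
    open Multipliers U
    open FreeProduct.OfInvolutions G σ σ² σ≁ε reduced≁ε

    σ₀ : G.Carrier
    σ₀ = σ zero

    ξ : Fin n → G.Carrier
    ξ i = σ (suc i) ∙ σ₀

    σ⁻¹~σ : ∀ i → σ i ⁻¹ ~ σ i
    σ⁻¹~σ i = G.sym (G.inverseˡ-unique (σ i) (σ i) (σ² i))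

    Normalises-resp : ∀ {τ τ′} → τ ~ τ′ → Normalises τ → Normalises τ′
    Normalises-resp eq (p , q) =
        (λ γ∈Γ → Γ-resp (G.∙-cong (G.∙-congʳ eq) (G.⁻¹-cong eq)) (p γ∈Γ))
      , (λ γ∈Γ → Γ-resp (G.∙-cong (G.∙-congʳ (G.⁻¹-cong eq)) eq) (q γ∈Γ))

    Normalises-∙ : ∀ {τ υ} → Normalises τ → Normalises υ → Normalises (τ ∙ υ)
    Normalises-∙ {τ} {υ} (p , p′) (q , q′) =
        (λ {γ} γ∈Γ → Γ-resp (G.trans
          (solveG 5 (λ τ υ γ υ′ τ′ → (τ ⊕ ((υ ⊕ γ) ⊕ υ′)) ⊕ τ′ ⊜ ((τ ⊕ υ) ⊕ γ) ⊕ (υ′ ⊕ τ′)) G.refl τ υ γ (υ ⁻¹) (τ ⁻¹))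
          (G.∙-congˡ (G.sym (G.⁻¹-anti-homo-∙ τ υ)))) (p (q γ∈Γ)))
      , (λ {γ} γ∈Γ → Γ-resp (G.trans
          (solveG 5 (λ τ υ γ υ′ τ′ → (υ′ ⊕ ((τ′ ⊕ γ) ⊕ τ)) ⊕ υ ⊜ ((υ′ ⊕ τ′) ⊕ γ) ⊕ (τ ⊕ υ)) G.refl τ υ γ (υ ⁻¹) (τ ⁻¹))
          (G.∙-congʳ (G.∙-congʳ (G.sym (G.⁻¹-anti-homo-∙ τ υ))))) (q′ (p′ γ∈Γ)))

    σ₀-normalises : Normalises σ₀
    σ₀-normalises = (λ γ∈Γ → normalizes _ γ∈Γ)
      , (λ γ∈Γ → Γ-resp (G.∙-cong (G.∙-congʳ (G.sym (σ⁻¹~σ zero))) (σ⁻¹~σ zero)) (normalizes _ γ∈Γ))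

    σσ₀∈Γ : ∀ k → σ k ∙ σ₀ ∈ Γ
    σσ₀∈Γ zero    = Γ-resp (G.sym (σ² zero)) ε∈
    σσ₀∈Γ (suc i) = ξ∈Γ i

    σσ₀σ₀~σ : ∀ k → σ k ∙ σ₀ ∙ σ₀ ~ σ k
    σσ₀σ₀~σ k = G.trans (G.assoc _ _ _) (G.trans (G.∙-congˡ (σ² zero)) (G.identityʳ _))

    σ-normalises : ∀ k → Normalises (σ k)
    σ-normalises k = Normalises-resp (σσ₀σ₀~σ k) (Normalises-∙ (Γ-normalises (σσ₀∈Γ k)) σ₀-normalises)

    σσ∈Γ : ∀ k i → σ k ∙ σ i ∈ Γ
    σσ∈Γ k i = Γ-resp (begin
      σ k ∙ σ₀ ∙ (σ i ∙ σ₀) ⁻¹     ≈⟨ G.∙-congˡ (G.⁻¹-anti-homo-∙ _ _) ⟩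
      σ k ∙ σ₀ ∙ (σ₀ ⁻¹ ∙ σ i ⁻¹)  ≈⟨ G.assoc _ _ _ ⟨
      σ k ∙ σ₀ ∙ σ₀ ⁻¹ ∙ σ i ⁻¹    ≈⟨ G.∙-cong (G.//-rightDividesʳ σ₀ (σ k)) (σ⁻¹~σ i) ⟩
      σ k ∙ σ i                    ∎) (x∙y⁻¹∈ (σσ₀∈Γ k) (σσ₀∈Γ i))
      where open ~-Reasoning

    ⟨ξ⟩-word : ∀ {γ} → γ ∈ ⟨ (λ x → ∃[ i ] x ~ σ (suc i) ∙ σ zero) ⟩ → ∃[ w ] value w ~ γ
    ⟨ξ⟩-word (gen (i , γ~ξ)) = suc i ∷ zero ∷ [] , G.trans (G.∙-congˡ (G.identityʳ σ₀)) (G.sym γ~ξ)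
    ⟨ξ⟩-word unit            = [] , G.refl
    ⟨ξ⟩-word (mul p q) with v , v~ ← ⟨ξ⟩-word p | w , w~ ← ⟨ξ⟩-word q =
      v ++ w , G.trans (value-++ v w) (G.∙-cong v~ w~)
    ⟨ξ⟩-word (inv p) with v , v~ ← ⟨ξ⟩-word p = reverse v , G.trans (value-reverse v) (G.⁻¹-cong v~)
    ⟨ξ⟩-word (resp x~y p) with v , v~ ← ⟨ξ⟩-word p = v , G.trans v~ x~y

    σ-not-conjugate : ∀ {i k γ} → k ≢ i → γ ∈ Γ → ¬ γ ∙ σ k ~ σ i ∙ γ
    σ-not-conjugate k≢i γ∈Γ eq with w , w~γ ← ⟨ξ⟩-word (Γ⊆⟨ξ⟩ γ∈Γ) =
      not-conjugate w k≢i (G.trans (G.∙-congʳ w~γ) (G.trans eq (G.∙-congˡ (G.sym w~γ))))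

    -- If pγ = u, then γ⁻¹σᵢγ also fixes `u`, and so does β = σₖγ⁻¹σᵢγ. Being the product of
    -- σₖγ⁻¹σₖ⁻¹ and σₖσᵢγ, β lies in Γ and is therefore trivial, which makes σₖ and σᵢ conjugate.
    fixed-points-inequivalent : ∀ {i k u p} → k ≢ i → u ∈ Ω → u ◂ σ k ≋ u → p ◂ σ i ≋ p → u ∉ Orbit p
    fixed-points-inequivalent {i} {k} {u} {p} k≢i u∈Ω uσ≋u pσ≋p (γ , γ∈Γ , pγ≋u) = σ-not-conjugate k≢i γ∈Γ (begin
      γ ∙ σ k                    ≈⟨ G.∙-congˡ (G.trans (G.sym (σ⁻¹~σ k)) (G.sym (G.inverseʳ-unique _ _ β~ε))) ⟩
      γ ∙ (γ ⁻¹ ∙ (σ i ∙ γ))     ≈⟨ G.\\-leftDividesˡ γ _ ⟩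
      σ i ∙ γ                    ∎)
      where
      open ~-Reasoning
      β = σ k ∙ (γ ⁻¹ ∙ (σ i ∙ γ))
      β∈Γ : β ∈ Γ
      β∈Γ = Γ-resp (begin
        σ k ∙ γ ⁻¹ ∙ σ k ⁻¹ ∙ (σ k ∙ σ i ∙ γ)    ≈⟨ G.assoc _ _ _ ⟩
        σ k ∙ γ ⁻¹ ∙ (σ k ⁻¹ ∙ (σ k ∙ σ i ∙ γ))  ≈⟨ G.∙-congˡ (G.trans (G.∙-congˡ (G.assoc _ _ _)) (G.\\-leftDividesʳ (σ k) _)) ⟩
        σ k ∙ γ ⁻¹ ∙ (σ i ∙ γ)                   ≈⟨ G.assoc _ _ _ ⟩
        β                                        ∎)
        (∙∈ (proj₁ (σ-normalises k) (⁻¹∈ γ∈Γ)) (∙∈ (σσ∈Γ k i) γ∈Γ))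
      uβ≋u : u ◂ β ≋ u
      uβ≋u = ≋-Reasoning.begin
        u ◂ β                          ≋-Reasoning.≈⟨ ◂-∙ u _ _ ⟩
        u ◂ σ k ◂ (γ ⁻¹ ∙ (σ i ∙ γ))   ≋-Reasoning.≈⟨ ◂-congˡ uσ≋u ⟩
        u ◂ (γ ⁻¹ ∙ (σ i ∙ γ))         ≋-Reasoning.≈⟨ ◂-∙ u _ _ ⟩
        u ◂ γ ⁻¹ ◂ (σ i ∙ γ)           ≋-Reasoning.≈⟨ ◂-congˡ (◂-⁻¹ pγ≋u) ⟩
        p ◂ (σ i ∙ γ)                  ≋-Reasoning.≈⟨ ◂-∙ p _ _ ⟩
        p ◂ σ i ◂ γ                    ≋-Reasoning.≈⟨ ◂-congˡ pσ≋p ⟩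
        p ◂ γ                          ≋-Reasoning.≈⟨ pγ≋u ⟩
        u                              ≋-Reasoning.∎
      β~ε : β ~ ε
      β~ε = stabiliser-trivial u∈Ω β∈Γ uβ≋u

    -- The index zero is included on both sides: `i` zero is claim (1), and `k` zero is the source
    -- of the diagonal case of (4).
    c-σσ : ∀ i k → k ≢ i → c (o i) (e i) (σ k ∙ σ i) ≈ - 1#
    c-σσ i k k≢i = Involution.c-involutions (σ² i) (σ-normalises i) (o∈Ω i) (e∈Ω i) (o≭e i) (o-fixed i) (e-fixed i)
      (σσ∈Γ k i) σσ≁ε (o∈Ω k) (e∈Ω k) (o≭e k) (o-fixed k) (e-fixed k)
      (fixed-points-inequivalent k≢i (o∈Ω k) (o-fixed k) (o-fixed i))
      (fixed-points-inequivalent k≢i (o∈Ω k) (o-fixed k) (e-fixed i))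
      (fixed-points-inequivalent k≢i (e∈Ω k) (e-fixed k) (o-fixed i))
      (fixed-points-inequivalent k≢i (e∈Ω k) (e-fixed k) (e-fixed i))
      where
      σσ≁ε : ¬ σ k ∙ σ i ~ ε
      σσ≁ε eq = σ-not-conjugate k≢i ε∈ (G.trans (G.identityˡ _)
        (G.trans (G.trans (G.inverseˡ-unique _ _ eq) (σ⁻¹~σ i)) (G.sym (G.identityʳ _))))

    c-σ₀ : ∀ {a b γ} → a ∈ Ω → b ∈ Ω → γ ∈ Γ → c a b γ * c a b (σ₀ ∙ γ ∙ σ₀ ⁻¹) ≈ 1#
    c-σ₀ {a} {b} {γ} a∈Ω b∈Ω γ∈Γ with x∈Γ , cx≈1 ← c-[Γ,Γ] a∈Ω b∈Ω (inverts γ γ∈Γ) =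
      trans (sym (c-homo a∈Ω b∈Ω γ∈Γ (normalizes γ γ∈Γ)))
        (trans (c-cong a∈Ω b∈Ω (∙∈ γ∈Γ (normalizes γ γ∈Γ)) x∈Γ
          (solveG 3 (λ γ s s′ → γ ⊕ ((s ⊕ γ) ⊕ s′) ⊜ ((γ ⊕ s) ⊕ γ) ⊕ s′) G.refl γ σ₀ (σ₀ ⁻¹))) cx≈1)

    module _ (i : Fin n) where

      -- Since p is fixed by σᵢ, σ₀ carries (p, e₀) to (pξᵢ, e₀).
      c²≈c-ξ : ∀ {p γ} → p ∈ Ω → p ◂ σ (suc i) ≋ p → γ ∈ Γ →
               c p (e zero) γ * c p (e zero) γ ≈ c p (p ◂ ξ i) γ
      c²≈c-ξ {p} {γ} p∈Ω pσ≋p γ∈Γ = begin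
        x * x                    ≈⟨ *-congʳ (c-cocycle p∈Ω pξ∈Ω e₀∈Ω γ∈Γ) ⟨
        c p (p ◂ ξ i) γ * y * x  ≈⟨ *-assoc _ _ _ ⟩
        c p (p ◂ ξ i) γ * (y * x) ≈⟨ *-congˡ (trans (*-congˡ x≈) (c-σ₀ pξ∈Ω e₀∈Ω γ∈Γ)) ⟩
        c p (p ◂ ξ i) γ * 1#     ≈⟨ *-identityʳ _ ⟩
        c p (p ◂ ξ i) γ          ∎
        where
        open ≈-Reasoning setoid
        e₀∈Ω = e∈Ω zero
        pξ∈Ω = Ω-Γ p∈Ω (ξ∈Γ i)
        x = c p (e zero) γ
        y = c (p ◂ ξ i) (e zero) γ
        x≈ : x ≈ c (p ◂ ξ i) (e zero) (σ₀ ∙ γ ∙ σ₀ ⁻¹)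
        x≈ = c-transport p∈Ω e₀∈Ω pξ∈Ω e₀∈Ω σ₀-normalises
          (X.trans (◂-congˡ (X.sym pσ≋p)) (X.sym (◂-∙ p _ _))) (e-fixed zero) γ∈Γ (normalizes γ γ∈Γ)
          (G.trans (G.trans (G.∙-congˡ (G.sym (σ⁻¹~σ zero)))
              (G.sym (G.trans (G.∙-congʳ (σ² zero)) (G.identityˡ _))))
            (solveG 3 (λ s γ s′ → (s ⊕ s) ⊕ (γ ⊕ s′) ⊜ s ⊕ ((s ⊕ γ) ⊕ s′)) G.refl σ₀ γ (σ₀ ⁻¹)))

    -- Moving both `a` and `b` by ξ conjugates the argument of `c a b` inside Γ, which a
    -- homomorphism to a commutative group does not notice. The rest is the cocycle relation from
    -- `a` to `b ◂ ξ`, by way of `a ◂ ξ` or of `b`.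
    c-base-point : ∀ {a b ξ γ} → a ∈ Ω → b ∈ Ω → ξ ∈ Γ → γ ∈ Γ → c a (a ◂ ξ) γ ≈ c b (b ◂ ξ) γ
    c-base-point {a} {b} {ξ} {γ} a∈Ω b∈Ω ξ∈Γ γ∈Γ = *-cancelʳ (c-nonzero a∈Ω b∈Ω γ∈Γ) (begin
      c a (a ◂ ξ) γ * c a b γ                 ≈⟨ *-congˡ moved ⟩
      c a (a ◂ ξ) γ * c (a ◂ ξ) (b ◂ ξ) γ     ≈⟨ c-cocycle a∈Ω aξ∈Ω bξ∈Ω γ∈Γ ⟩
      c a (b ◂ ξ) γ                           ≈⟨ c-cocycle a∈Ω b∈Ω bξ∈Ω γ∈Γ ⟨
      c a b γ * c b (b ◂ ξ) γ                 ≈⟨ *-comm _ _ ⟩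
      c b (b ◂ ξ) γ * c a b γ                 ∎)
      where
      open ≈-Reasoning setoid
      aξ∈Ω = Ω-Γ a∈Ω ξ∈Γ
      bξ∈Ω = Ω-Γ b∈Ω ξ∈Γ
      γ′∈Γ = proj₂ (Γ-normalises ξ∈Γ) γ∈Γ
      γξ~ξγ′ : γ ∙ ξ ~ ξ ∙ (ξ ⁻¹ ∙ γ ∙ ξ)
      γξ~ξγ′ = G.sym (G.trans (G.∙-congˡ (G.assoc _ _ _)) (G.\\-leftDividesˡ ξ _))
      moved : c a b γ ≈ c (a ◂ ξ) (b ◂ ξ) γ
      moved = trans (c-transport a∈Ω b∈Ω aξ∈Ω bξ∈Ω (Γ-normalises ξ∈Γ) X.refl X.refl γ∈Γ γ′∈Γ γξ~ξγ′)
        (sym (c-conjugate aξ∈Ω bξ∈Ω γ∈Γ ξ∈Γ γ′∈Γ γξ~ξγ′))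

    -- `c-σσ` supplies the value at σ₀σᵢ, which is the inverse of ξᵢ.
    c-σσ₀ : ∀ i → c (o (suc i)) (e (suc i)) (ξ i) ≈ - 1#
    c-σσ₀ i = begin
      x                   ≈⟨ solve 1 (λ x → x := :- (x :* (:- con ℤ.1ℤ))) refl x ⟩
      - (x * - fromℤ ℤ.1ℤ) ≈⟨ -‿cong (*-congˡ (-‿cong (+-identityʳ 1#))) ⟩
      - (x * - 1#)        ≈⟨ -‿cong (*-congˡ (c-σσ (suc i) zero (λ ()))) ⟨
      - (x * c (o (suc i)) (e (suc i)) (σ₀ ∙ σ (suc i)))
                          ≈⟨ -‿cong (c-inverse (o∈Ω _) (e∈Ω _) (ξ∈Γ i) (σσ∈Γ zero (suc i)) ξσ₀σ~ε) ⟩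
      - 1#                ∎
      where
      open ≈-Reasoning setoid
      x = c (o (suc i)) (e (suc i)) (ξ i)
      ξσ₀σ~ε : ξ i ∙ (σ₀ ∙ σ (suc i)) ~ ε
      ξσ₀σ~ε = G.trans (G.sym (G.assoc _ _ _)) (G.trans (G.∙-congʳ (σσ₀σ₀~σ (suc i))) (σ² (suc i)))

    -- ξⱼ = (σⱼσᵢ)ξᵢ, and both factors have multiplier -1.
    c-ξ-other : ∀ i j → i ≢ j → c (o (suc i)) (e (suc i)) (ξ j) ≈ 1#
    c-ξ-other i j i≢j = begin
      c oᵢ eᵢ (ξ j)
        ≈⟨ c-cong (o∈Ω _) (e∈Ω _) (ξ∈Γ j) (∙∈ (σσ∈Γ (suc j) (suc i)) (ξ∈Γ i)) ξ~ ⟩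
      c oᵢ eᵢ (σ (suc j) ∙ σ (suc i) ∙ ξ i)
        ≈⟨ c-homo (o∈Ω _) (e∈Ω _) (σσ∈Γ (suc j) (suc i)) (ξ∈Γ i) ⟩
      c oᵢ eᵢ (σ (suc j) ∙ σ (suc i)) * c oᵢ eᵢ (ξ i)
        ≈⟨ *-cong (c-σσ (suc i) (suc j) (λ eq → i≢j (≡.sym (Fin.suc-injective eq)))) (c-σσ₀ i) ⟩
      - 1# * - 1#
        ≈⟨ solve 1 (λ x → :- x :* :- x := x :* x) refl 1# ⟩
      1# * 1#
        ≈⟨ *-identityˡ 1# ⟩
      1# ∎
      where
      open ≈-Reasoning setoid
      oᵢ = o (suc i)
      eᵢ = e (suc i)
      ξ~ : ξ j ~ σ (suc j) ∙ σ (suc i) ∙ ξ i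
      ξ~ = G.trans (G.∙-congˡ (G.sym (G.trans (G.∙-congʳ (σ² (suc i))) (G.identityˡ σ₀))))
        (solveG 3 (λ t s s₀ → t ⊕ ((s ⊕ s) ⊕ s₀) ⊜ (t ⊕ s) ⊕ (s ⊕ s₀)) G.refl (σ (suc j)) (σ (suc i)) σ₀)

-- The abstract setting realised by a Schottky group acting on the projective line.

module SchottkyUniformisation {ℓ} (em : ExcludedMiddle ℓ)
    {ℝ : CompleteOrderedField ℓ} (𝕂 : CompleteNonArchimedeanField ℝ)
    {g : ℕ} (H : Schottky.Hyperelliptic 𝕂 g)
    (T : Schottky.ThetaFunctions 𝕂 (Schottky.Hyperelliptic.Γ H)) (i₀ : Fin g) where

  open CompleteNonArchimedeanField 𝕂 using (field′; ∣_∣)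
  open Schottky 𝕂
  private
    module PGL = Group PGL₂
    module ℝ = CompleteOrderedField ℝ
    module PP = ProjectiveProperties field′
    module T = ThetaFunctions T
  open Hyperelliptic H
  open IsSchottky schottky
  open IsDiscontinuous discontinuous
  open GroupTheory PGL₂ using (_^_)

  private
    module OP = OrdinaryPoints em 𝕂 Γ isSubgroup torsionFree
    module NI = NeighbourhoodOfInfinity em 𝕂 Γ isSubgroup torsionFree ∞∈Ω
    module TM = ThetaMultipliers em 𝕂 Γ isSubgroup torsionFree T
    module SP = SubgroupProperties PGL₂ isSubgroup

  ξ∈Γ : ∀ i → ξ i ∈ Γ
  ξ∈Γ i = proj₂ (proj₁ freeBasis) (gen (i , PGL.refl {ξ i}))

  ξ≁ε : ∀ i → ¬ ξ i ~ PGL.ε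
  ξ≁ε i eq = proj₂ freeBasis (i , Sign.+) [] [-] (PGL.trans {ξ i · PGL.ε} {ξ i} {PGL.ε} (PGL.identityʳ (ξ i)) eq)

  -- The index `i₀` provides a nontrivial element of Γ; its powers are the infinitely many group
  -- elements required.
  unbounded : ∀ r → ∃[ x ] r ℝ.< ∣ x ∣
  unbounded = OP.values-unbounded (λ n → ξ i₀ ^ n) (λ n → SP.^∈ {ξ i₀} n (ξ∈Γ i₀))
    (λ m n → SP.^-injective torsionFree {ξ i₀} {m} {n} (ξ∈Γ i₀) (ξ≁ε i₀)) {∞} ∞∈Ω (orbitClosures ∞)

  uniformisation : Uniformisation 𝕂 PP.◂-action Γ
  uniformisation = record
    { _≟G_               = λ _ _ → em
    ; _≟P_               = λ _ _ → em
    ; isSubgroup         = isSubgroup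
    ; torsionFree        = torsionFree
    ; Ω                  = Ω Γ
    ; Ω-◂                = λ {u} {v} → OP.Ω-◂ {u} {v}
    ; stabiliser-trivial = λ {u} {γ} → OP.stabiliser-trivial {u} {γ}
    ; ∞                  = ∞
    ; generic            = NI.generic-ordinary unbounded
    ; crossRatio         = PP.crossRatio
    ; crossRatio-cong    = λ {u} {v} {p} {q} {u′} {v′} {p′} {q′} → PP.crossRatio-cong {u} {v} {p} {q} {u′} {v′} {p′} {q′}
    ; crossRatio-◂       = λ M {u} {v} {p} {q} → PP.crossRatio-◂ M {u} {v} {p} {q}
    ; crossRatio-cocycle = λ {u} {v} {p} {q} {r} → PP.crossRatio-cocycle {u} {v} {p} {q} {r}
    ; crossRatio-trans   = λ {u} {v} {w} {p} {q} → PP.crossRatio-trans {u} {v} {w} {p} {q}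
    ; crossRatio-swap    = λ {u} {v} {p} {q} → PP.crossRatio-swap {u} {v} {p} {q}
    ; crossRatio≈1       = λ {u} {v} {p} {q} → PP.crossRatio≈1 {u} {v} {p} {q}
    ; c                  = T.c
    ; c-cong             = λ {a} {b} {γ} {δ} → T.c-cong a b γ δ
    ; c-nonzero          = λ {a} {b} {γ} → T.c-nonzero a b γ
    ; c-homo             = λ {a} {b} {γ} {δ} → T.c-homo a b γ δ
    ; c-product          = λ {a} {b} {γ} {u} → TM.c-product {a} {b} {γ} {u}
    }

  open HyperellipticGroup.FixedPoints uniformisation σ o e
    (λ i → proj₁ (order-two i)) (λ i → proj₂ (order-two i)) (proj₂ freeProduct)
    normalizes inverts ξ∈Γ (proj₁ (proj₁ freeBasis)) o-fixed e-fixed o≭e o∈Ω e∈Ω public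
    using (c-σσ; c²≈c-ξ; c-base-point; c-σσ₀; c-ξ-other)
  open Multipliers uniformisation public using (c-cocycle)

mainTheorem10 :
    (∀ {ℓ} → ExcludedMiddle ℓ) →
    ∀ {ℓ} {ℝ : CompleteOrderedField ℓ} (𝕂 : CompleteNonArchimedeanField ℝ) →
    let open CompleteNonArchimedeanField 𝕂
        open Schottky 𝕂
    in
    AlgebraicallyClosed → CharacteristicZero →
    ∀ {g : ℕ} (H : Hyperelliptic g) →
    let open Hyperelliptic H in
    (T : ThetaFunctions Γ) →
    let open ThetaFunctions T
        o₀ = o zero
        e₀ = e zero
    in
    ∀ (i j : Fin g) →
    let oᵢ = o (suc i)
        eᵢ = e (suc i)
    in
      c o₀ e₀ (ξ i) ≈ - 1#
    × ((∀ γ → γ ∈ Γ → c oᵢ e₀ γ ^ 2 ≈ c eᵢ e₀ γ ^ 2)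
      × (∀ a γ → a ∈ Ω Γ → γ ∈ Γ → c eᵢ e₀ γ ^ 2 ≈ c a (a ◂ ξ i) γ))
    × (∀ γ → γ ∈ Γ → c oᵢ e₀ γ ≈ c oᵢ eᵢ γ * c eᵢ e₀ γ)
    × c oᵢ eᵢ (ξ j) ≈ sign i j
mainTheorem10 em 𝕂 _ _ H T i j =
    c-σσ zero (suc i) (λ ())
  -- The two squares are the multiplier of ξᵢ with base points oᵢ and eᵢ.
  , ( (λ γ γ∈Γ → trans (c²≈c-ξᵢ {o (suc i)} {γ} (o∈Ω (suc i)) (o-fixed (suc i)) γ∈Γ)
                   (trans (c-base-point {o (suc i)} {e (suc i)} {ξ i} {γ} (o∈Ω (suc i)) (e∈Ω (suc i)) (ξ∈Γ i) γ∈Γ)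
                     (sym (c²≈c-ξᵢ {e (suc i)} {γ} (e∈Ω (suc i)) (e-fixed (suc i)) γ∈Γ))))
    , (λ a γ a∈Ω γ∈Γ → trans (c²≈c-ξᵢ {e (suc i)} {γ} (e∈Ω (suc i)) (e-fixed (suc i)) γ∈Γ)
                         (c-base-point {e (suc i)} {a} {ξ i} {γ} (e∈Ω (suc i)) a∈Ω (ξ∈Γ i) γ∈Γ)) )
  , (λ γ γ∈Γ → sym (c-cocycle {o (suc i)} {e (suc i)} {e zero} {γ} (o∈Ω (suc i)) (e∈Ω (suc i)) (e∈Ω zero) γ∈Γ))
  , c-ξⱼ (i Fin.≟ j)
  where
  open CompleteNonArchimedeanField 𝕂
  open Schottky 𝕂
  open Hyperelliptic H
  open ThetaFunctions T
  open SchottkyUniformisation em 𝕂 H T i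
  c²≈c-ξᵢ : ∀ {p γ} → p ∈ Ω Γ → p ◂ σ (suc i) ≋ p → γ ∈ Γ → c p (e zero) γ ^ 2 ≈ c p (p ◂ ξ i) γ
  -- `x ^ 2` unfolds to `x * (x * 1#)`.
  c²≈c-ξᵢ {p} {γ} p∈Ω pσ≋p γ∈Γ = trans (*-congˡ (*-identityʳ _)) (c²≈c-ξ i {p} {γ} p∈Ω pσ≋p γ∈Γ)
  -- `sign` with its decision abstracted, so that matching on the decision evaluates the exponent.
  c-ξⱼ : (i≟j : Dec (i ≡ j)) → c (o (suc i)) (e (suc i)) (ξ j) ≈ (- 1#) ^ (if does i≟j then 1 else 0)
  c-ξⱼ (yes ≡.refl) = trans (c-σσ₀ i) (sym (*-identityʳ (- 1#)))
  c-ξⱼ (no i≢j)     = c-ξ-other i j i≢j
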